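{- For every integer $n\geq 9$, the independence number of the graph $\Gamma(n,1,n-3)$ equals $\binom{n}{4}+42$.
   Context: For a positive integer $n$ let $[n]=\{1,\dots,n\}$. Two subsets $X,Y\subseteq[n]$ are called opposite if $X\cap Y=\emptyset$ or $X\cup Y=[n]$. A flag of $[n]$ is a set $f$ of non-empty proper subsets of $[n]$ that is totally ordered by inclusion; its type is $\{|X| : X\in f\}$. Two flags $f_1,f_2$ are opposite if every element of $f_1$ is opposite to every element of $f_2$. For integers $1\le a<b<n$, $\Gamma(n,a,b)$ is the graph whose vertices are the flags of type $\{a,b\}$, i.e. pairs $(A,B)$ with $A\subseteq B\subseteq[n]$, $|A|=a$, $|B|=b$, two vertices being adjacent iff they are opposite as flags. For $\Gamma(n,1,n-3)$ with $n\ge 7$, vertices $(A_1,B_1),(A_2,B_2)$ are adjacent iff $B_1\cup B_2=[n]$, $A_1\cap B_2=\emptyset$ and $A_2\cap B_1=\emptyset$. The independence number is the maximum size of a set of pairwise non-adjacent vertices. -}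

module Defs where

open import Data.Nat using (ℕ; _≤_; _+_; _∸_)
open import Data.Product using (_×_; proj₁; proj₂; Σ; ∃-syntax; _,_)
open import Data.Sum using (_⊎_)
open import Data.List using (List; length)
open import Data.List.Membership.Propositional using (_∈_)
open import Data.List.Relation.Unary.All using (All)
open import Data.List.Relation.Unary.Unique.Propositional using (Unique)
open import Data.Fin.Subset using (Subset; _⊆_; _∩_; _∪_; ∣_∣; ⊥; ⊤)
open import Relation.Binary.PropositionalEquality using (_≡_; _≢_)
open import Relation.Nullary using (¬_)

Opposite : ∀ {n} → Subset n → Subset n → Set
Opposite X Y = (X ∩ Y ≡ ⊥) ⊎ (X ∪ Y ≡ ⊤)

-- A flag of type {a,b} (a < b) is a pair (A , B) with A ⊆ B, |A| = a, |B| = b.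
-- (For 1 ≤ a < b < n these are automatically non-empty proper subsets.)
Flag2 : ℕ → Set
Flag2 n = Subset n × Subset n

IsVertex : ∀ {n} → ℕ → ℕ → Flag2 n → Set
IsVertex a b (A , B) = (A ⊆ B) × (∣ A ∣ ≡ a) × (∣ B ∣ ≡ b)

OppositeFlags : ∀ {n} → Flag2 n → Flag2 n → Set
OppositeFlags (A₁ , B₁) (A₂ , B₂) =
  Opposite A₁ A₂ × Opposite A₁ B₂ × Opposite B₁ A₂ × Opposite B₁ B₂

IsIndependentSet : (n a b : ℕ) → List (Flag2 n) → Set
IsIndependentSet n a b S =
  All (IsVertex a b) S × Unique S ×
  (∀ {x y} → x ∈ S → y ∈ S → x ≢ y → ¬ OppositeFlags x y)

IsIndependenceNumber : (n a b k : ℕ) → Set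
IsIndependenceNumber n a b k =
  (Σ (List (Flag2 n)) λ S → IsIndependentSet n a b S × length S ≡ k) ×
  (∀ S → IsIndependentSet n a b S → length S ≤ k)

-- A vertex is a 4-set T = {x} ∪ C with a marked point x, and T, T′ are adjacent iff T ∩ T′ consists of the two marked
-- points.  Hence the set is independent iff for all x ≢ y the graphs F_x^y = {uv : (x, yuv) chosen} and F_y^x on the
-- remaining points are cross-intersecting.  Classifying cross-intersecting pairs of graphs (both stars with a common
-- centre, or one of them tiny) bounds |F_x^y| + |F_y^x|.
--
-- The upper bound is proved by induction on n ≥ 7, deleting a point z of small degree.  Say that y dominates z if F_y^z
-- is large while F_z^y has at most one edge.  An undominated z has degree at most C(n-1,3) if n ≥ 10; for n = 8, 9 its
-- degree is at most 3 C(n-2,2), unless so few links are large that summing |F_x^y| + |F_y^x| over all pairs suffices.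
-- If every point is dominated and n ≥ 11, a point with the least number κ of dominating points can be deleted: its links
-- miss about κ points, which compensates for the κ large links into it.  If every point is dominated and n = 8, 9, 10,
-- or if n = 7, summing |F_x^y| + |F_y^x| over all pairs, graded by the numbers of dominating points, gives the bound.
--
-- The bound is attained by taking, for the 4-sets inside {1,...,9} containing 1, the three marks other than 1, and for
-- every 4-set not inside {1,...,9} its largest element as the mark.

{-# OPTIONS --safe #-}
module Submission where

open import Defs
open import Data.Bool using (Bool; true; false; _∧_; _∨_; not; T)
import Data.Bool.Properties as Bool
import Data.Empty
open import Data.Fin using (Fin; zero; suc)
open import Data.Fin.Properties using (_≟_; any?)
open import Data.Fin.Subset using (Subset; ⁅_⁆; ∁; _∪_; _∩_; ∣_∣; inside; outside; _⊆_) renaming (⊥ to ∅; ⊤ to whole; _∈_ to _∈ₛ_; _∉_ to _∉ₛ_)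
open import Data.Fin.Subset.Properties using (Empty-unique; ⊆-antisym; ⊆-max; _⊆?_; ∪-comm; ∪-assoc; ∪-identityˡ; ∪-identityʳ; x∈⁅x⁆; x∈⁅y⁆⇒x≡y; x∈∁p⇒x∉p; x∉p⇒x∈∁p; x∉∁p⇒x∈p; x∈p⇒x∉∁p; x∈p∪q⁻; x∈p∪q⁺; x∈p∩q⁻; ∉⊥; ∣⊥∣≡0; ∣⊤∣≡n; ∣∁p∣≡n∸∣p∣) renaming (_∈?_ to _∈ₛ?_)
open import Data.List using (List; []; _∷_; _++_; length; map; filter; concatMap; allFin)
open import Data.List.Properties using (length-++; length-map)
open import Data.List.Membership.Propositional using (_∈_)
open import Data.List.Membership.Propositional.Properties using (∈-++⁻; ∈-map⁻)
open import Data.List.Relation.Unary.All as All using (All; []; _∷_)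
import Data.List.Relation.Unary.All.Properties as All
open import Data.List.Relation.Unary.AllPairs using ([]; _∷_)
open import Data.List.Relation.Unary.Any using (Any; here; there)
open import Data.List.Relation.Unary.Unique.Propositional using (Unique)
import Data.List.Relation.Unary.Unique.DecPropositional as Unique
import Data.List.Relation.Unary.Unique.Propositional.Properties as Unique
open import Data.Nat using (ℕ; zero; suc; pred; _+_; _*_; _∸_; _⊓_; _⊔_; _≤_; _<_; z≤n; s≤s; _≤?_; _≤ᵇ_; _<ᵇ_; _≡ᵇ_)
import Data.Nat
open import Data.Nat.Combinatorics using (_C_; nCk+nC[k+1]≡[n+1]C[k+1]; nC1≡n)
open import Data.Nat.Properties hiding (_≟_)
open import Data.Nat.Tactic.RingSolver using (solve-∀)
open import Data.Product using (_×_; _,_; proj₁; proj₂; Σ; ∃-syntax)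
import Data.Product.Properties as Product
open import Data.Sum using (_⊎_; inj₁; inj₂)
open import Data.Unit using (tt)
open import Data.Vec as Vec using ([]; _∷_)
import Data.Vec.Properties as Vec
open import Function using (_∘_)
open import Relation.Binary.PropositionalEquality using (_≡_; _≢_; refl; sym; trans; cong; cong₂; subst; module ≡-Reasoning)
open import Relation.Nullary using (¬_; Dec; yes; no; does; contradiction)
open import Relation.Nullary.Decidable using (toWitness; _×-dec_; _→-dec_)
open import Algebra.Properties.Semiring.Sum +-*-semiring using (sum; sum-cong-≗; ∑-distrib-+; ∑-comm; *-distribˡ-sum; *-distribʳ-sum)

-- Counts run over ordered tuples: family sizes appear times 6, numbers of edges times 2. The bounds
-- 360, 630, 1008, 1512 for 7 to 10 points are 6·3·C(n-1,3), six times the size of the construction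
-- in which every 4-set contains one fixed point that is never its mark. This value agrees with
-- 6(C(n,4) + 42) at n = 9 and at n = 10, so 42 = 3·C(8,3) - C(9,4). The induction has to start
-- below 9, since for n = 9 and n = 8 an undominated point may leave deletion as the only way out.
-- The obstacle is that an empty F_z^y puts no restriction on F_y^z, which may then be complete, so
-- the degree of z cannot be bounded well pair by pair. Domination isolates these bad pairs and also
-- repairs them: if the points of a set D dominate y, then F_y^u has at most one edge for each u in
-- D, so all but at most |D| edges of F_y^z avoid D. Large links into z therefore shrink as soon as
-- the points sending them are dominated themselves.

-- Truth values as numbers.

⟦_⟧ : Bool → ℕ
⟦ false ⟧ = 0
⟦ true ⟧ = 1

⟦⟧≤ : ∀ {b k} → (b ≡ true → 1 ≤ k) → ⟦ b ⟧ ≤ k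
⟦⟧≤ {false} _ = z≤n
⟦⟧≤ {true} h = h refl

⟦⟧≤1 : ∀ b → ⟦ b ⟧ ≤ 1
⟦⟧≤1 false = z≤n
⟦⟧≤1 true = ≤-refl

∧-true : ∀ {a b} → a ∧ b ≡ true → a ≡ true × b ≡ true
∧-true {true} {true} _ = refl , refl

true-∧ : ∀ {a b} → a ≡ true → b ≡ true → a ∧ b ≡ true
true-∧ refl refl = refl

not-true : ∀ {a} → not a ≡ true → a ≡ false
not-true {false} _ = refl

true≢false : ∀ {a} → a ≡ true → a ≡ false → ∀ {A : Set} → A
true≢false refl ()

≤ᵇ-elim : ∀ {m n} → (m ≤ᵇ n) ≡ true → m ≤ n
≤ᵇ-elim {m} {n} e = ≤ᵇ⇒≤ m n (subst T (sym e) tt)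

≤ᵇ-intro : ∀ {m n} → m ≤ n → (m ≤ᵇ n) ≡ true
≤ᵇ-intro {m} {n} p with m ≤ᵇ n | ≤⇒≤ᵇ p
... | true | _ = refl

<ᵇ-elim : ∀ {m n} → (m <ᵇ n) ≡ true → m < n
<ᵇ-elim {m} {n} e = <ᵇ⇒< m n (subst T (sym e) tt)

<ᵇ-intro : ∀ {m n} → m < n → (m <ᵇ n) ≡ true
<ᵇ-intro {m} {n} p with m <ᵇ n | <⇒<ᵇ p
... | true | _ = refl

<ᵇ-false : ∀ {m n} → (m <ᵇ n) ≡ false → n ≤ m
<ᵇ-false e = ≮⇒≥ (λ lt → true≢false (<ᵇ-intro lt) e)

≡ᵇ-elim : ∀ {m n} → (m ≡ᵇ n) ≡ true → m ≡ n
≡ᵇ-elim {m} {n} e = ≡ᵇ⇒≡ m n (subst T (sym e) tt)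

≡ᵇ-intro : ∀ {m n} → m ≡ n → (m ≡ᵇ n) ≡ true
≡ᵇ-intro {m} refl with m ≡ᵇ m | ≡⇒≡ᵇ m m refl
... | true | _ = refl

from-slack : ∀ {a b} k → a + k ≡ b → a ≤ b
from-slack k eq = m+n≤o⇒m≤o _ (≤-reflexive eq)

-- Sums over Fin n

opaque
  ∑ : ∀ {n} → (Fin n → ℕ) → ℕ
  ∑ = sum

opaque
  unfolding ∑

  ∑-cong : ∀ {n} {f g : Fin n → ℕ} → (∀ i → f i ≡ g i) → ∑ f ≡ ∑ g
  ∑-cong = sum-cong-≗

  ∑-+ : ∀ {n} (f g : Fin n → ℕ) → ∑ (λ i → f i + g i) ≡ ∑ f + ∑ g
  ∑-+ = ∑-distrib-+

  ∑-swap : ∀ {m n} (f : Fin m → Fin n → ℕ) → ∑ (λ i → ∑ (f i)) ≡ ∑ (λ j → ∑ (λ i → f i j))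
  ∑-swap = ∑-comm

  ∑-*ˡ : ∀ {n} x (f : Fin n → ℕ) → ∑ (λ i → x * f i) ≡ x * ∑ f
  ∑-*ˡ x f = sym (*-distribˡ-sum x f)

  ∑-*ʳ : ∀ {n} x (f : Fin n → ℕ) → ∑ (λ i → f i * x) ≡ ∑ f * x
  ∑-*ʳ x f = sym (*-distribʳ-sum x f)

  ∑-mono : ∀ {n} {f g : Fin n → ℕ} → (∀ i → f i ≤ g i) → ∑ f ≤ ∑ g
  ∑-mono {zero} h = z≤n
  ∑-mono {suc n} h = +-mono-≤ (h zero) (∑-mono (λ i → h (suc i)))

  ∑-zero : ∀ {n} {f : Fin n → ℕ} → (∀ i → f i ≡ 0) → ∑ f ≡ 0
  ∑-zero {zero} h = refl
  ∑-zero {suc n} h = cong₂ _+_ (h zero) (∑-zero (λ i → h (suc i)))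

  term≤∑ : ∀ {n} (f : Fin n → ℕ) i → f i ≤ ∑ f
  term≤∑ f zero = m≤m+n _ _
  term≤∑ f (suc i) = ≤-trans (term≤∑ (f ∘ suc) i) (m≤n+m _ _)

infix 7 _==_

_==_ : ∀ {n} → Fin n → Fin n → Bool
u == v = does (u ≟ v)

==-refl : ∀ {n} (u : Fin n) → u == u ≡ true
==-refl u with u ≟ u
... | yes _ = refl
... | no ¬p = contradiction refl ¬p

==-true : ∀ {n} {u v : Fin n} → u == v ≡ true → u ≡ v
==-true {u = u} {v} eq with u ≟ v
... | yes p = p
... | no _ = contradiction eq (λ ())

==-false : ∀ {n} {u v : Fin n} → u ≢ v → u == v ≡ false
==-false {u = u} {v} u≢v with u ≟ v
... | yes p = contradiction p u≢v
... | no _ = refl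

opaque
  unfolding ∑

  ∑-select : ∀ {n} (a : Fin n) (g : Fin n → ℕ) → ∑ (λ u → ⟦ u == a ⟧ * g u) ≡ g a
  ∑-select {suc n} zero g =
    trans (cong₂ _+_ (*-identityˡ (g zero)) (∑-zero {n} {λ _ → 0} (λ _ → refl))) (+-identityʳ _)
  ∑-select (suc a) g = ∑-select a (g ∘ suc)

opaque
  unfolding ∑

  ∑-ones : ∀ n → ∑ {n} (λ _ → 1) ≡ n
  ∑-ones zero = refl
  ∑-ones (suc n) = cong suc (∑-ones n)

∑-zero⇒ : ∀ {n} {f : Fin n → ℕ} → ∑ f ≡ 0 → ∀ i → f i ≡ 0
∑-zero⇒ {f = f} eq i = n≤0⇒n≡0 (≤-trans (term≤∑ f i) (≤-reflexive eq))

∑-== : ∀ {n} (a : Fin n) → ∑ (λ u → ⟦ u == a ⟧) ≡ 1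
∑-== a = trans (∑-cong (λ u → sym (*-identityʳ ⟦ u == a ⟧))) (∑-select a (λ _ → 1))

-- A point mass. It is added to the terms of a sum to record that the term at `y₀` stays `d` below
-- the common cap, so that the surplus can be cancelled at the end.
at : ∀ {n} → Fin n → ℕ → Fin n → ℕ
at y₀ d y = ⟦ y == y₀ ⟧ * d

∑-at : ∀ {n} (y₀ : Fin n) d → ∑ (at y₀ d) ≡ d
∑-at y₀ d = ∑-select y₀ (λ _ → d)

at-0 : ∀ {n} {y₀ : Fin n} {d y} → y ≢ y₀ → at y₀ d y ≡ 0
at-0 {d = d} ne = cong (λ b → ⟦ b ⟧ * d) (==-false ne)

at-≤ : ∀ {n} {y₀ : Fin n} {d y x A} → x ≤ A → (y ≡ y₀ → x + d ≤ A) → x + at y₀ d y ≤ A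
at-≤ {n} {y₀} {d} {y} {x} {A} h h₀ = go (y ≟ y₀)
  where
  go : Dec (y ≡ y₀) → x + at y₀ d y ≤ A
  go (yes refl) = ≤-trans (≤-reflexive (trans (cong (λ b → x + ⟦ b ⟧ * d) (==-refl y)) (cong (x +_) (+-identityʳ d)))) (h₀ refl)
  go (no ne) = ≤-trans (≤-reflexive (trans (cong (x +_) (at-0 {d = d} ne)) (+-identityʳ x))) h

-- Boolean subsets and their sizes.

Subsetᵇ : ℕ → Set
Subsetᵇ n = Fin n → Bool

infixl 6 _∖_ _∖∖_

_∖_ : ∀ {n} → Subsetᵇ n → Fin n → Subsetᵇ n
(P ∖ a) u = P u ∧ not (u == a)

_∖∖_ : ∀ {n} → Subsetᵇ n → Subsetᵇ n → Subsetᵇ n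
(P ∖∖ Q) u = P u ∧ not (Q u)

size : ∀ {n} → Subsetᵇ n → ℕ
size P = ∑ (λ u → ⟦ P u ⟧)

∖-intro : ∀ {n} {P : Subsetᵇ n} {a u} → P u ≡ true → u ≢ a → (P ∖ a) u ≡ true
∖-intro Pu u≢a = true-∧ Pu (cong not (==-false u≢a))

∖-elim : ∀ {n} {P : Subsetᵇ n} {a u} → (P ∖ a) u ≡ true → P u ≡ true × u ≢ a
∖-elim {a = a} h with ∧-true h
... | Pu , ne = Pu , λ { refl → true≢false (==-refl a) (not-true ne) }

∖∖-intro : ∀ {n} {P Q : Subsetᵇ n} {u} → P u ≡ true → Q u ≡ false → (P ∖∖ Q) u ≡ true
∖∖-intro Pu Qu = true-∧ Pu (cong not Qu)

∖∖-elim : ∀ {n} {P Q : Subsetᵇ n} {u} → (P ∖∖ Q) u ≡ true → P u ≡ true × Q u ≡ false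
∖∖-elim h with ∧-true h
... | Pu , ne = Pu , not-true ne

size-mono : ∀ {n} {P Q : Subsetᵇ n} → (∀ u → P u ≡ true → Q u ≡ true) → size P ≤ size Q
size-mono h = ∑-mono (λ u → ⟦⟧≤ (λ Pu → ≤-reflexive (sym (cong ⟦_⟧ (h u Pu)))))

size-∖∖ : ∀ {n} (P Q : Subsetᵇ n) → (∀ u → Q u ≡ true → P u ≡ true) → size (P ∖∖ Q) + size Q ≡ size P
size-∖∖ P Q h = trans (sym (∑-+ _ _)) (∑-cong pt)
  where
  pt : ∀ u → ⟦ P u ∧ not (Q u) ⟧ + ⟦ Q u ⟧ ≡ ⟦ P u ⟧
  pt u with P u in p | Q u in q
  ... | true | true = refl
  ... | true | false = refl
  ... | false | true = true≢false (h u q) p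
  ... | false | false = refl

size-∖ : ∀ {n} (P : Subsetᵇ n) {a} → P a ≡ true → suc (size (P ∖ a)) ≡ size P
size-∖ P {a} Pa = trans (+-comm 1 _) (trans (cong (size (P ∖ a) +_) (sym (∑-== a)))
  (size-∖∖ P (_== a) (λ u eq → subst (λ w → P w ≡ true) (sym (==-true eq)) Pa)))

size-∖≡ : ∀ {n} (P : Subsetᵇ n) {a} → P a ≡ true → size (P ∖ a) ≡ size P ∸ 1
size-∖≡ P Pa = cong pred (size-∖ P Pa)

size≡0⇒ : ∀ {n} {P : Subsetᵇ n} → size P ≡ 0 → ∀ u → P u ≡ false
size≡0⇒ {P = P} eq u with P u in Pu
... | false = refl
... | true = contradiction (trans (sym (cong ⟦_⟧ Pu)) (∑-zero⇒ eq u)) (λ ())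

pick : ∀ {n} (P : Subsetᵇ n) → (∃[ u ] P u ≡ true) ⊎ (∀ u → P u ≡ false)
pick P with any? (λ u → P u Bool.≟ true)
... | yes e = inj₁ e
... | no ¬e = inj₂ (λ u → Bool.¬-not (λ Pu → ¬e (u , Pu)))

pick₂ : ∀ {n} (g : Fin n → Fin n → Bool) →
        (∃[ u ] ∃[ v ] g u v ≡ true) ⊎ (∀ u v → g u v ≡ false)
pick₂ g with any? (λ u → any? (λ v → g u v Bool.≟ true))
... | yes e = inj₁ e
... | no ¬e = inj₂ (λ u v → Bool.¬-not (λ Pu → ¬e (u , v , Pu)))

-- Deletes `j` elements one by one. It cuts a set of dominating points down to a prescribed size, so
-- that bounds can be stated at that size without any monotonicity argument.
subset-of-size : ∀ {n} (Q : Subsetᵇ n) j k → size Q ≡ k + j →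
  ∃[ R ] size R ≡ k × (∀ u → R u ≡ true → Q u ≡ true)
subset-of-size Q zero k eq = Q , trans eq (+-identityʳ k) , λ _ h → h
subset-of-size Q (suc j) k eq with pick Q
... | inj₂ none = contradiction (trans (sym (∑-zero (λ u → cong ⟦_⟧ (none u)))) (trans eq (+-suc k j))) (λ ())
... | inj₁ (a , Qa) with subset-of-size (Q ∖ a) j k (suc-injective (trans (size-∖ Q Qa) (trans eq (+-suc k j))))
... | R , sz , R⊆ = R , sz , λ u h → proj₁ (∖-elim {P = Q} {a} (R⊆ u h))

-- Counting the edges of graphs.

cnt : ∀ {n} → (Fin n → Fin n → Bool) → ℕ
cnt g = ∑ (λ u → ∑ (λ v → ⟦ g u v ⟧))

∑₂-mono : ∀ {n} {f g : Fin n → Fin n → ℕ} → (∀ u v → f u v ≤ g u v) →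
          ∑ (λ u → ∑ (f u)) ≤ ∑ (λ u → ∑ (g u))
∑₂-mono h = ∑-mono (λ u → ∑-mono (h u))

∑₂-+ : ∀ {n} (f g : Fin n → Fin n → ℕ) →
       ∑ (λ u → ∑ (λ v → f u v + g u v)) ≡ ∑ (λ u → ∑ (f u)) + ∑ (λ u → ∑ (g u))
∑₂-+ f g = trans (∑-cong (λ u → ∑-+ (f u) (g u))) (∑-+ (λ u → ∑ (f u)) (λ u → ∑ (g u)))

∑₂-* : ∀ {n} (a b : Fin n → ℕ) → ∑ (λ u → ∑ (λ v → a u * b v)) ≡ ∑ a * ∑ b
∑₂-* a b = trans (∑-cong (λ u → ∑-*ˡ (a u) b)) (∑-*ʳ (∑ b) a)

cnt-mono : ∀ {n} {g h : Fin n → Fin n → Bool} → (∀ u v → g u v ≡ true → h u v ≡ true) → cnt g ≤ cnt h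
cnt-mono h = ∑₂-mono (λ u v → ⟦⟧≤ (λ guv → ≤-reflexive (sym (cong ⟦_⟧ (h u v guv)))))

cnt-empty : ∀ {n} {g : Fin n → Fin n → Bool} → (∀ u v → g u v ≡ false) → cnt g ≡ 0
cnt-empty h = ∑-zero (λ u → ∑-zero (λ v → cong ⟦_⟧ (h u v)))

cnt-pos : ∀ {n} {g : Fin n → Fin n → Bool} {u v} → g u v ≡ true → 1 ≤ cnt g
cnt-pos {g = g} {u} {v} guv = ≤-trans (≤-reflexive (cong ⟦_⟧ (sym guv)))
  (≤-trans (term≤∑ (λ w → ⟦ g u w ⟧) v) (term≤∑ (λ w → ∑ (λ x → ⟦ g w x ⟧)) u))

cnt-split : ∀ {n} (g h : Fin n → Fin n → Bool) →
            cnt g ≤ cnt (λ u v → g u v ∧ h u v) + cnt (λ u v → g u v ∧ not (h u v))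
cnt-split g h = ≤-trans (∑₂-mono pt)
  (≤-reflexive (∑₂-+ (λ u v → ⟦ g u v ∧ h u v ⟧) (λ u v → ⟦ g u v ∧ not (h u v) ⟧)))
  where
  pt : ∀ u v → ⟦ g u v ⟧ ≤ ⟦ g u v ∧ h u v ⟧ + ⟦ g u v ∧ not (h u v) ⟧
  pt u v with g u v | h u v
  ... | false | _ = z≤n
  ... | true | true = ≤-refl
  ... | true | false = ≤-refl

record IsGraph {n} (g : Fin n → Fin n → Bool) : Set where
  field
    symm : ∀ {u v} → g u v ≡ true → g v u ≡ true
    irr : ∀ {u v} → g u v ≡ true → u ≢ v

On : ∀ {n} → Subsetᵇ n → (Fin n → Fin n → Bool) → Set
On P g = ∀ {u v} → g u v ≡ true → P u ≡ true

onʳ : ∀ {n} {P : Subsetᵇ n} {g} → IsGraph g → On P g → ∀ {u v} → g u v ≡ true → P v ≡ true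
onʳ G on guv = on (IsGraph.symm G guv)

complete-bound : ∀ {n} (P : Subsetᵇ n) {g} → IsGraph g → On P g → cnt g ≤ size P * (size P ∸ 1)
complete-bound P {g} G on = ≤-trans (∑-mono inner) (≤-reflexive (∑-*ʳ (size P ∸ 1) (λ u → ⟦ P u ⟧)))
  where
  open IsGraph G
  inner : ∀ u → ∑ (λ v → ⟦ g u v ⟧) ≤ ⟦ P u ⟧ * (size P ∸ 1)
  inner u with P u in Pu
  ... | true = ≤-trans (size-mono {P = g u} {P ∖ u} (λ v guv → ∖-intro {P = P} (onʳ G on guv) (λ { refl → irr guv refl })))
                 (≤-reflexive (trans (size-∖≡ P Pu) (sym (+-identityʳ _))))
  ... | false = ≤-reflexive (∑-zero (λ v → cong ⟦_⟧ (Bool.¬-not (λ guv → true≢false (on guv) Pu))))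

Star : ∀ {n} → Fin n → (Fin n → Fin n → Bool) → Set
Star c g = ∀ {u v} → g u v ≡ true → u ≡ c ⊎ v ≡ c

star-bound : ∀ {n} (P : Subsetᵇ n) c {g} → IsGraph g → On P g → Star c g → cnt g ≤ 2 * (size P ∸ 1)
star-bound {n} P c {g} G on star with P c in Pc
... | false = ≤-trans (≤-reflexive (cnt-empty (λ u v → Bool.¬-not (λ guv → no-edge guv (star guv))))) z≤n
  where
  no-edge : ∀ {u v} → g u v ≡ true → ¬ (u ≡ c ⊎ v ≡ c)
  no-edge guv (inj₁ refl) = true≢false (on guv) Pc
  no-edge guv (inj₂ refl) = true≢false (onʳ G on guv) Pc
... | true = begin
  cnt g ≤⟨ ∑₂-mono (λ u v → ⟦⟧≤ (pt u v)) ⟩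
  ∑ (λ u → ∑ (λ v → ⟦ u == c ⟧ * ⟦ Q v ⟧ + ⟦ Q u ⟧ * ⟦ v == c ⟧))
    ≡⟨ ∑₂-+ (λ u v → ⟦ u == c ⟧ * ⟦ Q v ⟧) (λ u v → ⟦ Q u ⟧ * ⟦ v == c ⟧) ⟩
  _ ≡⟨ cong₂ _+_ (∑₂-* (λ u → ⟦ u == c ⟧) (λ v → ⟦ Q v ⟧)) (∑₂-* (λ u → ⟦ Q u ⟧) (λ v → ⟦ v == c ⟧)) ⟩
  ∑ (λ u → ⟦ u == c ⟧) * size Q + size Q * ∑ (λ u → ⟦ u == c ⟧) ≡⟨ cong (λ x → x * size Q + size Q * x) (∑-== c) ⟩
  1 * size Q + size Q * 1 ≡⟨ arith (size Q) ⟩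
  2 * size Q ≡⟨ cong (2 *_) (size-∖≡ P Pc) ⟩
  2 * (size P ∸ 1) ∎
  where
  open ≤-Reasoning
  Q = P ∖ c
  arith : ∀ q → 1 * q + q * 1 ≡ 2 * q
  arith = solve-∀
  pt : ∀ u v → g u v ≡ true → 1 ≤ ⟦ u == c ⟧ * ⟦ Q v ⟧ + ⟦ Q u ⟧ * ⟦ v == c ⟧
  pt u v guv with star guv
  ... | inj₁ refl = ≤-trans (≤-reflexive (sym (cong₂ (λ x y → ⟦ x ⟧ * ⟦ y ⟧) (==-refl u)
          (∖-intro {P = P} (onʳ G on guv) (λ { refl → IsGraph.irr G guv refl }))))) (m≤m+n _ _)
  ... | inj₂ refl = ≤-trans (≤-reflexive (sym (cong₂ (λ x y → ⟦ x ⟧ * ⟦ y ⟧)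
          (∖-intro {P = P} (on guv) (IsGraph.irr G guv)) (==-refl v)))) (m≤n+m _ _)

Joins : ∀ {n} → Fin n → Fin n → Fin n × Fin n → Set
Joins u v (a , b) = (u ≡ a × v ≡ b) ⊎ (u ≡ b × v ≡ a)

listed-bound : ∀ {n} (es : List (Fin n × Fin n)) {g} →
               (∀ {u v} → g u v ≡ true → Any (Joins u v) es) → cnt g ≤ 2 * length es
listed-bound {n} es h = ≤-trans (∑₂-mono (λ u v → ⟦⟧≤ (λ guv → pt es (h guv)))) (≤-reflexive (total es))
  where
  mult : List (Fin n × Fin n) → Fin n → Fin n → ℕ
  mult [] u v = 0
  mult ((a , b) ∷ es) u v = (⟦ u == a ⟧ * ⟦ v == b ⟧ + ⟦ u == b ⟧ * ⟦ v == a ⟧) + mult es u v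
  pt : ∀ es {u v} → Any (Joins u v) es → 1 ≤ mult es u v
  pt (_ ∷ es) {u} {v} (here (inj₁ (refl , refl))) =
    ≤-trans (≤-reflexive (sym (cong₂ (λ x y → ⟦ x ⟧ * ⟦ y ⟧) (==-refl u) (==-refl v)))) (≤-trans (m≤m+n _ _) (m≤m+n _ _))
  pt ((a , b) ∷ es) {u} {v} (here (inj₂ (refl , refl))) =
    ≤-trans (≤-reflexive (sym (cong₂ (λ x y → ⟦ x ⟧ * ⟦ y ⟧) (==-refl u) (==-refl v))))
      (≤-trans (m≤n+m (⟦ u == b ⟧ * ⟦ v == a ⟧) (⟦ u == a ⟧ * ⟦ v == b ⟧)) (m≤m+n _ (mult es u v)))
  pt (_ ∷ es) (there p) = ≤-trans (pt es p) (m≤n+m _ _)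
  one : ∀ (a b : Fin n) → ∑ (λ u → ∑ (λ v → ⟦ u == a ⟧ * ⟦ v == b ⟧)) ≡ 1
  one a b = trans (∑₂-* (λ u → ⟦ u == a ⟧) (λ v → ⟦ v == b ⟧)) (cong₂ _*_ (∑-== a) (∑-== b))
  total : ∀ es → ∑ (λ u → ∑ (mult es u)) ≡ 2 * length es
  total [] = ∑-zero (λ u → ∑-zero (λ v → refl))
  total ((a , b) ∷ es) = begin
    _ ≡⟨ ∑₂-+ (λ u v → ⟦ u == a ⟧ * ⟦ v == b ⟧ + ⟦ u == b ⟧ * ⟦ v == a ⟧) (mult es) ⟩
    _ ≡⟨ cong₂ _+_ (∑₂-+ (λ u v → ⟦ u == a ⟧ * ⟦ v == b ⟧) (λ u v → ⟦ u == b ⟧ * ⟦ v == a ⟧)) (total es) ⟩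
    _ ≡⟨ cong (_+ 2 * length es) (cong₂ _+_ (one a b) (one b a)) ⟩
    2 + 2 * length es ≡⟨ sym (*-suc 2 (length es)) ⟩
    2 * suc (length es) ∎
    where open ≡-Reasoning

touch : ∀ {n} → Fin n → Fin n → Fin n → Bool
touch a u v = u == a ∨ v == a

touch-elim : ∀ {n} {a u v : Fin n} → touch a u v ≡ true → u ≡ a ⊎ v ≡ a
touch-elim {a = a} {u} h with u == a in eq
... | true = inj₁ (==-true eq)
... | false = inj₂ (==-true h)

touch-intro : ∀ {n} {a u v : Fin n} → u ≡ a ⊎ v ≡ a → touch a u v ≡ true
touch-intro {a = a} (inj₁ refl) rewrite ==-refl a = refl
touch-intro {a = a} {u} (inj₂ refl) rewrite ==-refl a = Bool.∨-zeroʳ (u == a)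

touch-false : ∀ {n} {a u v : Fin n} → touch a u v ≡ false → u ≢ a × v ≢ a
touch-false {a = a} {u} {v} h =
  (λ e → true≢false (touch-intro {a = a} {u} {v} (inj₁ e)) h) , (λ e → true≢false (touch-intro {a = a} {u} {v} (inj₂ e)) h)

touch-comm : ∀ {n} (a u v : Fin n) → touch a u v ≡ touch a v u
touch-comm a u v = Bool.∨-comm (u == a) (v == a)

∧-graph : ∀ {n} {g h : Fin n → Fin n → Bool} → IsGraph g → (∀ u v → h u v ≡ h v u) → IsGraph (λ u v → g u v ∧ h u v)
∧-graph {g = g} {h} G hs = record
  { symm = λ {u} {v} e → true-∧ (IsGraph.symm G (proj₁ (∧-true e))) (trans (hs v u) (proj₂ (∧-true {g u v} e)))
  ; irr = λ e → IsGraph.irr G (proj₁ (∧-true e)) }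

Meets : ∀ {n} → Fin n → Fin n → (Fin n → Fin n → Bool) → Set
Meets a b g = ∀ {u v} → g u v ≡ true → (u ≡ a ⊎ v ≡ a) ⊎ (u ≡ b ⊎ v ≡ b)

-- The edges at `a` form a star on `P`, and the remaining ones form a star at `b` on `P ∖ a`. If `a`
-- lies outside `P`, the first part is empty.
meets-bound : ∀ {n} (P : Subsetᵇ n) a b {g} → IsGraph g → On P g → Meets a b g →
              cnt g ≤ 2 * (size P ∸ 1) + 2 * (size P ∸ 2)
meets-bound {n} P a b {g} G on meets = ≤-trans (cnt-split g (touch a)) rest
  where
  G₁ = ∧-graph G (touch-comm a)
  G₂ = ∧-graph {h = λ u v → not (touch a u v)} G (λ u v → cong not (touch-comm a u v))
  bound₂ : ∀ (Q : Subsetᵇ n) → On Q (λ u v → g u v ∧ not (touch a u v)) →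
           cnt (λ u v → g u v ∧ not (touch a u v)) ≤ 2 * (size Q ∸ 1)
  bound₂ Q onQ = star-bound Q b G₂ onQ star₂
    where
    star₂ : Star b (λ u v → g u v ∧ not (touch a u v))
    star₂ {u} {v} e with meets (proj₁ (∧-true e))
    ... | inj₁ t = true≢false (touch-intro t) (not-true (proj₂ (∧-true {g u v} e)))
    ... | inj₂ t = t
  on₁ : On P (λ u v → g u v ∧ touch a u v)
  on₁ e = on (proj₁ (∧-true e))
  rest : cnt (λ u v → g u v ∧ touch a u v) + cnt (λ u v → g u v ∧ not (touch a u v)) ≤ 2 * (size P ∸ 1) + 2 * (size P ∸ 2)
  rest with P a in Pa
  ... | true = +-mono-≤ (star-bound P a G₁ on₁ (λ {u} {v} e → touch-elim (proj₂ (∧-true {g u v} e))))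
      (≤-trans (bound₂ (P ∖ a) (λ {u} {v} e → ∖-intro {P = P} (on (proj₁ (∧-true e)))
          (proj₁ (touch-false {a = a} {u} {v} (not-true (proj₂ (∧-true {g u v} e)))))))
        (≤-reflexive (cong (2 *_) (trans (cong (_∸ 1) (size-∖≡ P Pa)) (∸-+-assoc (size P) 1 1)))))
  ... | false = ≤-trans (+-mono-≤ (≤-reflexive (cnt-empty (λ u v → Bool.¬-not (λ e → none (proj₁ (∧-true e)) (touch-elim (proj₂ (∧-true {g u v} e)))))))
        (bound₂ P (λ e → on (proj₁ (∧-true e))))) (m≤m+n _ _)
      where
      none : ∀ {u v} → g u v ≡ true → ¬ (u ≡ a ⊎ v ≡ a)
      none guv (inj₁ refl) = true≢false (on guv) Pa
      none guv (inj₂ refl) = true≢false (onʳ G on guv) Pa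

StarOr : ∀ {n} → Fin n → Fin n → Fin n → (Fin n → Fin n → Bool) → Set
StarOr a b c g = ∀ {u v} → g u v ≡ true → (u ≡ a ⊎ v ≡ a) ⊎ Joins u v (b , c)

starOr-bound : ∀ {n} (P : Subsetᵇ n) a b c {g} → IsGraph g → On P g → StarOr a b c g →
               cnt g ≤ 2 * (size P ∸ 1) + 2
starOr-bound {n} P a b c {g} G on h = ≤-trans (cnt-split g (touch a)) (+-mono-≤
    (star-bound P a (∧-graph G (touch-comm a)) (λ e → on (proj₁ (∧-true e))) (λ {u} {v} e → touch-elim (proj₂ (∧-true {g u v} e))))
    (listed-bound ((b , c) ∷ []) extra))
  where
  extra : ∀ {u v} → g u v ∧ not (touch a u v) ≡ true → Any (Joins u v) ((b , c) ∷ [])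
  extra {u} {v} e with h (proj₁ (∧-true e))
  ... | inj₁ t = true≢false (touch-intro t) (not-true (proj₂ (∧-true {g u v} e)))
  ... | inj₂ j = here j

-- Cross-intersecting pairs of graphs

-- The primed constructors exchange the two graphs. In `small` the graphs have at most four edges
-- each and six together: two triangles, or the exceptional configurations on four points.
data Shape {n} (g h : Fin n → Fin n → Bool) : Set where
  star    : ∀ c → Star c g → Star c h → Shape g h
  single  : ∀ a b → cnt g ≤ 2 → Meets a b h → Shape g h
  single′ : ∀ a b → cnt h ≤ 2 → Meets a b g → Shape g h
  cherry  : ∀ a b c → cnt g ≤ 4 → StarOr a b c h → Shape g h
  cherry′ : ∀ a b c → cnt h ≤ 4 → StarOr a b c g → Shape g h
  small   : cnt g ≤ 8 → cnt h ≤ 8 → cnt g + cnt h ≤ 12 → Shape g h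

Cross : ∀ {n} (g h : Fin n → Fin n → Bool) → Set
Cross g h = ∀ {a b} → g a b ≡ true → Meets a b h

Cross-sym : ∀ {n} {g h : Fin n → Fin n → Bool} → Cross g h → Cross h g
Cross-sym X hab guv with X guv hab
... | inj₁ (inj₁ refl) = inj₁ (inj₁ refl)
... | inj₁ (inj₂ refl) = inj₂ (inj₁ refl)
... | inj₂ (inj₁ refl) = inj₁ (inj₂ refl)
... | inj₂ (inj₂ refl) = inj₂ (inj₂ refl)

joins : ∀ {n} {s t u v : Fin n} → s ≢ t → u ≡ s ⊎ v ≡ s → u ≡ t ⊎ v ≡ t → Joins u v (s , t)
joins s≢t (inj₁ refl) (inj₁ refl) = contradiction refl s≢t
joins s≢t (inj₁ refl) (inj₂ refl) = inj₁ (refl , refl)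
joins s≢t (inj₂ refl) (inj₁ refl) = inj₂ (refl , refl)
joins s≢t (inj₂ refl) (inj₂ refl) = contradiction refl s≢t

joins-touch : ∀ {n} {a b x u v : Fin n} → Joins u v (a , b) → u ≡ x ⊎ v ≡ x → a ≡ x ⊎ b ≡ x
joins-touch (inj₁ (refl , refl)) t = t
joins-touch (inj₂ (refl , refl)) (inj₁ e) = inj₂ e
joins-touch (inj₂ (refl , refl)) (inj₂ e) = inj₁ e

module _ {n} {g h : Fin n → Fin n → Bool} (G : IsGraph g) (H : IsGraph h) (X : Cross g h) where
  private
    module G = IsGraph G
    module H = IsGraph H

    X′ : Cross h g
    X′ = Cross-sym X

    absent : ∀ {k : Fin n → Fin n → Bool} → IsGraph k → ∀ {a b u v} →
             k a b ≡ false → k u v ≡ true → ∀ {A : Set} → Joins u v (a , b) → A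
    absent K kab kuv (inj₁ (refl , refl)) = true≢false kuv kab
    absent K kab kuv (inj₂ (refl , refl)) = true≢false (IsGraph.symm K kuv) kab

  -- If `g` is not a star at `c` as well, it has an edge `st` avoiding `c`, which leaves only `cs`
  -- and `ct` for `h`. Having both forces `g` to be a star at `c` plus possibly `st`.
  star⇒shape : ∀ c → Star c h → (∃[ u ] ∃[ v ] h u v ≡ true) → Shape g h
  star⇒shape c st (u₀ , v₀ , h₀) with pick₂ (λ u v → g u v ∧ not (touch c u v))
  ... | inj₂ none = star c st-g st
    where
    st-g : Star c g
    st-g {u} {v} guv with touch c u v in eq
    ... | true = touch-elim eq
    ... | false = true≢false (true-∧ guv (cong not eq)) (none u v)
  ... | inj₁ (s , t , e) = go
    where
    gst : g s t ≡ true
    gst = proj₁ (∧-true e)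
    avoid : s ≢ c × t ≢ c
    avoid = touch-false {a = c} {s} {t} (not-true (proj₂ (∧-true {g s t} e)))
    s≢t : s ≢ t
    s≢t = G.irr gst
    spokes : ∀ {u v} → h u v ≡ true → Joins u v (c , s) ⊎ Joins u v (c , t)
    spokes huv with X gst huv
    ... | inj₁ s-at = inj₁ (joins (λ e → proj₁ avoid (sym e)) (st huv) s-at)
    ... | inj₂ t-at = inj₂ (joins (λ e → proj₂ avoid (sym e)) (st huv) t-at)
    present : ∀ {k} → Joins u₀ v₀ (c , k) → h c k ≡ true
    present (inj₁ (refl , refl)) = h₀
    present (inj₂ (refl , refl)) = H.symm h₀
    go : Shape g h
    go with h c s in hcs | h c t in hct
    ... | true | true = cherry′ c s t (listed-bound ((c , s) ∷ (c , t) ∷ []) spokes′) stor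
      where
      spokes′ : ∀ {u v} → h u v ≡ true → Any (Joins u v) ((c , s) ∷ (c , t) ∷ [])
      spokes′ huv with spokes huv
      ... | inj₁ j = here j
      ... | inj₂ j = there (here j)
      stor : StarOr c s t g
      stor guv with X′ hcs guv | X′ hct guv
      ... | inj₁ tc | _ = inj₁ tc
      ... | _ | inj₁ tc = inj₁ tc
      ... | inj₂ s-at | inj₂ t-at = inj₂ (joins s≢t s-at t-at)
    ... | false | _ = single′ c t (listed-bound ((c , t) ∷ []) only) (X′ there!)
      where
      only : ∀ {u v} → h u v ≡ true → Any (Joins u v) ((c , t) ∷ [])
      only huv with spokes huv
      ... | inj₁ j = absent H hcs huv j
      ... | inj₂ j = here j
      there! : h c t ≡ true
      there! with spokes h₀
      ... | inj₁ j = absent H hcs h₀ j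
      ... | inj₂ j = present j
    ... | true | false = single′ c s (listed-bound ((c , s) ∷ []) only) (X′ hcs)
      where
      only : ∀ {u v} → h u v ≡ true → Any (Joins u v) ((c , s) ∷ [])
      only huv with spokes huv
      ... | inj₁ j = here j
      ... | inj₂ j = absent H hct huv j

  -- The disjoint edges `bx` and `ay` of `h` confine `g` to the four edges `ab`, `by`, `yx`, `xa` of
  -- a 4-cycle. The proof runs through the subsets of this cycle that contain `ab`.
  matching⇒shape : ∀ {a b x y} → g a b ≡ true → h b x ≡ true → h a y ≡ true →
                   x ≢ a → y ≢ b → x ≢ y → Shape g h
  matching⇒shape {a} {b} {x} {y} gab hbx hay x≢a y≢b x≢y = go
    where
    a≢b = G.irr gab
    b≢x = H.irr hbx
    a≢y = H.irr hay
    At : Fin n → Fin n → Fin n → Set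
    At c u v = u ≡ c ⊎ v ≡ c
    ab : ∀ {u v} → At a u v → At b u v → Joins u v (a , b)
    ab = joins a≢b
    by : ∀ {u v} → At b u v → At y u v → Joins u v (b , y)
    by = joins (λ e → y≢b (sym e))
    ax : ∀ {u v} → At a u v → At x u v → Joins u v (a , x)
    ax = joins (λ e → x≢a (sym e))
    xy : ∀ {u v} → At x u v → At y u v → Joins u v (x , y)
    xy = joins x≢y
    ay : ∀ {u v} → At a u v → At y u v → Joins u v (a , y)
    ay = joins a≢y
    bx : ∀ {u v} → At b u v → At x u v → Joins u v (b , x)
    bx = joins b≢x
    data Four (u v : Fin n) : Set where
      ab! : Joins u v (a , b) → Four u v
      by! : Joins u v (b , y) → Four u v
      ax! : Joins u v (a , x) → Four u v
      xy! : Joins u v (x , y) → Four u v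
    four : ∀ {u v} → g u v ≡ true → Four u v
    four guv with X′ hbx guv | X′ hay guv
    ... | inj₁ tb | inj₁ ta = ab! (ab ta tb)
    ... | inj₁ tb | inj₂ ty = by! (by tb ty)
    ... | inj₂ tx | inj₁ ta = ax! (ax ta tx)
    ... | inj₂ tx | inj₂ ty = xy! (xy tx ty)
    nope : ∀ {u v} {c d e f : Fin n} {A : Set} → c ≢ e → d ≢ e → c ≢ f → d ≢ f →
           Joins u v (c , d) → At e u v ⊎ At f u v → A
    nope ce de cf df j (inj₁ t) with joins-touch j t
    ... | inj₁ q = contradiction q ce
    ... | inj₂ q = contradiction q de
    nope ce de cf df j (inj₂ t) with joins-touch j t
    ... | inj₁ q = contradiction q cf
    ... | inj₂ q = contradiction q df
    go : Shape g h
    go with g b y in gby | g a x in gax | g x y in gxy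
    ... | false | false | false = single a b (listed-bound ((a , b) ∷ []) gs) (X gab)
      where
      gs : ∀ {u v} → g u v ≡ true → Any (Joins u v) ((a , b) ∷ [])
      gs guv with four guv
      ... | ab! j = here j
      ... | by! j = absent G gby guv j
      ... | ax! j = absent G gax guv j
      ... | xy! j = absent G gxy guv j
    ... | true | false | false = cherry b a y (listed-bound ((a , b) ∷ (b , y) ∷ []) gs) hs
      where
      gs : ∀ {u v} → g u v ≡ true → Any (Joins u v) ((a , b) ∷ (b , y) ∷ [])
      gs guv with four guv
      ... | ab! j = here j
      ... | by! j = there (here j)
      ... | ax! j = absent G gax guv j
      ... | xy! j = absent G gxy guv j
      hs : StarOr b a y h
      hs huv with X gab huv | X gby huv
      ... | inj₂ tb | _ = inj₁ tb
      ... | _ | inj₁ tb = inj₁ tb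
      ... | inj₁ ta | inj₂ ty = inj₂ (ay ta ty)
    ... | false | true | false = cherry a b x (listed-bound ((a , b) ∷ (a , x) ∷ []) gs) hs
      where
      gs : ∀ {u v} → g u v ≡ true → Any (Joins u v) ((a , b) ∷ (a , x) ∷ [])
      gs guv with four guv
      ... | ab! j = here j
      ... | by! j = absent G gby guv j
      ... | ax! j = there (here j)
      ... | xy! j = absent G gxy guv j
      hs : StarOr a b x h
      hs huv with X gab huv | X gax huv
      ... | inj₁ ta | _ = inj₁ ta
      ... | _ | inj₁ ta = inj₁ ta
      ... | inj₂ tb | inj₂ tx = inj₂ (bx tb tx)
    -- Here `g` consists of two opposite edges of the cycle, so `h` has to pick one end of each.
    ... | false | false | true = small (≤-trans gle (m≤m+n 4 4)) hle (+-mono-≤ gle hle)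
      where
      gs : ∀ {u v} → g u v ≡ true → Any (Joins u v) ((a , b) ∷ (x , y) ∷ [])
      gs guv with four guv
      ... | ab! j = here j
      ... | by! j = absent G gby guv j
      ... | ax! j = absent G gax guv j
      ... | xy! j = there (here j)
      hs : ∀ {u v} → h u v ≡ true → Any (Joins u v) ((a , x) ∷ (a , y) ∷ (b , x) ∷ (b , y) ∷ [])
      hs huv with X gab huv | X gxy huv
      ... | inj₁ ta | inj₁ tx = here (ax ta tx)
      ... | inj₁ ta | inj₂ ty = there (here (ay ta ty))
      ... | inj₂ tb | inj₁ tx = there (there (here (bx tb tx)))
      ... | inj₂ tb | inj₂ ty = there (there (there (here (by tb ty))))
      gle : cnt g ≤ 4
      gle = listed-bound _ gs
      hle : cnt h ≤ 8
      hle = listed-bound _ hs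
    ... | true | true | false = small (≤-trans gle (m≤m+n 6 2)) (≤-trans hle (m≤m+n 6 2)) (+-mono-≤ gle hle)
      where
      gs : ∀ {u v} → g u v ≡ true → Any (Joins u v) ((a , b) ∷ (b , y) ∷ (a , x) ∷ [])
      gs guv with four guv
      ... | ab! j = here j
      ... | by! j = there (here j)
      ... | ax! j = there (there (here j))
      ... | xy! j = absent G gxy guv j
      hs : ∀ {u v} → h u v ≡ true → Any (Joins u v) ((a , b) ∷ (a , y) ∷ (b , x) ∷ [])
      hs huv with X gab huv | X gby huv | X gax huv
      ... | inj₁ ta | inj₁ tb | _ = here (ab ta tb)
      ... | inj₁ ta | inj₂ ty | _ = there (here (ay ta ty))
      ... | inj₂ tb | _ | inj₁ ta = here (ab ta tb)
      ... | inj₂ tb | _ | inj₂ tx = there (there (here (bx tb tx)))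
      gle : cnt g ≤ 6
      gle = listed-bound _ gs
      hle : cnt h ≤ 6
      hle = listed-bound _ hs
    ... | true | false | true = small (≤-trans gle (m≤m+n 6 2)) (≤-trans hle (m≤m+n 6 2)) (+-mono-≤ gle hle)
      where
      gs : ∀ {u v} → g u v ≡ true → Any (Joins u v) ((a , b) ∷ (b , y) ∷ (x , y) ∷ [])
      gs guv with four guv
      ... | ab! j = here j
      ... | by! j = there (here j)
      ... | ax! j = absent G gax guv j
      ... | xy! j = there (there (here j))
      hs : ∀ {u v} → h u v ≡ true → Any (Joins u v) ((b , x) ∷ (b , y) ∷ (a , y) ∷ [])
      hs huv with X gby huv | X gxy huv | X gab huv
      ... | inj₁ tb | inj₁ tx | _ = here (bx tb tx)
      ... | inj₁ tb | inj₂ ty | _ = there (here (by tb ty))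
      ... | inj₂ ty | _ | inj₁ ta = there (there (here (ay ta ty)))
      ... | inj₂ ty | _ | inj₂ tb = there (here (by tb ty))
      gle : cnt g ≤ 6
      gle = listed-bound _ gs
      hle : cnt h ≤ 6
      hle = listed-bound _ hs
    ... | false | true | true = small (≤-trans gle (m≤m+n 6 2)) (≤-trans hle (m≤m+n 6 2)) (+-mono-≤ gle hle)
      where
      gs : ∀ {u v} → g u v ≡ true → Any (Joins u v) ((a , b) ∷ (a , x) ∷ (x , y) ∷ [])
      gs guv with four guv
      ... | ab! j = here j
      ... | by! j = absent G gby guv j
      ... | ax! j = there (here j)
      ... | xy! j = there (there (here j))
      hs : ∀ {u v} → h u v ≡ true → Any (Joins u v) ((a , x) ∷ (a , y) ∷ (b , x) ∷ [])
      hs huv with X gax huv | X gxy huv | X gab huv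
      ... | inj₁ ta | inj₁ tx | _ = here (ax ta tx)
      ... | inj₁ ta | inj₂ ty | _ = there (here (ay ta ty))
      ... | inj₂ tx | _ | inj₁ ta = here (ax ta tx)
      ... | inj₂ tx | _ | inj₂ tb = there (there (here (bx tb tx)))
      gle : cnt g ≤ 6
      gle = listed-bound _ gs
      hle : cnt h ≤ 6
      hle = listed-bound _ hs
    ... | true | true | true = small gle (≤-trans hle (m≤m+n 4 4)) (+-mono-≤ gle hle)
      where
      gs : ∀ {u v} → g u v ≡ true → Any (Joins u v) ((a , b) ∷ (b , y) ∷ (a , x) ∷ (x , y) ∷ [])
      gs guv with four guv
      ... | ab! j = here j
      ... | by! j = there (here j)
      ... | ax! j = there (there (here j))
      ... | xy! j = there (there (there (here j)))
      hs : ∀ {u v} → h u v ≡ true → Any (Joins u v) ((a , y) ∷ (b , x) ∷ [])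
      hs huv with X gby huv | X gax huv
      -- Such an edge would be `ab`, which misses the edge `xy` of `g`.
      ... | inj₁ tb | inj₁ ta = nope (λ e → x≢a (sym e)) b≢x a≢y (λ e → y≢b (sym e)) (ab ta tb) (X gxy huv)
      ... | inj₁ tb | inj₂ tx = there (here (bx tb tx))
      ... | inj₂ ty | inj₁ ta = here (ay ta ty)
      ... | inj₂ ty | inj₂ tx = nope x≢a (λ e → a≢y (sym e)) (λ e → b≢x (sym e)) y≢b (xy tx ty) (X gab huv)
      gle : cnt g ≤ 8
      gle = listed-bound _ gs
      hle : cnt h ≤ 4
      hle = listed-bound _ hs

  private
    -- An edge of `h` that avoids `a` still has to meet `ab`, hence passes through `b`.
    away : ∀ {a b} → g a b ≡ true → (∃[ x ] (h b x ≡ true × x ≢ a)) ⊎ Star a h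
    away {a} {b} gab with pick₂ (λ u v → h u v ∧ not (touch a u v))
    ... | inj₂ none = inj₂ st
      where
      st : Star a h
      st {u} {v} huv with touch a u v in eq
      ... | true = touch-elim eq
      ... | false = true≢false (true-∧ huv (cong not eq)) (none u v)
    ... | inj₁ (p , q , e) with ∧-true {h p q} e
    ... | hpq , nt with touch-false {a = a} {p} {q} (not-true nt) | X gab hpq
    ... | p≢a , q≢a | inj₁ (inj₁ p≡a) = contradiction p≡a p≢a
    ... | p≢a , q≢a | inj₁ (inj₂ q≡a) = contradiction q≡a q≢a
    ... | p≢a , q≢a | inj₂ (inj₁ refl) = inj₁ (q , hpq , q≢a)
    ... | p≢a , q≢a | inj₂ (inj₂ refl) = inj₁ (p , H.symm hpq , p≢a)

    -- The edges `ax` and `bx` of `h` leave for `g` only edges through `x` and `ab`. If `h`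
    -- satisfies the same restriction, the pair is a cherry or two triangles. Any other edge of `h`
    -- starts at `a` or `b` and leads to a fourth point, so it completes a matching and
    -- `matching⇒shape` applies.
    triangle⇒shape : ∀ {a b x} → g a b ≡ true → h b x ≡ true → h a x ≡ true → Shape g h
    triangle⇒shape {a} {b} {x} gab hbx hax = go
      where
      a≢b = G.irr gab
      b≢x = H.irr hbx
      a≢x = H.irr hax
      g-edges : ∀ {u v} → g u v ≡ true → (u ≡ x ⊎ v ≡ x) ⊎ Joins u v (a , b)
      g-edges guv with X′ hbx guv | X′ hax guv
      ... | inj₂ tx | _ = inj₁ tx
      ... | _ | inj₂ tx = inj₁ tx
      ... | inj₁ tb | inj₁ ta = inj₂ (joins a≢b ta tb)
      escape : ∀ {u v} → h u v ≡ true → touch x u v ≡ false → touch a u v ∧ touch b u v ≡ false → Shape g h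
      escape {u} {v} huv nx nab with touch-false {a = x} {u} {v} nx | X gab huv
      ... | u≢x , v≢x | inj₁ (inj₁ refl) = matching⇒shape gab hbx huv (λ e → a≢x (sym e)) v≢b (λ e → v≢x (sym e))
        where
        v≢b : v ≢ b
        v≢b refl = true≢false (true-∧ (touch-intro {a = u} {u} {v} (inj₁ refl)) (touch-intro {a = v} {u} {v} (inj₂ refl))) nab
      ... | u≢x , v≢x | inj₁ (inj₂ refl) = matching⇒shape gab hbx (H.symm huv) (λ e → a≢x (sym e)) u≢b (λ e → u≢x (sym e))
        where
        u≢b : u ≢ b
        u≢b refl = true≢false (true-∧ (touch-intro {a = v} {u} {v} (inj₂ refl)) (touch-intro {a = u} {u} {v} (inj₁ refl))) nab
      ... | u≢x , v≢x | inj₂ (inj₁ refl) = matching⇒shape gab huv hax v≢a (λ e → b≢x (sym e)) v≢x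
        where
        v≢a : v ≢ a
        v≢a refl = true≢false (true-∧ (touch-intro {a = v} {u} {v} (inj₂ refl)) (touch-intro {a = u} {u} {v} (inj₁ refl))) nab
      ... | u≢x , v≢x | inj₂ (inj₂ refl) = matching⇒shape gab (H.symm huv) hax u≢a (λ e → b≢x (sym e)) u≢x
        where
        u≢a : u ≢ a
        u≢a refl = true≢false (true-∧ (touch-intro {a = u} {u} {v} (inj₁ refl)) (touch-intro {a = v} {u} {v} (inj₂ refl))) nab
      go : Shape g h
      go with pick₂ (λ u v → h u v ∧ (not (touch x u v) ∧ not (touch a u v ∧ touch b u v)))
      ... | inj₁ (u , v , e) with ∧-true {h u v} e
      ... | huv , e′ with ∧-true {not (touch x u v)} e′
      ... | nx , nab = escape huv (not-true nx) (not-true nab)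
      go | inj₂ none = fin
        where
        h-edges : ∀ {u v} → h u v ≡ true → (u ≡ x ⊎ v ≡ x) ⊎ Joins u v (a , b)
        h-edges {u} {v} huv with touch x u v in ex | touch a u v in ea | touch b u v in eb
        ... | true | _ | _ = inj₁ (touch-elim ex)
        ... | false | true | true = inj₂ (joins a≢b (touch-elim ea) (touch-elim eb))
        ... | false | true | false = true≢false (true-∧ huv (true-∧ (cong not ex) (cong not (cong₂ _∧_ ea eb)))) (none u v)
        ... | false | false | _ = true≢false (true-∧ huv (true-∧ (cong not ex) (cong not (cong (_∧ touch b u v) ea)))) (none u v)
        fin : Shape g h
        fin with h a b in hab
        ... | false = cherry′ x a b (listed-bound ((a , x) ∷ (b , x) ∷ []) hs) g-edges
          where
          hs : ∀ {u v} → h u v ≡ true → Any (Joins u v) ((a , x) ∷ (b , x) ∷ [])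
          hs huv with h-edges huv | X gab huv
          ... | inj₂ j | _ = absent H hab huv j
          ... | inj₁ tx | inj₁ ta = here (joins a≢x ta tx)
          ... | inj₁ tx | inj₂ tb = there (here (joins b≢x tb tx))
        ... | true = small (≤-trans gle (m≤m+n 6 2)) (≤-trans hle (m≤m+n 6 2)) (+-mono-≤ gle hle)
          where
          tri : ∀ {u v} → (u ≡ x ⊎ v ≡ x) ⊎ Joins u v (a , b) → (u ≡ a ⊎ v ≡ a) ⊎ (u ≡ b ⊎ v ≡ b) →
                Any (Joins u v) ((a , b) ∷ (a , x) ∷ (b , x) ∷ [])
          tri (inj₂ j) _ = here j
          tri (inj₁ tx) (inj₁ ta) = there (here (joins a≢x ta tx))
          tri (inj₁ tx) (inj₂ tb) = there (there (here (joins b≢x tb tx)))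
          gle : cnt g ≤ 6
          gle = listed-bound _ (λ guv → tri (g-edges guv) (X′ hab guv))
          hle : cnt h ≤ 6
          hle = listed-bound _ (λ huv → tri (h-edges huv) (X gab huv))

  -- Relative to one edge `ab` of `g`, either `h` is a star at `a` or at `b`, or it has an edge at
  -- each end avoiding the other end. These two edges are disjoint or close a triangle with `ab`.
  shape : (∃[ u ] ∃[ v ] g u v ≡ true) → (∃[ u ] ∃[ v ] h u v ≡ true) → Shape g h
  shape (a , b , gab) h≢∅ with away gab
  ... | inj₂ st = star⇒shape a st h≢∅
  ... | inj₁ (x , hbx , x≢a) with away (G.symm gab)
  ... | inj₂ st = star⇒shape b st h≢∅
  ... | inj₁ (y , hay , y≢b) with x ≟ y
  ... | no x≢y = matching⇒shape gab hbx hay x≢a y≢b x≢y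
  ... | yes refl = triangle⇒shape gab hbx hay

-- Numerical consequences of the classification.

complete-bound≤ : ∀ {n} (P : Subsetᵇ n) {g q} → IsGraph g → On P g → size P ≤ q → cnt g ≤ q * (q ∸ 1)
complete-bound≤ P G on le = ≤-trans (complete-bound P G on) (*-mono-≤ le (∸-monoˡ-≤ 1 le))

star-bound≤ : ∀ {n} (P : Subsetᵇ n) c {g q} → IsGraph g → On P g → Star c g → size P ≤ q → cnt g ≤ 2 * (q ∸ 1)
star-bound≤ P c G on st le = ≤-trans (star-bound P c G on st) (*-monoʳ-≤ 2 (∸-monoˡ-≤ 1 le))

meets-bound≤ : ∀ {n} (P : Subsetᵇ n) a b {g q} → IsGraph g → On P g → Meets a b g → size P ≤ q →
               cnt g ≤ 2 * (q ∸ 1) + 2 * (q ∸ 2)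
meets-bound≤ P a b G on st le = ≤-trans (meets-bound P a b G on st)
  (+-mono-≤ (*-monoʳ-≤ 2 (∸-monoˡ-≤ 1 le)) (*-monoʳ-≤ 2 (∸-monoˡ-≤ 2 le)))

starOr-bound≤ : ∀ {n} (P : Subsetᵇ n) a b c {g q} → IsGraph g → On P g → StarOr a b c g → size P ≤ q →
                cnt g ≤ 2 * (q ∸ 1) + 2
starOr-bound≤ P a b c G on st le = ≤-trans (starOr-bound P a b c G on st)
  (+-monoˡ-≤ 2 (*-monoʳ-≤ 2 (∸-monoˡ-≤ 1 le)))

-- The value is that of two full stars with a common centre, and `single` attains it too. The
-- condition `4 ≤ q` enters through `small`, where 12 ≤ 4(q - 1) is required.
cross-bound : ∀ {n} {g h : Fin n → Fin n → Bool} (P Q : Subsetᵇ n) {q} → 4 ≤ q →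
  IsGraph g → IsGraph h → On P g → On Q h → size P ≤ q → size Q ≤ q → Shape g h →
  cnt g + cnt h ≤ 4 * (q ∸ 1)
cross-bound {g = g} {h} P Q {suc (suc (suc (suc q)))} (s≤s (s≤s (s≤s (s≤s z≤n)))) G H onG onH leP leQ = go
  where
  eq₁ : ∀ x → 2 * (3 + x) + 2 * (3 + x) ≡ 4 * (3 + x)
  eq₁ = solve-∀
  eq₂ : ∀ x → 2 + (2 * (3 + x) + 2 * (2 + x)) ≡ 4 * (3 + x)
  eq₂ = solve-∀
  eq₃ : ∀ x → 4 + (2 * (3 + x) + 2) + 2 * x ≡ 4 * (3 + x)
  eq₃ = solve-∀
  eq₄ : ∀ x → 12 + 4 * x ≡ 4 * (3 + x)
  eq₄ = solve-∀
  go : Shape g h → cnt g + cnt h ≤ 4 * (3 + q)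
  go (star c sg sh) = ≤-trans (+-mono-≤ (star-bound≤ P c G onG sg leP) (star-bound≤ Q c H onH sh leQ)) (≤-reflexive (eq₁ q))
  go (single a b le mt) = ≤-trans (+-mono-≤ le (meets-bound≤ Q a b H onH mt leQ)) (≤-reflexive (eq₂ q))
  go (single′ a b le mt) = ≤-trans (≤-reflexive (+-comm (cnt g) (cnt h)))
    (≤-trans (+-mono-≤ le (meets-bound≤ P a b G onG mt leP)) (≤-reflexive (eq₂ q)))
  go (cherry a b c le so) = ≤-trans (+-mono-≤ le (starOr-bound≤ Q a b c H onH so leQ))
    (≤-trans (m≤m+n _ (2 * q)) (≤-reflexive (eq₃ q)))
  go (cherry′ a b c le so) = ≤-trans (≤-reflexive (+-comm (cnt g) (cnt h)))
    (≤-trans (+-mono-≤ le (starOr-bound≤ P a b c G onG so leP)) (≤-trans (m≤m+n _ (2 * q)) (≤-reflexive (eq₃ q))))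
  go (small _ _ le) = ≤-trans le (≤-trans (m≤m+n 12 (4 * q)) (≤-reflexive (eq₄ q)))

-- Applied with g = F_z^y, h = F_y^z and k the edges of g avoiding the points that dominate z: this is the share of y
-- in the degree of z.
weighted-cross-bound : ∀ {n} {k g h : Fin n → Fin n → Bool} (K P Q : Subsetᵇ n) {q m r w X} →
  IsGraph k → IsGraph g → IsGraph h → On K k → On P g → On Q h →
  (∀ {u v} → k u v ≡ true → g u v ≡ true) →
  size K ≤ q → size P ≤ m → size Q ≤ suc r → Cross g h → (cnt g ≤ 2 → cnt h ≤ w) →
  q * (q ∸ 1) ≤ X → 2 * (q ∸ 1) + 6 * r ≤ X → 2 + 3 * w ≤ X → 6 * r + 10 ≤ X →
  2 * (m ∸ 1) + 2 * (m ∸ 2) + 6 ≤ X → 2 * (m ∸ 1) + 14 ≤ X → 28 ≤ X →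
  cnt k + 3 * cnt h ≤ X
weighted-cross-bound {k = k} {g} {h} K P Q {q} {m} {r} {w} {X} Kk G H onK onG onH k⊆g leK leP leQ cross lw
  x₁ x₂ x₃ x₄ x₅ x₆ x₇ = main
  where
  k≤g : cnt k ≤ cnt g
  k≤g = cnt-mono (λ u v → k⊆g)
  eq₁ : ∀ r → 4 + 3 * (2 * r + 2) ≡ 6 * r + 10
  eq₁ = solve-∀
  eq₂ : ∀ a → a + 2 + 3 * 4 ≡ a + 14
  eq₂ = solve-∀
  eq₃ : ∀ g h → g + 3 * h ≡ (g + h) + 2 * h
  eq₃ = solve-∀
  eq₄ : ∀ a r → a + 3 * (2 * r) ≡ a + 6 * r
  eq₄ = solve-∀
  -- `x₁` serves an empty `h`. The others serve, in this order, `star`, `single` (and an empty `g`),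
  -- `cherry`, `single′`, `cherry′`, `small`. In `single` the graph `h` may have almost twice the
  -- size of a star, so it is controlled by `lw` instead.
  go : Shape g h → cnt k + 3 * cnt h ≤ X
  go (star c sg sh) = ≤-trans (+-mono-≤ (star-bound≤ K c Kk onK (λ e → sg (k⊆g e)) leK)
    (*-monoʳ-≤ 3 (star-bound≤ Q c H onH sh leQ))) (≤-trans (≤-reflexive (eq₄ (2 * (q ∸ 1)) r)) x₂)
  go (single a b le mt) = ≤-trans (+-mono-≤ (≤-trans k≤g le) (*-monoʳ-≤ 3 (lw le))) x₃
  go (single′ a b le mt) = ≤-trans (+-mono-≤ (≤-trans k≤g (meets-bound≤ P a b G onG mt leP)) (*-monoʳ-≤ 3 le)) x₅
  go (cherry a b c le so) = ≤-trans (+-mono-≤ (≤-trans k≤g le) (*-monoʳ-≤ 3 (starOr-bound≤ Q a b c H onH so leQ)))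
    (≤-trans (≤-reflexive (eq₁ r)) x₄)
  go (cherry′ a b c le so) = ≤-trans (+-mono-≤ (≤-trans k≤g (starOr-bound≤ P a b c G onG so leP)) (*-monoʳ-≤ 3 le))
    (≤-trans (≤-reflexive (eq₂ (2 * (m ∸ 1)))) x₆)
  go (small l₁ l₂ l₃) = ≤-trans (+-monoˡ-≤ (3 * cnt h) k≤g) (≤-trans (≤-reflexive (eq₃ (cnt g) (cnt h)))
    (≤-trans (+-mono-≤ l₃ (*-monoʳ-≤ 2 l₂)) x₇))
  main : cnt k + 3 * cnt h ≤ X
  main with pick₂ h
  ... | inj₂ none = ≤-trans (≤-reflexive (trans (cong (λ z → cnt k + 3 * z) (cnt-empty none)) (+-identityʳ (cnt k))))
                      (≤-trans (complete-bound≤ K Kk onK leK) x₁)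
  ... | inj₁ eh with pick₂ g
  ... | inj₂ none = ≤-trans (+-mono-≤ (≤-trans k≤g (≤-trans (≤-reflexive (cnt-empty none)) (z≤n {2}))) (*-monoʳ-≤ 3 (lw (≤-trans (≤-reflexive (cnt-empty none)) z≤n)))) x₃
  ... | inj₁ eg = go (shape G H cross eg eh)

-- Families of marked 4-sets.

-- `f x y u v` says that the 4-set `{x,y,u,v}` is chosen with mark `x`, and `f x y` is the graph
-- F_x^y. The ground set is a subset `S` of a fixed `Fin n`, so points can be deleted without
-- relabelling.
record Family (n : ℕ) : Set where
  field
    S : Subsetᵇ n
    f : Fin n → Fin n → Fin n → Fin n → Bool
    f-swap₁ : ∀ x y u v → f x y u v ≡ f x u y v
    f-swap₂ : ∀ x y u v → f x y u v ≡ f x y v u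
    f-dom : ∀ {x y u v} → f x y u v ≡ true → S x ≡ true × S y ≡ true
    f-irr : ∀ {x y u v} → f x y u v ≡ true → x ≢ y × y ≢ u
    f-cross : ∀ x y → x ≢ y → Cross (f x y) (f y x)

  -- E x y is twice the number of triples D ∋ y such that (x , D) belongs to the family.
  E : Fin n → Fin n → ℕ
  E x y = cnt (f x y)

  -- total and cost z are six times the number of all members and of those whose 4-set contains z.
  total : ℕ
  total = ∑ (λ x → ∑ (E x))

  cost : Fin n → ℕ
  cost z = ∑ (E z) + 3 * ∑ (λ y → E y z)

  f-irr′ : ∀ {x y u v} → f x y u v ≡ true → u ≢ v
  f-irr′ {x} {y} {u} {v} e refl = proj₂ (f-irr (trans (sym (trans (f-swap₁ x y u u) (f-swap₂ x u y u))) e)) refl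

  graph : ∀ x y → IsGraph (f x y)
  graph x y = record { symm = λ {u} {v} e → trans (sym (f-swap₂ x y u v)) e ; irr = f-irr′ }

  f-rest : ∀ {x y u v} → f x y u v ≡ true → S u ≡ true × u ≢ x × u ≢ y
  f-rest {x} {y} {u} {v} e = proj₂ (f-dom e′) , (λ p → proj₁ (f-irr e′) (sym p)) , λ p → proj₂ (f-irr e) (sym p)
    where
    e′ : f x u y v ≡ true
    e′ = trans (sym (f-swap₁ x y u v)) e

  E-diag : ∀ x → E x x ≡ 0
  E-diag x = cnt-empty (λ u v → Bool.¬-not (λ e → proj₁ (f-irr e) refl))

  E-outˡ : ∀ {x} y → S x ≡ false → E x y ≡ 0
  E-outˡ y e = cnt-empty (λ u v → Bool.¬-not (λ p → true≢false (proj₁ (f-dom p)) e))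

  E-outʳ : ∀ x {y} → S y ≡ false → E x y ≡ 0
  E-outʳ x e = cnt-empty (λ u v → Bool.¬-not (λ p → true≢false (proj₂ (f-dom p)) e))

  ground : Fin n → Fin n → Subsetᵇ n → Subsetᵇ n
  ground x y D = ((S ∖ x) ∖ y) ∖∖ D

  clean : Fin n → Fin n → Subsetᵇ n → Fin n → Fin n → Bool
  clean x y D u v = f x y u v ∧ (not (D u) ∧ not (D v))

  clean⊆ : ∀ x y D {u v} → clean x y D u v ≡ true → f x y u v ≡ true
  clean⊆ x y D e = proj₁ (∧-true e)

  clean-graph : ∀ x y D → IsGraph (clean x y D)
  clean-graph x y D = ∧-graph (graph x y) (λ u v → Bool.∧-comm (not (D u)) (not (D v)))

  clean-on : ∀ x y D → On (ground x y D) (clean x y D)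
  clean-on x y D {u} {v} e with ∧-true {f x y u v} e
  ... | p , q with f-rest p
  ... | Su , u≢x , u≢y = true-∧ (∖-intro {P = S ∖ x} (∖-intro {P = S} Su u≢x) u≢y) (proj₁ (∧-true q))

  ground-size : ∀ {x y} D → S x ≡ true → S y ≡ true → x ≢ y →
                (∀ u → D u ≡ true → S u ≡ true × u ≢ x × u ≢ y) →
                2 + (size (ground x y D) + size D) ≡ size S
  ground-size {x} {y} D Sx Sy x≢y C⊆ = trans (cong (2 +_) (size-∖∖ ((S ∖ x) ∖ y) D in-base))
    (trans (cong suc (size-∖ (S ∖ x) (∖-intro {P = S} Sy (λ e → x≢y (sym e))))) (size-∖ S Sx))
    where
    in-base : ∀ u → D u ≡ true → ((S ∖ x) ∖ y) u ≡ true
    in-base u Cu with C⊆ u Cu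
    ... | Su , u≢x , u≢y = ∖-intro {P = S ∖ x} (∖-intro {P = S} Su u≢x) u≢y

  -- Every edge `uv` of F_x^z reappears as the edge `zv` of F_x^u, where it is counted in both
  -- orders.
  half : ∀ x z u → 2 * ∑ (λ v → ⟦ f x z u v ⟧) ≤ E x u
  half x z u = begin
    2 * s ≡⟨ cong (s +_) (+-identityʳ s) ⟩
    s + s ≡⟨ sym (cong₂ _+_ (trans (∑₂-one (λ v → ⟦ f x u z v ⟧)) (∑-cong λ v → cong ⟦_⟧ (f-swap₁ x u z v)))
               (trans (∑-cong (λ w → ∑-select z (λ v → ⟦ f x u w v ⟧)))
                 (∑-cong (λ w → cong ⟦_⟧ (trans (f-swap₂ x u w z) (f-swap₁ x u z w)))))) ⟩
    ∑ (λ w → ∑ (λ v → ⟦ w == z ⟧ * ⟦ f x u z v ⟧)) + ∑ (λ w → ∑ (λ v → ⟦ v == z ⟧ * ⟦ f x u w v ⟧))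
      ≡⟨ sym (∑₂-+ (λ w v → ⟦ w == z ⟧ * ⟦ f x u z v ⟧) (λ w v → ⟦ v == z ⟧ * ⟦ f x u w v ⟧)) ⟩
    ∑ (λ w → ∑ (λ v → ⟦ w == z ⟧ * ⟦ f x u z v ⟧ + ⟦ v == z ⟧ * ⟦ f x u w v ⟧)) ≤⟨ ∑₂-mono pt ⟩
    E x u ∎
    where
    open ≤-Reasoning
    s = ∑ (λ v → ⟦ f x z u v ⟧)
    ∑₂-one : ∀ (b : Fin n → ℕ) → ∑ (λ w → ∑ (λ v → ⟦ w == z ⟧ * b v)) ≡ ∑ b
    ∑₂-one b = trans (∑₂-* (λ w → ⟦ w == z ⟧) b) (trans (cong (_* ∑ b) (∑-== z)) (*-identityˡ (∑ b)))
    pt : ∀ w v → ⟦ w == z ⟧ * ⟦ f x u z v ⟧ + ⟦ v == z ⟧ * ⟦ f x u w v ⟧ ≤ ⟦ f x u w v ⟧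
    pt w v with w == z in ew | v == z in ev
    ... | false | false = z≤n
    ... | false | true = ≤-reflexive (+-identityʳ _)
    ... | true | false with refl ← ==-true {u = w} {z} ew = ≤-reflexive (trans (+-identityʳ _) (+-identityʳ _))
    ... | true | true with refl ← ==-true {u = w} {z} ew | refl ← ==-true {u = v} {z} ev =
      ≤-reflexive (trans (cong (λ k → k + 0 + (k + 0)) (cong ⟦_⟧ zz)) (sym (cong ⟦_⟧ zz)))
      where
      zz : f x u z z ≡ false
      zz = Bool.¬-not (λ e → f-irr′ e refl)

  -- An edge of F_x^z touching `D` in `u` is an edge at `z` of F_x^u. By `half`, the weight `E x u`
  -- pays for both positions in which `u` can stand.
  link : ∀ x z D → E x z ≤ cnt (clean x z D) + ∑ (λ u → ⟦ D u ⟧ * E x u)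
  link x z D = begin
    E x z ≤⟨ ∑₂-mono pt ⟩
    ∑ (λ u → ∑ (λ v → ⟦ clean x z D u v ⟧ + (⟦ D u ⟧ * φ u v + ⟦ D v ⟧ * φ u v)))
      ≡⟨ trans (∑₂-+ (λ u v → ⟦ clean x z D u v ⟧) (λ u v → ⟦ D u ⟧ * φ u v + ⟦ D v ⟧ * φ u v))
           (cong (cnt (clean x z D) +_) (∑₂-+ (λ u v → ⟦ D u ⟧ * φ u v) (λ u v → ⟦ D v ⟧ * φ u v))) ⟩
    cnt (clean x z D) + (∑ (λ u → ∑ (λ v → ⟦ D u ⟧ * φ u v)) + ∑ (λ u → ∑ (λ v → ⟦ D v ⟧ * φ u v)))
      ≡⟨ cong (λ k → cnt (clean x z D) + (∑ (λ u → ∑ (λ v → ⟦ D u ⟧ * φ u v)) + k))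
           (trans (∑-swap (λ u v → ⟦ D v ⟧ * φ u v)) (∑-cong (λ v → ∑-cong (λ u → cong (λ b → ⟦ D v ⟧ * ⟦ b ⟧) (f-swap₂ x z u v))))) ⟩
    cnt (clean x z D) + (A + A) ≡⟨ cong (cnt (clean x z D) +_) (cong (A +_) (sym (+-identityʳ A))) ⟩
    cnt (clean x z D) + 2 * A ≤⟨ +-monoʳ-≤ (cnt (clean x z D)) 2A≤ ⟩
    cnt (clean x z D) + ∑ (λ u → ⟦ D u ⟧ * E x u) ∎
    where
    open ≤-Reasoning
    φ : Fin n → Fin n → ℕ
    φ u v = ⟦ f x z u v ⟧
    A = ∑ (λ u → ∑ (λ v → ⟦ D u ⟧ * φ u v))
    pt : ∀ u v → φ u v ≤ ⟦ clean x z D u v ⟧ + (⟦ D u ⟧ * φ u v + ⟦ D v ⟧ * φ u v)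
    pt u v with f x z u v | D u | D v
    ... | false | _ | _ = z≤n
    ... | true | true | _ = s≤s z≤n
    ... | true | false | true = ≤-refl
    ... | true | false | false = ≤-refl
    2A≤ : 2 * A ≤ ∑ (λ u → ⟦ D u ⟧ * E x u)
    2A≤ = begin
      2 * A ≡⟨ sym (∑-*ˡ 2 (λ u → ∑ (λ v → ⟦ D u ⟧ * φ u v))) ⟩
      ∑ (λ u → 2 * ∑ (λ v → ⟦ D u ⟧ * φ u v)) ≤⟨ ∑-mono (λ u → ≤-trans (≤-reflexive (trans (cong (2 *_) (∑-*ˡ ⟦ D u ⟧ (φ u)))
            (rot ⟦ D u ⟧ (∑ (φ u))))) (*-monoʳ-≤ ⟦ D u ⟧ (half x z u))) ⟩
      ∑ (λ u → ⟦ D u ⟧ * E x u) ∎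
      where
      rot : ∀ a b → 2 * (a * b) ≡ a * (2 * b)
      rot = solve-∀

  -- Triples meeting `D` are sorted by a position holding an element of `D`. By the symmetry of
  -- `f x` all three positions contribute the same sum, which is collected at `y`.
  out-bound : ∀ x D → ∑ (E x) ≤ ∑ (λ y → ⟦ not (D y) ⟧ * cnt (clean x y D) + 3 * (⟦ D y ⟧ * E x y))
  out-bound x D = begin
    ∑ (E x) ≤⟨ ∑-mono (λ y → ∑₂-mono (pt y)) ⟩
    ∑ (λ y → ∑ (λ u → ∑ (λ v → ⟦ not (D y) ⟧ * ⟦ clean x y D u v ⟧ + (⟦ D y ⟧ * φ y u v + (⟦ D u ⟧ * φ y u v + ⟦ D v ⟧ * φ y u v)))))
      ≡⟨ ∑-cong (λ y → trans (∑₂-+ (λ u v → ⟦ not (D y) ⟧ * ⟦ clean x y D u v ⟧) _)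
           (cong₂ _+_ (scale ⟦ not (D y) ⟧ (λ u v → ⟦ clean x y D u v ⟧))
             (trans (∑₂-+ (λ u v → ⟦ D y ⟧ * φ y u v) _) (cong₂ _+_ (scale ⟦ D y ⟧ (φ y)) (∑₂-+ (λ u v → ⟦ D u ⟧ * φ y u v) _))))) ⟩
    ∑ (λ y → a y + (b y + (c y + d y))) ≡⟨ ∑-+ a _ ⟩
    ∑ a + ∑ (λ y → b y + (c y + d y)) ≡⟨ cong (∑ a +_) (trans (∑-+ b _) (cong (∑ b +_) (∑-+ c d))) ⟩
    ∑ a + (∑ b + (∑ c + ∑ d)) ≡⟨ cong₂ (λ s t → ∑ a + (∑ b + (s + t))) c≡b (trans (sym c≡d) c≡b) ⟩
    ∑ a + (∑ b + (∑ b + ∑ b)) ≡⟨ cong (λ k → ∑ a + (∑ b + (∑ b + k))) (sym (+-identityʳ (∑ b))) ⟩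
    ∑ a + 3 * ∑ b ≡⟨ cong (∑ a +_) (sym (∑-*ˡ 3 b)) ⟩
    ∑ a + ∑ (λ y → 3 * b y) ≡⟨ sym (∑-+ a _) ⟩
    ∑ (λ y → a y + 3 * b y) ∎
    where
    open ≤-Reasoning
    φ : Fin n → Fin n → Fin n → ℕ
    φ y u v = ⟦ f x y u v ⟧
    a b c d : Fin n → ℕ
    a y = ⟦ not (D y) ⟧ * cnt (clean x y D)
    b y = ⟦ D y ⟧ * E x y
    c y = ∑ (λ u → ∑ (λ v → ⟦ D u ⟧ * φ y u v))
    d y = ∑ (λ u → ∑ (λ v → ⟦ D v ⟧ * φ y u v))
    scale : ∀ k (ψ : Fin n → Fin n → ℕ) → ∑ (λ u → ∑ (λ v → k * ψ u v)) ≡ k * ∑ (λ u → ∑ (ψ u))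
    scale k ψ = trans (∑-cong (λ u → ∑-*ˡ k (ψ u))) (∑-*ˡ k (λ u → ∑ (ψ u)))
    pt : ∀ y u v → φ y u v ≤ ⟦ not (D y) ⟧ * ⟦ clean x y D u v ⟧ + (⟦ D y ⟧ * φ y u v + (⟦ D u ⟧ * φ y u v + ⟦ D v ⟧ * φ y u v))
    pt y u v with f x y u v | D y | D u | D v
    ... | false | _ | _ | _ = z≤n
    ... | true | true | _ | _ = s≤s z≤n
    ... | true | false | true | _ = s≤s z≤n
    ... | true | false | false | true = ≤-refl
    ... | true | false | false | false = ≤-refl
    c≡b : ∑ c ≡ ∑ b
    c≡b = trans (∑-swap (λ y u → ∑ (λ v → ⟦ D u ⟧ * φ y u v)))
      (∑-cong (λ u → trans (scale ⟦ D u ⟧ (λ y v → φ y u v))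
        (cong (⟦ D u ⟧ *_) (∑-cong (λ y → ∑-cong (λ v → cong ⟦_⟧ (f-swap₁ x y u v)))))))
    c≡d : ∑ c ≡ ∑ d
    c≡d = ∑-cong (λ y → trans (∑-swap (λ u v → ⟦ D u ⟧ * φ y u v))
      (∑-cong (λ v → ∑-cong (λ u → cong (λ k → ⟦ D u ⟧ * ⟦ k ⟧) (f-swap₂ x y u v)))))

-- Deletion and domination

module _ {n} (F : Family n) where
  open Family F

  avoids : Fin n → Fin n → Fin n → Fin n → Fin n → Bool
  avoids z x y u v = not (x == z) ∧ (not (y == z) ∧ (not (u == z) ∧ not (v == z)))

  delete : Fin n → Family n
  delete z = record
    { S = S ∖ z
    ; f = λ x y u v → f x y u v ∧ avoids z x y u v
    ; f-swap₁ = λ x y u v → cong₂ _∧_ (f-swap₁ x y u v) (swap₁ (not (x == z)) (not (y == z)) (not (u == z)) (not (v == z)))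
    ; f-swap₂ = λ x y u v → cong₂ _∧_ (f-swap₂ x y u v) (swap₂ (not (x == z)) (not (y == z)) (not (u == z)) (not (v == z)))
    ; f-dom = λ {x} {y} e → let p , q = ∧-true e ; q₁ , q₂ = ∧-true q in
        true-∧ (proj₁ (f-dom p)) q₁ , true-∧ (proj₂ (f-dom p)) (proj₁ (∧-true {not (y == z)} q₂))
    ; f-irr = λ e → f-irr (proj₁ (∧-true e))
    ; f-cross = λ x y x≢y e e′ → f-cross x y x≢y (proj₁ (∧-true e)) (proj₁ (∧-true e′))
    }
    where
    swap₁ : ∀ a b c d → a ∧ (b ∧ (c ∧ d)) ≡ a ∧ (c ∧ (b ∧ d))
    swap₁ false _ _ _ = refl
    swap₁ true false false _ = refl
    swap₁ true false true _ = refl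
    swap₁ true true c _ = refl
    swap₂ : ∀ a b c d → a ∧ (b ∧ (c ∧ d)) ≡ a ∧ (b ∧ (d ∧ c))
    swap₂ a b c d = cong (λ k → a ∧ (b ∧ k)) (Bool.∧-comm c d)

  -- A lost quadruple has `z` in one of four positions. The mark contributes the first part of
  -- `cost z`, and the other three contribute equal sums by symmetry.
  total-delete : ∀ z → total ≤ Family.total (delete z) + cost z
  total-delete z = begin
    ∑ (λ x → ∑ (λ y → ∑ (λ u → ∑ (λ v → φ x y u v)))) ≤⟨ ∑-mono (λ x → ∑-mono (λ y → ∑₂-mono (pt x y))) ⟩
    ∑ (λ x → ∑ (λ y → ∑ (λ u → ∑ (λ v → ψ x y u v + (⟦ x == z ⟧ * φ x y u v + (⟦ y == z ⟧ * φ x y u v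
      + (⟦ u == z ⟧ * φ x y u v + ⟦ v == z ⟧ * φ x y u v)))))))
      ≡⟨ ∑₂-cong (λ x y → split₂ (ψ x y) (λ u v → ⟦ x == z ⟧ * φ x y u v) (λ u v → ⟦ y == z ⟧ * φ x y u v)
                            (λ u v → ⟦ u == z ⟧ * φ x y u v) (λ u v → ⟦ v == z ⟧ * φ x y u v)) ⟩
    ∑ (λ x → ∑ (λ y → p x y + (a x y + (b x y + (c x y + d x y))))) ≡⟨ split₂ p a b c d ⟩
    ∑₂ p + (∑₂ a + (∑₂ b + (∑₂ c + ∑₂ d))) ≡⟨ cong (∑₂ p +_) (cong₂ _+_ a≡ (cong₂ _+_ b≡ (cong₂ _+_ c≡ d≡))) ⟩
    ∑₂ p + (∑ (E z) + (I + (I + I))) ≡⟨ cong (λ k → ∑₂ p + (∑ (E z) + (I + (I + k)))) (sym (+-identityʳ I)) ⟩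
    Family.total (delete z) + cost z ∎
    where
    open ≤-Reasoning
    φ ψ : Fin n → Fin n → Fin n → Fin n → ℕ
    φ x y u v = ⟦ f x y u v ⟧
    ψ x y u v = ⟦ f x y u v ∧ avoids z x y u v ⟧
    I = ∑ (λ y → E y z)
    ∑₂ : (Fin n → Fin n → ℕ) → ℕ
    ∑₂ g = ∑ (λ x → ∑ (g x))
    ∑₂-cong : ∀ {g h : Fin n → Fin n → ℕ} → (∀ x y → g x y ≡ h x y) → ∑₂ g ≡ ∑₂ h
    ∑₂-cong e = ∑-cong (λ x → ∑-cong (e x))
    split₂ : ∀ (p a b c d : Fin n → Fin n → ℕ) →
      ∑₂ (λ x y → p x y + (a x y + (b x y + (c x y + d x y)))) ≡ ∑₂ p + (∑₂ a + (∑₂ b + (∑₂ c + ∑₂ d)))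
    split₂ p a b c d = trans (∑₂-+ p _) (cong (∑₂ p +_) (trans (∑₂-+ a _) (cong (∑₂ a +_)
      (trans (∑₂-+ b _) (cong (∑₂ b +_) (∑₂-+ c d))))))
    p a b c d : Fin n → Fin n → ℕ
    p x y = ∑₂ (ψ x y)
    a x y = ∑₂ (λ u v → ⟦ x == z ⟧ * φ x y u v)
    b x y = ∑₂ (λ u v → ⟦ y == z ⟧ * φ x y u v)
    c x y = ∑₂ (λ u v → ⟦ u == z ⟧ * φ x y u v)
    d x y = ∑₂ (λ u v → ⟦ v == z ⟧ * φ x y u v)
    scale : ∀ k (θ : Fin n → Fin n → ℕ) → ∑₂ (λ u v → k * θ u v) ≡ k * ∑₂ θ
    scale k θ = trans (∑-cong (λ u → ∑-*ˡ k (θ u))) (∑-*ˡ k (λ u → ∑ (θ u)))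
    a≡ : ∑₂ a ≡ ∑ (E z)
    a≡ = trans (∑-cong (λ x → trans (∑-cong (λ y → scale ⟦ x == z ⟧ (φ x y))) (∑-*ˡ ⟦ x == z ⟧ (E x))))
      (∑-select z (λ x → ∑ (E x)))
    b≡ : ∑₂ b ≡ I
    b≡ = ∑-cong (λ x → trans (∑-cong (λ y → scale ⟦ y == z ⟧ (φ x y))) (∑-select z (E x)))
    c≡ : ∑₂ c ≡ I
    c≡ = ∑-cong (λ x → trans (∑-cong (λ y → trans (∑-cong (λ u → ∑-*ˡ ⟦ u == z ⟧ (φ x y u))) (∑-select z (λ u → ∑ (φ x y u)))))
      (∑-cong (λ y → ∑-cong (λ v → cong ⟦_⟧ (f-swap₁ x y z v)))))
    d≡ : ∑₂ d ≡ I
    d≡ = trans (∑₂-cong (λ x y → trans (∑-swap (λ u v → ⟦ v == z ⟧ * φ x y u v))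
      (∑₂-cong (λ u v → cong (λ k → ⟦ u == z ⟧ * ⟦ k ⟧) (f-swap₂ x y v u))))) c≡
    pt : ∀ x y u v → φ x y u v ≤ ψ x y u v + (⟦ x == z ⟧ * φ x y u v + (⟦ y == z ⟧ * φ x y u v
      + (⟦ u == z ⟧ * φ x y u v + ⟦ v == z ⟧ * φ x y u v)))
    pt x y u v with f x y u v | x == z | y == z | u == z | v == z
    ... | false | _ | _ | _ | _ = z≤n
    ... | true | true | _ | _ | _ = s≤s z≤n
    ... | true | false | true | _ | _ = s≤s z≤n
    ... | true | false | false | true | _ = s≤s z≤n
    ... | true | false | false | false | true = ≤-refl
    ... | true | false | false | false | false = ≤-refl

  -- `m` is the number of points available to a link once its two indices are removed. The threshold
  -- `t` for a large link is tuned to the number of points, and `3 ≤ t` makes domination asymmetric.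
  module InNeighbours (t : ℕ) (3≤t : 3 ≤ t) (m : ℕ) (|S| : size S ≡ 2 + m) where

    -- In z y: y dominates z.
    opaque
      In : Fin n → Subsetᵇ n
      In z y = (t ≤ᵇ E y z) ∧ (E z y ≤ᵇ 2)

    κ : Fin n → ℕ
    κ z = size (In z)

    opaque
      unfolding In

      In-elim : ∀ {z y} → In z y ≡ true → t ≤ E y z × E z y ≤ 2
      In-elim {z} {y} e = ≤ᵇ-elim (proj₁ (∧-true e)) , ≤ᵇ-elim (proj₂ (∧-true {t ≤ᵇ E y z} e))

      In-intro : ∀ {z y} → t ≤ E y z → E z y ≤ 2 → In z y ≡ true
      In-intro p q = true-∧ (≤ᵇ-intro p) (≤ᵇ-intro q)

    In-false : ∀ {z y} → In z y ≡ false → E z y ≤ 2 → E y z < t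
    In-false e q = ≰⇒> (λ p → true≢false (In-intro p q) e)

    In⊆ : ∀ {z y} → In z y ≡ true → S y ≡ true × y ≢ z
    In⊆ {z} {y} e = Sy , y≢z
      where
      big : 1 ≤ E y z
      big = ≤-trans (≤-trans (s≤s z≤n) 3≤t) (proj₁ (In-elim e))
      Sy : S y ≡ true
      Sy with S y in Sy
      ... | true = refl
      ... | false = contradiction (≤-trans big (≤-reflexive (E-outˡ z Sy))) λ ()
      y≢z : y ≢ z
      y≢z refl = contradiction (≤-trans big (≤-reflexive (E-diag y))) λ ()

    In-S : ∀ {z y} → In z y ≡ true → S z ≡ true
    In-S {z} {y} e with S z in Sz
    ... | true = refl
    ... | false = contradiction (≤-trans 3≤t (≤-trans (proj₁ (In-elim e)) (≤-reflexive (E-outʳ y Sz)))) λ ()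

    In-asym : ∀ {z y} → In z y ≡ true → In y z ≡ false
    In-asym {z} {y} e = Bool.¬-not (λ e′ → contradiction (≤-trans 3≤t (≤-trans (proj₁ (In-elim e)) (proj₂ (In-elim e′)))) λ { (s≤s (s≤s ())) })

    ground≡ : ∀ {x y} D → S x ≡ true → S y ≡ true → x ≢ y →
              (∀ u → D u ≡ true → S u ≡ true × u ≢ x × u ≢ y) → size (ground x y D) + size D ≡ m
    ground≡ D Sx Sy x≢y C⊆ = suc-injective (suc-injective (trans (ground-size D Sx Sy x≢y C⊆) |S|))

    ground≤ : ∀ {x y} D → S x ≡ true → S y ≡ true → x ≢ y →
              (∀ u → D u ≡ true → S u ≡ true × u ≢ x × u ≢ y) → size (ground x y D) ≤ m ∸ size D
    ground≤ D Sx Sy x≢y C⊆ = ≤-reflexive (sym (trans (cong (_∸ size D) (sym (ground≡ D Sx Sy x≢y C⊆))) (m+n∸n≡m _ (size D))))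

    In-ground : ∀ {x y} → In x y ≡ false → ∀ u → In x u ≡ true → S u ≡ true × u ≢ x × u ≢ y
    In-ground e u e′ = proj₁ (In⊆ e′) , proj₂ (In⊆ e′) , λ { refl → true≢false e′ e }

    module _ {z y} (y∈ : In z y ≡ true) (D : Subsetᵇ n) (C⊆ : ∀ u → D u ≡ true → In y u ≡ true) where
      private
        q = m ∸ size D
        Sy = proj₁ (In⊆ y∈)
        Sz = In-S y∈
        y≢z = proj₂ (In⊆ y∈)
        C-ok : ∀ u → D u ≡ true → S u ≡ true × u ≢ y × u ≢ z
        C-ok u Cu = In-ground (In-asym y∈) u (C⊆ u Cu)
        leak : ∑ (λ u → ⟦ D u ⟧ * E y u) ≤ 2 * size D
        leak = ≤-trans (∑-mono pt) (≤-reflexive (trans (∑-*ʳ 2 (λ u → ⟦ D u ⟧)) (*-comm (size D) 2)))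
          where
          pt : ∀ u → ⟦ D u ⟧ * E y u ≤ ⟦ D u ⟧ * 2
          pt u with D u in Cu
          ... | false = z≤n
          ... | true = +-monoˡ-≤ 0 (proj₂ (In-elim (C⊆ u Cu)))

      -- Each `u` in `D` dominates `y`, so `E y u` is at most 2. Hence by `link` the edges touching
      -- `D` cost at most `2 * size D`, and the others live on `q` points.
      in-bound : E y z ≤ q * (q ∸ 1) + 2 * size D
      in-bound = ≤-trans (link y z D) (+-mono-≤
        (complete-bound≤ (ground y z D) (clean-graph y z D) (clean-on y z D) (ground≤ D Sy Sz y≢z C-ok)) leak)

      in-bound-clean : (∀ u → D u ≡ true → E y u ≡ 0) → E y z ≤ q * (q ∸ 1)
      in-bound-clean zero! = ≤-trans (link y z D) (≤-trans (+-mono-≤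
        (complete-bound≤ (ground y z D) (clean-graph y z D) (clean-on y z D) (ground≤ D Sy Sz y≢z C-ok))
        (≤-reflexive (∑-zero pt))) (≤-reflexive (+-identityʳ _)))
        where
        pt : ∀ u → ⟦ D u ⟧ * E y u ≡ 0
        pt u with D u in Cu
        ... | false = refl
        ... | true = trans (+-identityʳ _) (zero! u Cu)

      -- A single edge of F_z^y must be met by every edge of F_y^z, which reduces a complete graph
      -- to two stars.
      clean-odd-bound : E z y ≢ 0 → cnt (clean y z D) ≤ 2 * (q ∸ 1) + 2 * (q ∸ 2)
      clean-odd-bound odd with pick₂ (f z y)
      ... | inj₂ none = contradiction (cnt-empty none) odd
      ... | inj₁ (a , b , e) = meets-bound≤ (ground y z D) a b (clean-graph y z D) (clean-on y z D)
            (λ e′ → f-cross z y (λ p → y≢z (sym p)) e (clean⊆ y z D e′)) (ground≤ D Sy Sz y≢z C-ok)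

      in-bound-odd : E z y ≢ 0 → E y z ≤ 2 * (q ∸ 1) + 2 * (q ∸ 2) + 2 * size D
      in-bound-odd odd = ≤-trans (link y z D) (+-mono-≤ (clean-odd-bound odd) leak)

    -- The share of `y` in `cost z`, with the first part of the cost redistributed by `out-bound`
    -- for the set of points dominating `z`.
    charge : Fin n → Fin n → ℕ
    charge z y = (⟦ not (In z y) ⟧ * cnt (clean z y (In z)) + 3 * (⟦ In z y ⟧ * E z y)) + 3 * E y z

    cost≤charges : ∀ z → cost z ≤ ∑ (charge z)
    cost≤charges z = ≤-trans (+-mono-≤ (out-bound z (In z)) (≤-reflexive (sym (∑-*ˡ 3 (λ y → E y z)))))
      (≤-reflexive (sym (∑-+ (λ y → ⟦ not (In z y) ⟧ * cnt (clean z y (In z)) + 3 * (⟦ In z y ⟧ * E z y)) (λ y → 3 * E y z))))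

    rest : Fin n → Subsetᵇ n
    rest z = (S ∖ z) ∖∖ In z

    rest-size : ∀ {z} → S z ≡ true → size (rest z) + κ z ≡ 1 + m
    rest-size {z} Sz = trans (size-∖∖ (S ∖ z) (In z) (λ u e → ∖-intro {P = S} (proj₁ (In⊆ e)) (proj₂ (In⊆ e))))
      (suc-injective (trans (size-∖ S Sz) |S|))

    charge-in : ∀ {z y} → In z y ≡ true → charge z y ≡ 3 * E z y + 3 * E y z
    charge-in {z} {y} e rewrite e = cong (λ k → 3 * k + 3 * E y z) (+-identityʳ (E z y))

    charge-out : ∀ {z y} → In z y ≡ false → charge z y ≡ cnt (clean z y (In z)) + 3 * E y z
    charge-out {z} {y} e rewrite e = cong (_+ 3 * E y z) (trans (+-identityʳ (c + 0)) (+-identityʳ c))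
      where
      c = cnt (clean z y (In z))

    charge-other : ∀ {z y} → rest z y ≡ false → In z y ≡ false → charge z y ≡ 0
    charge-other {z} {y} r i = trans (charge-out {z} {y} i) (zero! (S y Bool.≟ true) (y ≟ z))
      where
      c≤ : cnt (clean z y (In z)) ≤ E z y
      c≤ = cnt-mono (λ u v → clean⊆ z y (In z))
      zero! : Dec (S y ≡ true) → Dec (y ≡ z) → cnt (clean z y (In z)) + 3 * E y z ≡ 0
      zero! (no ¬Sy) _ = cong₂ (λ a b → a + 3 * b) (n≤0⇒n≡0 (≤-trans c≤ (≤-reflexive (E-outʳ z (Bool.¬-not ¬Sy))))) (E-outˡ z (Bool.¬-not ¬Sy))
      zero! _ (yes refl) = cong₂ (λ a b → a + 3 * b) (n≤0⇒n≡0 (≤-trans c≤ (≤-reflexive (E-diag z)))) (E-diag z)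
      zero! (yes Sy) (no y≢z) = true≢false (∖∖-intro {P = S ∖ z} {Q = In z} (∖-intro {P = S} Sy y≢z) i) r

    -- `δ` collects known shortfalls of individual charges, so that a few good points can be
    -- exploited without splitting the sum.
    charges≤ : ∀ {z} A X (δ : Fin n → ℕ) →
      (∀ y → In z y ≡ true → charge z y + δ y ≤ A) → (∀ y → rest z y ≡ true → charge z y + δ y ≤ X) →
      (∀ y → In z y ≡ false → rest z y ≡ false → δ y ≡ 0) →
      cost z + ∑ δ ≤ κ z * A + size (rest z) * X
    charges≤ {z} A X δ hi hr ho = begin
      cost z + ∑ δ ≤⟨ +-monoˡ-≤ (∑ δ) (cost≤charges z) ⟩
      ∑ (charge z) + ∑ δ ≡⟨ sym (∑-+ (charge z) δ) ⟩
      ∑ (λ y → charge z y + δ y) ≤⟨ ∑-mono pt ⟩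
      ∑ (λ y → ⟦ In z y ⟧ * A + ⟦ rest z y ⟧ * X) ≡⟨ ∑-+ (λ y → ⟦ In z y ⟧ * A) (λ y → ⟦ rest z y ⟧ * X) ⟩
      ∑ (λ y → ⟦ In z y ⟧ * A) + ∑ (λ y → ⟦ rest z y ⟧ * X) ≡⟨ cong₂ _+_ (∑-*ʳ A (λ y → ⟦ In z y ⟧)) (∑-*ʳ X (λ y → ⟦ rest z y ⟧)) ⟩
      κ z * A + size (rest z) * X ∎
      where
      open ≤-Reasoning
      pt : ∀ y → charge z y + δ y ≤ ⟦ In z y ⟧ * A + ⟦ rest z y ⟧ * X
      pt y = by-cases (In z y Bool.≟ true) (rest z y Bool.≟ true)
        where
        by-cases : Dec (In z y ≡ true) → Dec (rest z y ≡ true) → charge z y + δ y ≤ ⟦ In z y ⟧ * A + ⟦ rest z y ⟧ * X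
        by-cases (yes i) _ = ≤-trans (hi y i) (≤-trans (≤-reflexive (sym (trans (cong (λ b → ⟦ b ⟧ * A) i) (*-identityˡ A)))) (m≤m+n _ _))
        by-cases (no _) (yes r) = ≤-trans (hr y r) (≤-trans (≤-reflexive (sym (trans (cong (λ b → ⟦ b ⟧ * X) r) (*-identityˡ X)))) (m≤n+m _ _))
        by-cases (no i) (no r) = ≤-trans (≤-reflexive (cong₂ _+_ (charge-other {z} {y} (Bool.¬-not r) (Bool.¬-not i)) (ho y (Bool.¬-not i) (Bool.¬-not r)))) z≤n

    -- `weighted-cross-bound` with `r = m ∸ 1`, as F_y^z lives on `m` points, and with `w = t ∸ 1`:
    -- since `y` does not dominate `z`, a link F_z^y with at most one edge forces F_y^z below the
    -- threshold.
    charge-rest≤ : ∀ {z y} X → S z ≡ true → rest z y ≡ true →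
      (let q = m ∸ κ z) → 1 ≤ m →
      q * (q ∸ 1) ≤ X → 2 * (q ∸ 1) + 6 * (m ∸ 1) ≤ X → 2 + 3 * (t ∸ 1) ≤ X → 6 * (m ∸ 1) + 10 ≤ X →
      2 * (m ∸ 1) + 2 * (m ∸ 2) + 6 ≤ X → 2 * (m ∸ 1) + 14 ≤ X → 28 ≤ X →
      charge z y ≤ X
    charge-rest≤ {z} {y} X Sz r 1≤m x₁ x₂ x₃ x₄ x₅ x₆ x₇ with ∖∖-elim {P = S ∖ z} {Q = In z} r
    ... | p , i with ∖-elim {P = S} p
    ... | Sy , y≢z = ≤-trans (≤-reflexive (charge-out {z} {y} i))
      (weighted-cross-bound (ground z y (In z)) (ground z y (λ _ → false)) (ground y z (λ _ → false)) {w = t ∸ 1}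
        (clean-graph z y (In z)) (graph z y) (graph y z) (clean-on z y (In z)) (on z y) (on y z) (clean⊆ z y (In z))
        (ground≤ (In z) Sz Sy (λ e → y≢z (sym e)) (In-ground i))
        (ground≤m Sz Sy (λ e → y≢z (sym e))) (≤-trans (ground≤m Sy Sz y≢z) (≤-reflexive (sym (m+[n∸m]≡n 1≤m))))
        (f-cross z y (λ e → y≢z (sym e)))
        (λ le → <⇒≤pred (In-false i le)) x₁ x₂ x₃ x₄ x₅ x₆ x₇)
      where
      on : ∀ x y → On (ground x y (λ _ → false)) (f x y)
      on x y e with f-rest e
      ... | Su , u≢x , u≢y = ∖∖-intro {P = (S ∖ x) ∖ y} {Q = λ _ → false} (∖-intro {P = S ∖ x} (∖-intro {P = S} Su u≢x) u≢y) refl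
      ground≤m : ∀ {x y} → S x ≡ true → S y ≡ true → x ≢ y → size (ground x y (λ _ → false)) ≤ m
      ground≤m Sx Sy x≢y = ≤-trans (ground≤ (λ _ → false) Sx Sy x≢y (λ u ())) (m∸n≤m m (size {n} (λ _ → false)))

-- A point of small degree among twelve or more points.

argmin : ∀ {n} (P : Subsetᵇ n) (k : Fin n → ℕ) → ∃[ u ] P u ≡ true →
         ∃[ z ] P z ≡ true × (∀ y → P y ≡ true → k z ≤ k y)
argmin {n} P k (u , Pu) = go (k u) u Pu ≤-refl
  where
  go : ∀ b u → P u ≡ true → k u ≤ b → ∃[ z ] P z ≡ true × (∀ y → P y ≡ true → k z ≤ k y)
  go b u Pu le with pick (λ y → P y ∧ (suc (k y) ≤ᵇ k u))
  go b u Pu le | inj₂ none = u , Pu , λ y Py → ≮⇒≥ (λ lt → true≢false (true-∧ Py (≤ᵇ-intro lt)) (none y))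
  go b u Pu le | inj₁ (y , e) with ∧-true {P y} e
  go zero u Pu le | inj₁ (y , e) | Py , lt = contradiction (≤-trans (≤ᵇ-elim {suc (k y)} lt) le) λ ()
  go (suc b) u Pu le | inj₁ (y , e) | Py , lt = go b y Py (≤-pred (≤-trans (≤ᵇ-elim {suc (k y)} lt) le))

-- Cap for the charge of a point not dominating `z` when `k` points do: an empty F_y^z, a common
-- star, and all other shapes. The last entry is the cherry value 6(m - 1) + 10, which covers the
-- remaining shapes for `m` at least 4.
X : ℕ → ℕ → ℕ
X m k = (m ∸ k) * (m ∸ k ∸ 1) ⊔ (2 * (m ∸ k ∸ 1) + 6 * (m ∸ 1) ⊔ (6 * m + 4))

X-lub : ∀ m k {B} → (m ∸ k) * (m ∸ k ∸ 1) ≤ B → 2 * (m ∸ k ∸ 1) + 6 * (m ∸ 1) ≤ B → 6 * m + 4 ≤ B → X m k ≤ B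
X-lub m k x₁ x₂ x₃ = ⊔-lub x₁ (⊔-lub x₂ x₃)

-- Cost of a point with `k` dominating points, each itself dominated by at least `k` points: 6
-- covers `3 * E z y`, and the inner bracket is the bound of `in-bound` on `E y z`.
crude : ℕ → ℕ → ℕ
crude m k = k * (6 + 3 * ((m ∸ k) * (m ∸ k ∸ 1) + 2 * k)) + (1 + m ∸ k) * X m k

-- The sparse estimate in `crude-large` fails for these `m`, so they are checked by computation.
crude-small : ∀ {m} → m < 31 → ∀ {k} → k < 33 → 10 ≤ m → 1 ≤ k → k ≤ 1 + m → crude m k ≤ (1 + m) * (m * (m ∸ 1))
crude-small = toWitness {a? = allUpTo? (λ m → allUpTo? (λ k →
  10 ≤? m →-dec 1 ≤? k →-dec k ≤? 1 + m →-dec crude m k ≤? (1 + m) * (m * (m ∸ 1))) 33) 31} tt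

-- The cutoff 8(m - 1) bounds the star entry of `X` for every `k`. Above it, `X` is the
-- complete-graph entry and a cubic identity finishes. Below it, everything is at most quadratic in
-- `m` and loses to the cubic right-hand side.
crude-large : ∀ {m k} → 31 ≤ m → 1 ≤ k → k ≤ 1 + m → crude m k ≤ (1 + m) * (m * (m ∸ 1))
crude-large {m} {k} 31≤m 1≤k k≤ with (m ∸ k) * (m ∸ k ∸ 1) ≤? 8 * (m ∸ 1)
... | no big = dense (k ≤? m)
  where
  dense : Dec (k ≤ m) → crude m k ≤ (1 + m) * (m * (m ∸ 1))
  dense (no k≰m) = contradiction (≤-trans (≤-reflexive (cong (λ q → q * (q ∸ 1)) (m≤n⇒m∸n≡0 (<⇒≤ (≰⇒> k≰m))))) z≤n) big
  dense (yes k≤m) = step (m ∸ k) refl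
    where
    open ≤-Reasoning
    X≤ : X m k ≤ (m ∸ k) * (m ∸ k ∸ 1)
    X≤ = ⊔-lub ≤-refl (⊔-lub (≤-trans (≤-trans (+-monoˡ-≤ (6 * (m ∸ 1)) (*-monoʳ-≤ 2 (∸-monoˡ-≤ 1 (m∸n≤m m k))))
        (≤-reflexive (sym (*-distribʳ-+ (m ∸ 1) 2 6)))) (≰⇒≥ big))
      (≤-trans six (≰⇒≥ big)))
      where
      six : 6 * m + 4 ≤ 8 * (m ∸ 1)
      six = subst (λ z → 6 * z + 4 ≤ 8 * (z ∸ 1)) (m+[n∸m]≡n 31≤m) (from-slack (50 + 2 * (m ∸ 31)) (e (m ∸ 31)))
        where
        e : ∀ p → 6 * (31 + p) + 4 + (50 + 2 * p) ≡ 8 * (30 + p)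
        e = solve-∀
    step : ∀ q → m ∸ k ≡ q → crude m k ≤ (1 + m) * (m * (m ∸ 1))
    step 0 eq = contradiction (≤-trans (≤-reflexive (cong (λ q → q * (q ∸ 1)) eq)) z≤n) big
    step 1 eq = contradiction (≤-trans (≤-reflexive (cong (λ q → q * (q ∸ 1)) eq)) z≤n) big
    step 2 eq = contradiction (≤-trans (≤-reflexive (cong (λ q → q * (q ∸ 1)) eq)) (≤-trans (m≤m+n 2 238) (*-monoʳ-≤ 8 (∸-monoˡ-≤ 1 31≤m)))) big
    step (suc (suc (suc p))) eq = begin
      crude m k ≤⟨ +-monoʳ-≤ (k * (6 + 3 * ((m ∸ k) * (m ∸ k ∸ 1) + 2 * k))) (*-monoʳ-≤ (1 + m ∸ k) X≤) ⟩
      k * (6 + 3 * ((m ∸ k) * (m ∸ k ∸ 1) + 2 * k)) + (1 + m ∸ k) * ((m ∸ k) * (m ∸ k ∸ 1))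
        ≡⟨ cong₂ (λ q r → k * (6 + 3 * (q * (q ∸ 1) + 2 * k)) + r * (q * (q ∸ 1))) eq (trans (+-∸-assoc 1 k≤m) (cong suc eq)) ⟩
      k * (6 + 3 * ((3 + p) * (2 + p) + 2 * k)) + (4 + p) * ((3 + p) * (2 + p)) ≤⟨ m≤m+n _ (k * ((k + 1) * (k + 2 + 3 * p))) ⟩
      k * (6 + 3 * ((3 + p) * (2 + p) + 2 * k)) + (4 + p) * ((3 + p) * (2 + p)) + k * ((k + 1) * (k + 2 + 3 * p)) ≡⟨ poly p k ⟩
      (1 + (3 + p + k)) * ((3 + p + k) * (2 + p + k)) ≡⟨ cong (λ z → (1 + z) * (z * (z ∸ 1))) (trans (cong (_+ k) (sym eq)) (m∸n+n≡m k≤m)) ⟩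
      (1 + m) * (m * (m ∸ 1)) ∎
      where
      poly : ∀ p k → k * (6 + 3 * ((3 + p) * (2 + p) + 2 * k)) + (4 + p) * ((3 + p) * (2 + p)) + k * ((k + 1) * (k + 2 + 3 * p))
                     ≡ (1 + (3 + p + k)) * ((3 + p + k) * (2 + p + k))
      poly = solve-∀
... | yes sparse = begin
    crude m k ≤⟨ +-mono-≤ (*-monoʳ-≤ k (+-monoʳ-≤ 6 (*-monoʳ-≤ 3 (+-monoˡ-≤ (2 * k) sparse)))) (*-monoʳ-≤ (1 + m ∸ k) X≤) ⟩
    k * (6 + 3 * (8 * (m ∸ 1) + 2 * k)) + (1 + m ∸ k) * (8 * (m ∸ 1)) ≡⟨ cong (_+ (1 + m ∸ k) * (8 * (m ∸ 1))) (e₁ k (m ∸ 1)) ⟩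
    k * (6 + 6 * k + 16 * (m ∸ 1)) + k * (8 * (m ∸ 1)) + (1 + m ∸ k) * (8 * (m ∸ 1))
      ≡⟨ trans (+-assoc (k * (6 + 6 * k + 16 * (m ∸ 1))) _ _) (cong (k * (6 + 6 * k + 16 * (m ∸ 1)) +_)
          (trans (sym (*-distribʳ-+ (8 * (m ∸ 1)) k (1 + m ∸ k))) (cong (_* (8 * (m ∸ 1))) (m+[n∸m]≡n k≤)))) ⟩
    k * (6 + 6 * k + 16 * (m ∸ 1)) + (1 + m) * (8 * (m ∸ 1))
      ≤⟨ +-monoˡ-≤ ((1 + m) * (8 * (m ∸ 1))) (*-mono-≤ k≤ (+-monoˡ-≤ (16 * (m ∸ 1)) (+-monoʳ-≤ 6 (*-monoʳ-≤ 6 k≤)))) ⟩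
    (1 + m) * (6 + 6 * (1 + m) + 16 * (m ∸ 1)) + (1 + m) * (8 * (m ∸ 1)) ≡⟨ sym (*-distribˡ-+ (1 + m) (6 + 6 * (1 + m) + 16 * (m ∸ 1)) (8 * (m ∸ 1))) ⟩
    (1 + m) * (6 + 6 * (1 + m) + 16 * (m ∸ 1) + 8 * (m ∸ 1)) ≤⟨ *-monoʳ-≤ (1 + m) fin ⟩
    (1 + m) * (m * (m ∸ 1)) ∎
  where
  open ≤-Reasoning
  p = m ∸ 31
  m≡ : 31 + p ≡ m
  m≡ = m+[n∸m]≡n 31≤m
  X≤ : X m k ≤ 8 * (m ∸ 1)
  X≤ = ⊔-lub sparse (⊔-lub (≤-trans (+-monoˡ-≤ (6 * (m ∸ 1)) (*-monoʳ-≤ 2 (∸-monoˡ-≤ 1 (m∸n≤m m k))))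
        (≤-reflexive (sym (*-distribʳ-+ (m ∸ 1) 2 6))))
      (subst (λ z → 6 * z + 4 ≤ 8 * (z ∸ 1)) m≡ (from-slack (50 + 2 * p) (e p))))
    where
    e : ∀ p → 6 * (31 + p) + 4 + (50 + 2 * p) ≡ 8 * (30 + p)
    e = solve-∀
  e₁ : ∀ k w → k * (6 + 3 * (8 * w + 2 * k)) ≡ k * (6 + 6 * k + 16 * w) + k * (8 * w)
  e₁ = solve-∀
  -- The left side is 30m - 12, which stays below m(m - 1) from `m = 31` on; this is the origin of
  -- 31.
  fin : 6 + 6 * (1 + m) + 16 * (m ∸ 1) + 8 * (m ∸ 1) ≤ m * (m ∸ 1)
  fin = subst (λ z → 6 + 6 * (1 + z) + 16 * (z ∸ 1) + 8 * (z ∸ 1) ≤ z * (z ∸ 1)) m≡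
    (from-slack (12 + 31 * p + p * p) (e p))
    where
    e : ∀ p → 6 + 6 * (1 + (31 + p)) + 16 * (30 + p) + 8 * (30 + p) + (12 + 31 * p + p * p) ≡ (31 + p) * (30 + p)
    e = solve-∀

crude-bound : ∀ {m k} → 10 ≤ m → 1 ≤ k → k ≤ 1 + m → crude m k ≤ (1 + m) * (m * (m ∸ 1))
crude-bound {m} {k} 10≤m 1≤k k≤ with 31 ≤? m
... | yes 31≤m = crude-large 31≤m 1≤k k≤
... | no ¬31 = crude-small (≰⇒> ¬31) (≤-trans (s≤s k≤) (s≤s (s≤s (≰⇒≥ ¬31)))) 10≤m 1≤k k≤

module _ {n} (F : Family n) (t : ℕ) (3≤t : 3 ≤ t) (m : ℕ) (|S| : size (Family.S F) ≡ 2 + m) where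
  open Family F
  open InNeighbours F t 3≤t m |S|

  κ≤1+m : ∀ {z} → S z ≡ true → κ z ≤ 1 + m
  κ≤1+m {z} Sz = ≤-trans (m≤n+m (κ z) (size (rest z))) (≤-reflexive (rest-size Sz))

  rest≡ : ∀ {z} → S z ≡ true → size (rest z) ≡ 1 + m ∸ κ z
  rest≡ {z} Sz = trans (sym (m+n∸n≡m _ (κ z))) (cong (_∸ κ z) (rest-size Sz))

  member : ∃[ u ] S u ≡ true
  member with pick S
  ... | inj₁ e = e
  ... | inj₂ none = contradiction (trans (sym (∑-zero (λ u → cong ⟦_⟧ (none u)))) |S|) λ ()

  undominated-cost : ∀ {z} B → S z ≡ true → κ z ≡ 0 → (∀ y → rest z y ≡ true → charge z y ≤ B) → cost z ≤ (1 + m) * B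
  undominated-cost {z} B Sz κ0 h = ≤-trans (m≤m+n (cost z) _) (≤-trans
    (charges≤ 0 B (λ _ → 0) (λ y e → true≢false e (size≡0⇒ κ0 y)) (λ y r → ≤-trans (≤-reflexive (+-identityʳ _)) (h y r)) (λ _ _ _ → refl))
    (≤-reflexive (cong₂ (λ a b → a * 0 + b * B) κ0 (trans (rest≡ Sz) (cong (1 + m ∸_) κ0)))))

  -- Only `k` of the points dominating `y` are removed, which yields the bound at `k` itself rather
  -- than at `κ y`.
  in-bound-min : ∀ {z y} → In z y ≡ true → ∀ {k} → k ≤ κ y → E y z ≤ (m ∸ k) * (m ∸ k ∸ 1) + 2 * k
  in-bound-min {z} {y} e {k} k≤ with subset-of-size (In y) (κ y ∸ k) k (sym (m+[n∸m]≡n k≤))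
  ... | D , refl , C⊆ = in-bound e D C⊆

  -- A full star on `m` points has count 2(m - 1), so with this threshold a link is large as soon as
  -- it beats a star.
  module _ (t≡ : t ≡ 2 * m ∸ 1) (4≤m : 4 ≤ m) where
    private
      p = m ∸ 4
      m≡ : 4 + p ≡ m
      m≡ = m+[n∸m]≡n 4≤m

    charge≤X : ∀ {z y} → S z ≡ true → rest z y ≡ true → charge z y ≤ X m (κ z)
    charge≤X {z} {y} Sz r = charge-rest≤ (X m (κ z)) Sz r (≤-trans (s≤s z≤n) 4≤m)
      (m≤m⊔n Q _) (≤-trans (m≤m⊔n R _) (m≤n⊔m Q _))
      (≤X (≤-trans (≤-reflexive (cong (λ x → 2 + 3 * (x ∸ 1)) t≡)) (via (λ m → 2 + 3 * (2 * m ∸ 1 ∸ 1)) (λ p → 20 + 6 * p) (λ p → 8) e₁ e₁′)))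
      (≤X (via (λ m → 6 * (m ∸ 1) + 10) (λ p → 28 + 6 * p) (λ p → 0) (λ p → e₂ p) e₂′))
      (≤X (via (λ m → 2 * (m ∸ 1) + 2 * (m ∸ 2) + 6) (λ p → 16 + 4 * p) (λ p → 12 + 2 * p) e₃ e₃′))
      (≤X (via (λ m → 2 * (m ∸ 1) + 14) (λ p → 20 + 2 * p) (λ p → 8 + 4 * p) e₄ e₄′))
      (≤X (via (λ _ → 28) (λ _ → 28) (λ p → 6 * p) (λ _ → refl) e₅′))
      where
      Q = (m ∸ κ z) * (m ∸ κ z ∸ 1)
      R = 2 * (m ∸ κ z ∸ 1) + 6 * (m ∸ 1)
      ≤X : ∀ {x} → x ≤ 6 * m + 4 → x ≤ X m (κ z)
      ≤X le = ≤-trans le (≤-trans (m≤n⊔m R _) (m≤n⊔m Q _))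
      via : ∀ (φ : ℕ → ℕ) (ψ slack : ℕ → ℕ) → (∀ p → φ (4 + p) ≡ ψ p) → (∀ p → ψ p + slack p ≡ 6 * (4 + p) + 4) → φ m ≤ 6 * m + 4
      via φ ψ slack e e′ = subst (λ m → φ m ≤ 6 * m + 4) m≡
        (≤-trans (≤-reflexive (e p)) (≤-trans (m≤m+n (ψ p) (slack p)) (≤-reflexive (e′ p))))
      e₁ : ∀ p → 2 + 3 * (2 * (4 + p) ∸ 1 ∸ 1) ≡ 20 + 6 * p
      e₁ p = trans (cong (λ x → 2 + 3 * (x ∸ 1 ∸ 1)) (e₁″ p)) (e₁‴ p)
        where
        e₁″ : ∀ p → 2 * (4 + p) ≡ 8 + 2 * p
        e₁″ = solve-∀
        e₁‴ : ∀ p → 2 + 3 * (6 + 2 * p) ≡ 20 + 6 * p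
        e₁‴ = solve-∀
      e₁′ : ∀ p → 20 + 6 * p + 8 ≡ 6 * (4 + p) + 4
      e₁′ = solve-∀
      e₂ : ∀ p → 6 * (3 + p) + 10 ≡ 28 + 6 * p
      e₂ = solve-∀
      e₂′ : ∀ p → 28 + 6 * p + 0 ≡ 6 * (4 + p) + 4
      e₂′ = solve-∀
      e₃ : ∀ p → 2 * (3 + p) + 2 * (2 + p) + 6 ≡ 16 + 4 * p
      e₃ = solve-∀
      e₃′ : ∀ p → 16 + 4 * p + (12 + 2 * p) ≡ 6 * (4 + p) + 4
      e₃′ = solve-∀
      e₄ : ∀ p → 2 * (3 + p) + 14 ≡ 20 + 2 * p
      e₄ = solve-∀
      e₄′ : ∀ p → 20 + 2 * p + (8 + 4 * p) ≡ 6 * (4 + p) + 4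
      e₄′ = solve-∀
      e₅′ : ∀ p → 28 + 6 * p ≡ 6 * (4 + p) + 4
      e₅′ = solve-∀

    -- Minimality is applied to the points dominating `z`: each is dominated by at least `κ z`
    -- points, and its link into `z` shrinks accordingly.
    least-dominated-cost : ∀ {z} → S z ≡ true → (∀ y → S y ≡ true → κ z ≤ κ y) → cost z ≤ crude m (κ z)
    least-dominated-cost {z} Sz least = ≤-trans (m≤m+n (cost z) _) (≤-trans
      (charges≤ (6 + 3 * ((m ∸ κ z) * (m ∸ κ z ∸ 1) + 2 * κ z)) (X m (κ z)) (λ _ → 0)
        (λ y e → ≤-trans (≤-reflexive (trans (+-identityʳ _) (charge-in {z} {y} e)))
          (+-mono-≤ (*-monoʳ-≤ 3 (proj₂ (In-elim e))) (*-monoʳ-≤ 3 (in-bound-min e (least y (proj₁ (In⊆ e)))))))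
        (λ y r → ≤-trans (≤-reflexive (+-identityʳ _)) (charge≤X Sz r)) (λ _ _ _ → refl))
      (≤-reflexive (cong (λ x → κ z * (6 + 3 * ((m ∸ κ z) * (m ∸ κ z ∸ 1) + 2 * κ z)) + x * X m (κ z)) (rest≡ Sz))))

-- For n = m + 2 points the bound is 6·C(n-1,3), the increment of 6·C(n,4). It is reached by `X m 0`
-- if some point is undominated and by `crude` otherwise.
cheap-point : ∀ {n} (F : Family n) m → 10 ≤ m → size (Family.S F) ≡ 2 + m →
              ∃[ z ] Family.S F z ≡ true × Family.cost F z ≤ (1 + m) * (m * (m ∸ 1))
cheap-point F m 10≤m |S| with argmin (Family.S F) (InNeighbours.κ F (2 * m ∸ 1) 3≤t m |S|) (member F (2 * m ∸ 1) 3≤t m |S|)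
  where
  3≤t : 3 ≤ 2 * m ∸ 1
  3≤t = ≤-trans (m≤m+n 3 16) (∸-monoˡ-≤ 1 (*-monoʳ-≤ 2 10≤m))
... | z , Sz , least = z , Sz , bound (k ≤? 0)
  where
  3≤t : 3 ≤ 2 * m ∸ 1
  3≤t = ≤-trans (m≤m+n 3 16) (∸-monoˡ-≤ 1 (*-monoʳ-≤ 2 10≤m))
  k = InNeighbours.κ F (2 * m ∸ 1) 3≤t m |S| z
  4≤m : 4 ≤ m
  4≤m = ≤-trans (m≤m+n 4 6) 10≤m
  p = m ∸ 10
  m≡ : 10 + p ≡ m
  m≡ = m+[n∸m]≡n 10≤m
  bound : Dec (k ≤ 0) → Family.cost F z ≤ (1 + m) * (m * (m ∸ 1))
  bound (no k≰0) = ≤-trans (least-dominated-cost F (2 * m ∸ 1) 3≤t m |S| refl 4≤m Sz least)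
    (crude-bound 10≤m (≰⇒> k≰0) (κ≤1+m F (2 * m ∸ 1) 3≤t m |S| Sz))
  bound (yes k≤0) = undominated-cost F (2 * m ∸ 1) 3≤t m |S| (m * (m ∸ 1)) Sz k≡0
    (λ y r → ≤-trans (charge≤X F (2 * m ∸ 1) 3≤t m |S| refl 4≤m Sz r) (subst (λ k → X m k ≤ m * (m ∸ 1)) (sym k≡0) X≤))
    where
    k≡0 : k ≡ 0
    k≡0 = n≤0⇒n≡0 k≤0
    X≤ : X m 0 ≤ m * (m ∸ 1)
    X≤ = subst (λ m → X m 0 ≤ m * (m ∸ 1)) m≡ (X-lub (10 + p) 0 ≤-refl
      (from-slack ((9 + p) * (2 + p)) (e₁ p)) (from-slack (26 + 13 * p + p * p) (e₂ p)))
      where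
      e₁ : ∀ p → 2 * (9 + p) + 6 * (9 + p) + (9 + p) * (2 + p) ≡ (10 + p) * (9 + p)
      e₁ = solve-∀
      e₂ : ∀ p → 6 * (10 + p) + 4 + (26 + 13 * p + p * p) ≡ (10 + p) * (9 + p)
      e₂ = solve-∀

-- A point of small degree among eleven points.

-- For `m = 9` the values of `crude` at 1, 2, 3 are 738, 768, 748 instead of at most 720. The point
-- to be deleted then has to be chosen with more care among those with the least number of
-- dominating points.
module Eleven {n} (F : Family n) (|S| : size (Family.S F) ≡ 11) where
  open Family F
  private
    3≤17 : 3 ≤ 17
    3≤17 = m≤m+n 3 14
  open InNeighbours F 17 3≤17 9 |S|

  module _ (k : ℕ) (least : ∀ y → S y ≡ true → k ≤ κ y) where
    -- Bounds on `E y z` for `y` dominating `z`: `any` in general, `odd` if F_z^y has an edge,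
    -- `full` if nothing leaks through the points dominating `y`, and `far` if `y` has more than `k`
    -- of them.
    q any odd full far : ℕ
    q = 9 ∸ k
    any = q * (q ∸ 1) + 2 * k
    odd = 2 * (q ∸ 1) + 2 * (q ∸ 2) + 2 * k
    full = q * (q ∸ 1)
    far = (9 ∸ suc k) * (9 ∸ suc k ∸ 1) + 2 * suc k

    -- One point `y₀` whose charge stays `d` below its cap pays for the excess of the general
    -- estimate over 720.
    saving : ∀ {z A} d y₀ → S z ≡ true → κ z ≡ k → In z y₀ ≡ true ⊎ rest z y₀ ≡ true →
             (∀ y → In z y ≡ true → charge z y ≤ A × (y ≡ y₀ → charge z y + d ≤ A)) →
             (rest z y₀ ≡ true → charge z y₀ + d ≤ X 9 k) →
             k * A + (10 ∸ k) * X 9 k ≤ 720 + d → cost z ≤ 720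
    saving {z} {A} d y₀ Sz κz where-y₀ hi hr le = +-cancelʳ-≤ d (cost z) 720 (begin
      cost z + d ≡⟨ cong (cost z +_) (sym (∑-at y₀ d)) ⟩
      cost z + ∑ (at y₀ d) ≤⟨ charges≤ A (X 9 k) (at y₀ d) (λ y i → at-≤ {y₀ = y₀} {d} {y} (proj₁ (hi y i)) (proj₂ (hi y i)))
         (λ y r → at-≤ {y₀ = y₀} {d} {y} (subst (λ k → charge z y ≤ X 9 k) κz (charge≤X F 17 3≤17 9 |S| refl (m≤m+n 4 5) Sz r)) (λ { refl → hr r }))
         (λ y ni nr → at-0 {y₀ = y₀} {d} {y} (λ { refl → neither where-y₀ ni nr })) ⟩
      κ z * A + size (rest z) * X 9 k ≡⟨ cong₂ (λ a b → a * A + b * X 9 k) κz (trans (rest≡ F 17 3≤17 9 |S| Sz) (cong (10 ∸_) κz)) ⟩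
      k * A + (10 ∸ k) * X 9 k ≤⟨ le ⟩
      720 + d ∎)
      where
      open ≤-Reasoning
      neither : ∀ {y} → In z y ≡ true ⊎ rest z y ≡ true → In z y ≡ false → ∀ {A : Set} → rest z y ≡ false → A
      neither (inj₁ i) ni _ = true≢false i ni
      neither (inj₂ r) _ nr = true≢false r nr

    odd-cost : odd ≤ any → k * (6 + 3 * any) + (10 ∸ k) * X 9 k ≤ 720 + 3 * (any ∸ odd) →
               ∀ {z y} → κ z ≡ k → In z y ≡ true → E z y ≢ 0 → cost z ≤ 720
    odd-cost o≤a le {z} {y} κz i e = saving (3 * (any ∸ odd)) y (In-S i) κz (inj₁ i)
        (λ w iw → charge≤ w iw , λ { refl → special })
        (λ r → true≢false i (proj₂ (∖∖-elim {P = S ∖ z} {Q = In z} r))) le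
      where
      charge≤ : ∀ w → In z w ≡ true → charge z w ≤ 6 + 3 * any
      charge≤ w iw = ≤-trans (≤-reflexive (charge-in {z} {w} iw)) (+-mono-≤ (*-monoʳ-≤ 3 (proj₂ (In-elim iw)))
        (*-monoʳ-≤ 3 (in-bound-min F 17 3≤17 9 |S| iw (least w (proj₁ (In⊆ iw))))))
      E≤odd : E y z ≤ odd
      E≤odd with subset-of-size (In y) (κ y ∸ k) k (sym (m+[n∸m]≡n (least y (proj₁ (In⊆ i)))))
      ... | D , sz , C⊆ = subst (λ k → E y z ≤ 2 * (9 ∸ k ∸ 1) + 2 * (9 ∸ k ∸ 2) + 2 * k) sz (in-bound-odd i D C⊆ e)
      special : charge z y + 3 * (any ∸ odd) ≤ 6 + 3 * any
      special = begin
        charge z y + 3 * (any ∸ odd) ≡⟨ cong (_+ 3 * (any ∸ odd)) (charge-in {z} {y} i) ⟩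
        3 * E z y + 3 * E y z + 3 * (any ∸ odd) ≤⟨ +-monoˡ-≤ (3 * (any ∸ odd)) (+-mono-≤ (*-monoʳ-≤ 3 (proj₂ (In-elim i))) (*-monoʳ-≤ 3 E≤odd)) ⟩
        6 + 3 * odd + 3 * (any ∸ odd) ≡⟨ cong (6 +_) (trans (sym (*-distribˡ-+ 3 odd (any ∸ odd))) (cong (3 *_) (m+[n∸m]≡n o≤a))) ⟩
        6 + 3 * any ∎
        where open ≤-Reasoning

    module _ (no-odd : ∀ z y → κ z ≡ k → In z y ≡ true → E z y ≡ 0) (far≤full : far ≤ full) where
      -- If `κ y` is also the minimum, the points dominating `y` receive no edges from `y` at all,
      -- so the leak in `in-bound` vanishes. Otherwise `y` has an additional dominating point.
      E≤full : ∀ {z y} → κ z ≡ k → In z y ≡ true → E y z ≤ full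
      E≤full {z} {y} κz i with κ y ≤? k
      ... | yes le = subst (λ k → E y z ≤ (9 ∸ k) * (9 ∸ k ∸ 1)) κy (in-bound-clean i (In y) (λ _ e → e) (λ u e → no-odd y u κy e))
        where
        κy : κ y ≡ k
        κy = ≤-antisym le (least y (proj₁ (In⊆ i)))
      ... | no gt = ≤-trans (in-bound-min F 17 3≤17 9 |S| i (≰⇒> gt)) far≤full

      charge≤full : ∀ {z} y → κ z ≡ k → In z y ≡ true → charge z y ≤ 3 * full
      charge≤full {z} y κz i = ≤-trans (≤-reflexive (trans (charge-in {z} {y} i) (cong (λ a → 3 * a + 3 * E y z) (no-odd z y κz i))))
        (*-monoʳ-≤ 3 (E≤full κz i))

      far-cost : k * (3 * full) + (10 ∸ k) * X 9 k ≤ 720 + 3 * (full ∸ far) →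
                 ∀ {z y} → κ z ≡ k → In z y ≡ true → k < κ y → cost z ≤ 720
      far-cost le {z} {y} κz i k<κ = saving (3 * (full ∸ far)) y (In-S i) κz (inj₁ i)
        (λ w iw → charge≤full w κz iw , λ { refl → special })
        (λ r → true≢false i (proj₂ (∖∖-elim {P = S ∖ z} {Q = In z} r))) le
        where
        special : charge z y + 3 * (full ∸ far) ≤ 3 * full
        special = begin
          charge z y + 3 * (full ∸ far) ≡⟨ cong (_+ 3 * (full ∸ far)) (trans (charge-in {z} {y} i) (cong (λ a → 3 * a + 3 * E y z) (no-odd z y κz i))) ⟩
          3 * E y z + 3 * (full ∸ far) ≤⟨ +-monoˡ-≤ (3 * (full ∸ far)) (*-monoʳ-≤ 3 (in-bound-min F 17 3≤17 9 |S| i k<κ)) ⟩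
          3 * far + 3 * (full ∸ far) ≡⟨ trans (sym (*-distribˡ-+ 3 far (full ∸ far))) (cong (3 *_) (m+[n∸m]≡n far≤full)) ⟩
          3 * full ∎
          where open ≤-Reasoning

      -- The saving sits at a point `w` that `z` itself dominates: F_w^z is empty, so the charge of
      -- `w` reduces to a graph on `q` points.
      out-cost : full ≤ X 9 k → k * (3 * full) + (10 ∸ k) * X 9 k ≤ 720 + (X 9 k ∸ full) →
                 ∀ {z w} → κ z ≡ k → κ w ≡ k → In w z ≡ true → cost z ≤ 720
      out-cost full≤X le {z} {w} κz κw i = saving (X 9 k ∸ full) w Sz κz (inj₂ r)
        (λ y iy → charge≤full y κz iy , λ { refl → true≢false iy ni }) (λ _ → special) le
        where
        Sz = proj₁ (In⊆ i)
        ni = In-asym i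
        w≢z : w ≢ z
        w≢z e = proj₂ (In⊆ i) (sym e)
        r : rest z w ≡ true
        r = ∖∖-intro {P = S ∖ z} {Q = In z} (∖-intro {P = S} (In-S i) w≢z) ni
        special : charge z w + (X 9 k ∸ full) ≤ X 9 k
        special = begin
          charge z w + (X 9 k ∸ full) ≡⟨ cong (_+ (X 9 k ∸ full)) (trans (charge-out {z} {w} ni) (trans (cong (λ a → cnt (clean z w (In z)) + 3 * a) (no-odd w z κw i)) (+-identityʳ _))) ⟩
          cnt (clean z w (In z)) + (X 9 k ∸ full) ≤⟨ +-monoˡ-≤ (X 9 k ∸ full) (complete-bound≤ (ground z w (In z)) (clean-graph z w (In z)) (clean-on z w (In z))
             (≤-trans (ground≤ (In z) Sz (In-S i) (λ e → w≢z (sym e)) (In-ground ni)) (≤-reflexive (cong (9 ∸_) κz)))) ⟩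
          full + (X 9 k ∸ full) ≡⟨ m+[n∸m]≡n full≤X ⟩
          X 9 k ∎
          where open ≤-Reasoning

    outright : (∀ u v → (κ u ≡ᵇ k) ∧ (In u v ∧ not (E u v ≡ᵇ 0)) ≡ false) → ∀ z y → κ z ≡ k → In z y ≡ true → E z y ≡ 0
    outright none u v κu iu with E u v ≡ᵇ 0 in eq
    ... | true = ≡ᵇ-elim {E u v} eq
    ... | false = true≢false (true-∧ (≡ᵇ-intro κu) (true-∧ iu (cong not eq))) (none u v)

    -- If a point of minimal in-degree sends an edge back to a point dominating it, `odd-cost`
    -- applies. Otherwise take any `y` dominating `z`: if `κ y` exceeds the minimum, `z` is cheap,
    -- and if not, `y` is, because it dominates `z`. The Boolean hypothesis gathers the numerical
    -- conditions so that `refl` settles each `k`.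
    few-dominated : 1 ≤ k → ∃[ z ] (S z ≡ true × κ z ≡ k) →
      (odd ≤ᵇ any) ∧ (k * (6 + 3 * any) + (10 ∸ k) * X 9 k ≤ᵇ 720 + 3 * (any ∸ odd)) ∧ (far ≤ᵇ full) ∧
      (k * (3 * full) + (10 ∸ k) * X 9 k ≤ᵇ 720 + 3 * (full ∸ far)) ∧ (full ≤ᵇ X 9 k) ∧
      (k * (3 * full) + (10 ∸ k) * X 9 k ≤ᵇ 720 + (X 9 k ∸ full)) ≡ true →
      ∃[ z ] S z ≡ true × cost z ≤ 720
    few-dominated 1≤k (z , Sz , κz) ok
      with c₁ , ok₁ ← ∧-true {odd ≤ᵇ any} ok
      with c₂ , ok₂ ← ∧-true {k * (6 + 3 * any) + (10 ∸ k) * X 9 k ≤ᵇ 720 + 3 * (any ∸ odd)} ok₁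
      with c₃ , ok₃ ← ∧-true {far ≤ᵇ full} ok₂
      with c₄ , ok₄ ← ∧-true {k * (3 * full) + (10 ∸ k) * X 9 k ≤ᵇ 720 + 3 * (full ∸ far)} ok₃
      with c₅ , c₆ ← ∧-true {full ≤ᵇ X 9 k} ok₄
      with pick₂ (λ u v → (κ u ≡ᵇ k) ∧ (In u v ∧ not (E u v ≡ᵇ 0)))
    ... | inj₁ (u , v , e) with eκ , e′ ← ∧-true {κ u ≡ᵇ k} e with i , o ← ∧-true {In u v} e′ =
      u , In-S i , odd-cost (≤ᵇ-elim c₁) (≤ᵇ-elim {k * (6 + 3 * any) + (10 ∸ k) * X 9 k} c₂) (≡ᵇ-elim {κ u} eκ) i
        (λ E0 → true≢false (cong (_≡ᵇ 0) E0) (not-true o))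
    ... | inj₂ none with pick (In z)
    ... | inj₂ empty = contradiction (≤-trans 1≤k (≤-trans (≤-reflexive (sym κz)) (≤-reflexive (∑-zero (λ u → cong ⟦_⟧ (empty u)))))) λ ()
    ... | inj₁ (y , i) with κ y ≤? k
    ... | no gt = z , Sz , far-cost (outright none) (≤ᵇ-elim {far} c₃) (≤ᵇ-elim {k * (3 * full) + (10 ∸ k) * X 9 k} c₄) κz i (≰⇒> gt)
    ... | yes le = y , proj₁ (In⊆ i) , out-cost (outright none) (≤ᵇ-elim {far} c₃) (≤ᵇ-elim {full} c₅) (≤ᵇ-elim {k * (3 * full) + (10 ∸ k) * X 9 k} c₆)
        (≤-antisym le (least y (proj₁ (In⊆ i)))) κz i

  cheap-point₁₁ : ∃[ z ] S z ≡ true × cost z ≤ 720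
  cheap-point₁₁ with argmin S κ (member F 17 3≤17 9 |S|)
  ... | z , Sz , least = by (κ z) refl least
    where
    by : ∀ k → κ z ≡ k → (∀ y → S y ≡ true → k ≤ κ y) → ∃[ z ] S z ≡ true × cost z ≤ 720
    by 0 κz _ = z , Sz , undominated-cost F 17 3≤17 9 |S| 72 Sz κz
      (λ y r → subst (λ k → charge z y ≤ X 9 k) κz (charge≤X F 17 3≤17 9 |S| refl (m≤m+n 4 5) Sz r))
    by 1 κz least = few-dominated 1 least (s≤s z≤n) (z , Sz , κz) refl
    by 2 κz least = few-dominated 2 least (s≤s z≤n) (z , Sz , κz) refl
    by 3 κz least = few-dominated 3 least (s≤s z≤n) (z , Sz , κz) refl
    by (suc (suc (suc (suc j)))) κz least = z , Sz , ≤-trans (least-dominated-cost F 17 3≤17 9 |S| refl (m≤m+n 4 5) Sz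
        (λ y Sy → ≤-trans (≤-reflexive κz) (least y Sy)))
      (subst (λ k → crude 9 k ≤ 720) (sym κz) (many j (≤-trans (≤-reflexive (sym κz)) (κ≤1+m F 17 3≤17 9 |S| Sz))))
      where
      many : ∀ j → 4 + j ≤ 10 → crude 9 (4 + j) ≤ 720
      many 0 _ = ≤ᵇ-elim {crude 9 4} refl
      many 1 _ = ≤ᵇ-elim {crude 9 5} refl
      many 2 _ = ≤ᵇ-elim {crude 9 6} refl
      many 3 _ = ≤ᵇ-elim {crude 9 7} refl
      many 4 _ = ≤ᵇ-elim {crude 9 8} refl
      many 5 _ = ≤ᵇ-elim {crude 9 9} refl
      many 6 _ = ≤ᵇ-elim {crude 9 10} refl
      many (suc (suc (suc (suc (suc (suc (suc j))))))) (s≤s (s≤s (s≤s (s≤s (s≤s (s≤s (s≤s (s≤s (s≤s (s≤s ()))))))))))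

-- Sums over pairs of points

module _ {n} (S : Subsetᵇ n) where
  sum-pairs : (Fin n → Fin n → ℕ) → ℕ
  sum-pairs B = ∑ (λ y → ∑ (λ z → ⟦ S y ⟧ * ⟦ (S ∖ y) z ⟧ * B y z))

  private
    indicator : ∀ {y z} → S y ≡ true → S z ≡ true → y ≢ z → ⟦ S y ⟧ * ⟦ (S ∖ y) z ⟧ ≡ 1
    indicator Sy Sz y≢z = cong₂ (λ a b → ⟦ a ⟧ * ⟦ b ⟧) Sy (∖-intro {P = S} Sz (λ e → y≢z (sym e)))

    ∑₂-swap+ : ∀ (W : Fin n → Fin n → ℕ) → ∑ (λ y → ∑ (λ z → W y z + W z y)) ≡ 2 * ∑ (λ y → ∑ (W y))
    ∑₂-swap+ W = trans (∑₂-+ W (λ y z → W z y)) (cong (∑ (λ y → ∑ (W y)) +_)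
      (trans (∑-swap (λ y z → W z y)) (sym (+-identityʳ _))))

  -- Only the sum over both orientations of a pair is controlled, so both sides are doubled,
  -- compared and halved.
  sum-pairs-bound : ∀ (W B : Fin n → Fin n → ℕ) →
    (∀ y → W y y ≡ 0) → (∀ y z → S y ≡ false → W y z ≡ 0) → (∀ y z → S z ≡ false → W y z ≡ 0) →
    (∀ {y z} → S y ≡ true → S z ≡ true → y ≢ z → W y z + W z y ≤ B y z + B z y) →
    ∑ (λ y → ∑ (W y)) ≤ sum-pairs B
  sum-pairs-bound W B diag offˡ offʳ h = *-cancelˡ-≤ 2 (begin
    2 * ∑ (λ y → ∑ (W y)) ≡⟨ sym (∑₂-swap+ W) ⟩
    ∑ (λ y → ∑ (λ z → W y z + W z y)) ≤⟨ ∑₂-mono (λ y z → pt y z (S y Bool.≟ true) (S z Bool.≟ true) (y ≟ z)) ⟩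
    ∑ (λ y → ∑ (λ z → D y z + D z y)) ≡⟨ ∑₂-swap+ D ⟩
    2 * sum-pairs B ∎)
    where
    open ≤-Reasoning
    D : Fin n → Fin n → ℕ
    D y z = ⟦ S y ⟧ * ⟦ (S ∖ y) z ⟧ * B y z
    pt : ∀ y z → Dec (S y ≡ true) → Dec (S z ≡ true) → Dec (y ≡ z) → W y z + W z y ≤ D y z + D z y
    pt y z (no ¬Sy) _ _ = ≤-trans (≤-reflexive (cong₂ _+_ (offˡ y z (Bool.¬-not ¬Sy)) (offʳ z y (Bool.¬-not ¬Sy)))) z≤n
    pt y z _ (no ¬Sz) _ = ≤-trans (≤-reflexive (cong₂ _+_ (offʳ y z (Bool.¬-not ¬Sz)) (offˡ z y (Bool.¬-not ¬Sz)))) z≤n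
    pt y z _ _ (yes refl) = ≤-trans (≤-reflexive (cong₂ _+_ (diag y) (diag y))) z≤n
    pt y z (yes Sy) (yes Sz) (no y≢z) = ≤-trans (h Sy Sz y≢z) (≤-reflexive (sym (cong₂ _+_
      (trans (cong (_* B y z) (indicator Sy Sz y≢z)) (*-identityˡ (B y z)))
      (trans (cong (_* B z y) (indicator Sz Sy (λ e → y≢z (sym e)))) (*-identityˡ (B z y))))))

  sum-pairs-+ : ∀ B B′ → sum-pairs (λ y z → B y z + B′ y z) ≡ sum-pairs B + sum-pairs B′
  sum-pairs-+ B B′ = trans (∑-cong (λ y → ∑-cong (λ z → *-distribˡ-+ (⟦ S y ⟧ * ⟦ (S ∖ y) z ⟧) (B y z) (B′ y z))))
    (∑₂-+ (λ y z → ⟦ S y ⟧ * ⟦ (S ∖ y) z ⟧ * B y z) (λ y z → ⟦ S y ⟧ * ⟦ (S ∖ y) z ⟧ * B′ y z))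

  sum-pairs-* : ∀ c B → sum-pairs (λ y z → c * B y z) ≡ c * sum-pairs B
  sum-pairs-* c B = trans (∑-cong (λ y → trans (∑-cong (λ z → rot (⟦ S y ⟧ * ⟦ (S ∖ y) z ⟧) c (B y z))) (∑-*ˡ c _))) (∑-*ˡ c _)
    where
    rot : ∀ i c b → i * (c * b) ≡ c * (i * b)
    rot = solve-∀

  sum-pairs-const : ∀ c → sum-pairs (λ _ _ → c) ≡ size S * (size S ∸ 1) * c
  sum-pairs-const c = begin
    ∑ (λ y → ∑ (λ z → ⟦ S y ⟧ * ⟦ (S ∖ y) z ⟧ * c)) ≡⟨ ∑-cong (λ y → trans (∑-*ʳ c (λ z → ⟦ S y ⟧ * ⟦ (S ∖ y) z ⟧)) (cong (_* c) (trans (∑-*ˡ ⟦ S y ⟧ (λ z → ⟦ (S ∖ y) z ⟧)) (row y)))) ⟩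
    ∑ (λ y → ⟦ S y ⟧ * (size S ∸ 1) * c) ≡⟨ trans (∑-*ʳ c (λ y → ⟦ S y ⟧ * (size S ∸ 1))) (cong (_* c) (∑-*ʳ (size S ∸ 1) (λ y → ⟦ S y ⟧))) ⟩
    size S * (size S ∸ 1) * c ∎
    where
    open ≡-Reasoning
    row : ∀ y → ⟦ S y ⟧ * size (S ∖ y) ≡ ⟦ S y ⟧ * (size S ∸ 1)
    row y with S y in Sy
    ... | false = refl
    ... | true = cong (_+ 0) (size-∖≡ S Sy)

  sum-pairs≤ : ∀ B → sum-pairs B ≤ ∑ (λ y → ∑ (B y))
  sum-pairs≤ B = ∑₂-mono (λ y z → ≤-trans (*-monoˡ-≤ (B y z) (*-mono-≤ (⟦⟧≤1 (S y)) (⟦⟧≤1 ((S ∖ y) z)))) (≤-reflexive (*-identityˡ (B y z))))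

  -- With `s` points, `c` of them in `A`, there are c(s - 1) pairs starting in `A` and (s - c)c
  -- ending but not starting there.
  sum-pairs-meeting : ∀ (A : Subsetᵇ n) → sum-pairs (λ y z → ⟦ A y ∨ A z ⟧) ≤ size (λ y → S y ∧ A y) * (2 * size S ∸ 1 ∸ size (λ y → S y ∧ A y))
  sum-pairs-meeting A = ≤-trans step (≤-reflexive (solve-c (size S) c c≤s))
    where
    SA : Subsetᵇ n
    SA y = S y ∧ A y
    c = size SA
    c≤s : c ≤ size S
    c≤s = size-mono {P = SA} {S} (λ u e → proj₁ (∧-true e))
    co : size (S ∖∖ SA) ≡ size S ∸ c
    co = trans (sym (m+n∸n≡m (size (S ∖∖ SA)) c)) (cong (_∸ c) (size-∖∖ S SA (λ u e → proj₁ (∧-true e))))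
    pt : ∀ y z → ⟦ S y ⟧ * ⟦ (S ∖ y) z ⟧ * ⟦ A y ∨ A z ⟧ ≤ ⟦ SA y ⟧ * ⟦ (S ∖ y) z ⟧ + ⟦ (S ∖∖ SA) y ⟧ * ⟦ SA z ⟧
    pt y z with S y | A y | S z | A z | z == y
    ... | false | _ | _ | _ | _ = z≤n
    ... | true | true | false | _ | _ = z≤n
    ... | true | true | true | _ | true = z≤n
    ... | true | true | true | _ | false = ≤-refl
    ... | true | false | false | _ | _ = z≤n
    ... | true | false | true | false | true = z≤n
    ... | true | false | true | false | false = z≤n
    ... | true | false | true | true | true = z≤n
    ... | true | false | true | true | false = ≤-refl
    row : ∀ y → ⟦ SA y ⟧ * size (S ∖ y) ≡ ⟦ SA y ⟧ * (size S ∸ 1)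
    row y with S y in Sy | A y
    ... | false | _ = refl
    ... | true | false = refl
    ... | true | true = cong (_+ 0) (size-∖≡ S Sy)
    step : sum-pairs (λ y z → ⟦ A y ∨ A z ⟧) ≤ c * (size S ∸ 1) + (size S ∸ c) * c
    step = ≤-trans (∑₂-mono pt) (≤-reflexive (trans (∑₂-+ (λ y z → ⟦ SA y ⟧ * ⟦ (S ∖ y) z ⟧) (λ y z → ⟦ (S ∖∖ SA) y ⟧ * ⟦ SA z ⟧))
      (cong₂ _+_ (trans (∑-cong (λ y → trans (∑-*ˡ ⟦ SA y ⟧ (λ z → ⟦ (S ∖ y) z ⟧)) (row y))) (∑-*ʳ (size S ∸ 1) (λ y → ⟦ SA y ⟧)))
        (trans (∑₂-* (λ y → ⟦ (S ∖∖ SA) y ⟧) (λ z → ⟦ SA z ⟧)) (cong (_* c) co)))))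
    solve-c : ∀ s c → c ≤ s → c * (s ∸ 1) + (s ∸ c) * c ≡ c * (2 * s ∸ 1 ∸ c)
    solve-c zero zero z≤n = refl
    solve-c (suc s) c c≤ = trans (cong (c * s +_) (*-comm (suc s ∸ c) c)) (trans (sym (*-distribˡ-+ c s (suc s ∸ c)))
      (cong (c *_) (trans (sym (+-∸-assoc s c≤)) (cong (λ x → s + suc x ∸ c) (sym (+-identityʳ s))))))

-- Bounds, in terms of the least in-degree k, for a pair of points neither of which dominates the other ...
pair-cap : ℕ → ℕ → ℕ → ℕ
pair-cap m T k with 4 ≤? m ∸ k
... | yes _ = 4 * (m ∸ k ∸ 1) ⊔ (T ⊓ ((m ∸ k) * (m ∸ k ∸ 1)))
... | no _ = 2 * ((m ∸ k) * (m ∸ k ∸ 1))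

-- ... and for a pair in which a point of in-degree k dominates the other.
edge-cap : ℕ → ℕ → ℕ
edge-cap m k = (m ∸ k) * (m ∸ k ∸ 1) ⊔ (2 * (m ∸ k ∸ 1) + 2 * (m ∸ k ∸ 2) + 6)

module Pairs {n} (F : Family n) (t : ℕ) (3≤t : 3 ≤ t) (m : ℕ) (1≤m : 1 ≤ m) (|S| : size (Family.S F) ≡ 2 + m) where
  open Family F
  open InNeighbours F t 3≤t m |S|

  full-on : ∀ x y → On (ground x y (λ _ → false)) (f x y)
  full-on x y e with f-rest e
  ... | Su , u≢x , u≢y = ∖∖-intro {P = (S ∖ x) ∖ y} {Q = λ _ → false} (∖-intro {P = S ∖ x} (∖-intro {P = S} Su u≢x) u≢y) refl

  full-size : ∀ {x y} → S x ≡ true → S y ≡ true → x ≢ y → size (ground x y (λ _ → false)) ≤ m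
  full-size Sx Sy x≢y = ≤-trans (ground≤ (λ _ → false) Sx Sy x≢y (λ u ())) (m∸n≤m m (size {n} (λ _ → false)))

  E≤complete : ∀ {x y} → S x ≡ true → S y ≡ true → x ≢ y → E x y ≤ m * (m ∸ 1)
  E≤complete {x} {y} Sx Sy x≢y = complete-bound≤ (ground x y (λ _ → false)) (graph x y) (full-on x y) (full-size Sx Sy x≢y)

  E-both : ∀ {x y} → 4 ≤ m → S x ≡ true → S y ≡ true → x ≢ y → E x y ≢ 0 → E y x ≢ 0 → E x y + E y x ≤ 4 * (m ∸ 1)
  E-both {x} {y} 4≤m Sx Sy x≢y e e′ with pick₂ (f x y) | pick₂ (f y x)
  ... | inj₂ none | _ = contradiction (cnt-empty none) e
  ... | inj₁ _ | inj₂ none = contradiction (cnt-empty none) e′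
  ... | inj₁ p | inj₁ p′ = cross-bound (ground x y (λ _ → false)) (ground y x (λ _ → false)) 4≤m (graph x y) (graph y x)
      (full-on x y) (full-on y x) (full-size Sx Sy x≢y) (full-size Sy Sx (λ e → x≢y (sym e)))
      (shape (graph x y) (graph y x) (f-cross x y x≢y) p p′)

  -- Either F_z^y has at most one edge, and failure of domination keeps `E y z` below `t`, or the
  -- classification leaves F_y^z at most a star plus one edge, of count `2 * m`, or at most 8.
  E-notin : ∀ {z y} T → t ∸ 1 ≤ T → 2 * m ≤ T → 8 ≤ T → S y ≡ true → S z ≡ true → y ≢ z → In z y ≡ false → E y z ≤ T
  E-notin {z} {y} T T₁ T₂ T₃ Sy Sz y≢z i with E z y ≤? 2
  ... | yes le = ≤-trans (<⇒≤pred (In-false i le)) T₁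
  ... | no gt with pick₂ (f z y) | pick₂ (f y z)
  ... | inj₂ none | _ = contradiction (≤-trans (≤-reflexive (cnt-empty none)) z≤n) gt
  ... | inj₁ _ | inj₂ none = ≤-trans (≤-reflexive (cnt-empty none)) z≤n
  ... | inj₁ p | inj₁ p′ = go (shape (graph z y) (graph y z) (f-cross z y (λ e → y≢z (sym e))) p p′)
    where
    sz : size (ground y z (λ _ → false)) ≤ m
    sz = full-size Sy Sz y≢z
    go : Shape (f z y) (f y z) → E y z ≤ T
    go (star c sg sh) = ≤-trans (star-bound≤ (ground y z (λ _ → false)) c (graph y z) (full-on y z) sh sz)
      (≤-trans (*-monoʳ-≤ 2 (m∸n≤m m 1)) T₂)
    go (single a b le mt) = contradiction le gt
    go (single′ a b le mt) = ≤-trans le (≤-trans (m≤m+n 2 6) T₃)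
    go (cherry a b c le so) = ≤-trans (starOr-bound≤ (ground y z (λ _ → false)) a b c (graph y z) (full-on y z) so sz)
      (≤-trans (≤-reflexive (trans (+-comm (2 * (m ∸ 1)) 2) (trans (sym (*-suc 2 (m ∸ 1))) (cong (2 *_) (m+[n∸m]≡n 1≤m))))) T₂)
    go (cherry′ a b c le so) = ≤-trans le (≤-trans (m≤m+n 4 4) T₃)
    go (small _ le _) = ≤-trans le T₃

  -- The share of an ordered pair in `total` after `out-bound` has been applied at every point with
  -- its own set of dominating points.
  W : Fin n → Fin n → ℕ
  W y z = ⟦ not (In y z) ⟧ * cnt (clean y z (In y)) + 3 * (⟦ In y z ⟧ * E y z)

  W-in : ∀ {y z} → In y z ≡ true → W y z ≡ 3 * E y z
  W-in {y} {z} e rewrite e = cong (3 *_) (+-identityʳ (E y z))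

  W-out : ∀ {y z} → In y z ≡ false → W y z ≡ cnt (clean y z (In y))
  W-out {y} {z} e rewrite e = trans (+-identityʳ (c + 0)) (+-identityʳ c)
    where
    c = cnt (clean y z (In y))

  W≤3E : ∀ y z → W y z ≤ 3 * E y z
  W≤3E y z = go (In y z Bool.≟ true)
    where
    go : Dec (In y z ≡ true) → W y z ≤ 3 * E y z
    go (yes i) = ≤-reflexive (W-in i)
    go (no ni) = ≤-trans (≤-reflexive (W-out (Bool.¬-not ni))) (≤-trans (cnt-mono (λ u v → clean⊆ y z (In y))) (m≤m+n _ _))

  total≤W : total ≤ ∑ (λ y → ∑ (W y))
  total≤W = ∑-mono (λ y → out-bound y (In y))

  clean-size : ∀ {y z k} → S y ≡ true → S z ≡ true → y ≢ z → In y z ≡ false → k ≤ κ y → size (ground y z (In y)) ≤ m ∸ k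
  clean-size Sy Sz y≢z i k≤ = ≤-trans (ground≤ (In _) Sy Sz y≢z (In-ground i)) (∸-monoʳ-≤ m k≤)

  -- Both cleaned links live on at most `m ∸ k` points for the smaller in-degree `k`. If both have
  -- edges, `cross-bound` applies; if one is empty, the other is bounded by `E-notin` and by
  -- completeness.
  pair-nonedge : ∀ {y z} T → t ∸ 1 ≤ T → 2 * m ≤ T → 8 ≤ T → S y ≡ true → S z ≡ true → y ≢ z →
    In y z ≡ false → In z y ≡ false → W y z + W z y ≤ pair-cap m T (κ y ⊓ κ z)
  pair-nonedge {y} {z} T T₁ T₂ T₃ Sy Sz y≢z i j = ≤-trans (≤-reflexive (cong₂ _+_ (W-out i) (W-out j))) main
    where
    k = κ y ⊓ κ z
    z≢y : z ≢ y
    z≢y e = y≢z (sym e)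
    sy = clean-size Sy Sz y≢z i (m⊓n≤m (κ y) (κ z))
    sz = clean-size Sz Sy z≢y j (m⊓n≤n (κ y) (κ z))
    cy = complete-bound≤ (ground y z (In y)) (clean-graph y z (In y)) (clean-on y z (In y)) sy
    cz = complete-bound≤ (ground z y (In z)) (clean-graph z y (In z)) (clean-on z y (In z)) sz
    main : cnt (clean y z (In y)) + cnt (clean z y (In z)) ≤ pair-cap m T k
    main with 4 ≤? m ∸ k
    ... | no _ = ≤-trans (+-mono-≤ cy cz) (≤-reflexive (cong ((m ∸ k) * (m ∸ k ∸ 1) +_) (sym (+-identityʳ _))))
    ... | yes 4≤q with pick₂ (clean y z (In y)) | pick₂ (clean z y (In z))
    ... | inj₁ p | inj₁ p′ = ≤-trans (cross-bound (ground y z (In y)) (ground z y (In z)) 4≤q (clean-graph y z (In y)) (clean-graph z y (In z))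
          (clean-on y z (In y)) (clean-on z y (In z)) sy sz (shape (clean-graph y z (In y)) (clean-graph z y (In z))
            (λ e e′ → f-cross y z y≢z (clean⊆ y z (In y) e) (clean⊆ z y (In z) e′)) p p′)) (m≤m⊔n _ _)
    ... | inj₂ none | _ = ≤-trans (≤-reflexive (cong (_+ cnt (clean z y (In z))) (cnt-empty none))) (≤-trans
          (⊓-glb (≤-trans (cnt-mono (λ u v → clean⊆ z y (In z))) (E-notin T T₁ T₂ T₃ Sz Sy z≢y i)) cz) (m≤n⊔m _ _))
    ... | inj₁ _ | inj₂ none = ≤-trans (≤-reflexive (trans (cong (cnt (clean y z (In y)) +_) (cnt-empty none)) (+-identityʳ _))) (≤-trans
          (⊓-glb (≤-trans (cnt-mono (λ u v → clean⊆ y z (In y))) (E-notin T T₁ T₂ T₃ Sy Sz y≢z j)) cy) (m≤n⊔m _ _))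

  κ-tail≤m : ∀ {z y} → In z y ≡ true → κ y ≤ m
  κ-tail≤m {z} {y} i = ≤-trans (m≤n+m (κ y) _) (≤-reflexive (ground≡ (In y) (proj₁ (In⊆ i)) (In-S i) (proj₂ (In⊆ i)) (In-ground (In-asym i))))

  -- The reverse share is `3 * E z y`, at most 6. If it is nonzero, an edge of F_z^y reduces F_y^z
  -- to two stars.
  pair-edge : ∀ {y z} → In z y ≡ true → W y z + W z y ≤ edge-cap m (κ y)
  pair-edge {y} {z} i = ≤-trans (≤-reflexive (cong₂ _+_ (W-out (In-asym i)) (W-in i))) (go (E z y Data.Nat.≟ 0))
    where
    q = m ∸ κ y
    go : Dec (E z y ≡ 0) → cnt (clean y z (In y)) + 3 * E z y ≤ edge-cap m (κ y)
    go (yes e) = ≤-trans (≤-reflexive (trans (cong (λ a → cnt (clean y z (In y)) + 3 * a) e) (+-identityʳ _)))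
      (≤-trans (complete-bound≤ (ground y z (In y)) (clean-graph y z (In y)) (clean-on y z (In y))
        (clean-size (proj₁ (In⊆ i)) (In-S i) (proj₂ (In⊆ i)) (In-asym i) ≤-refl)) (m≤m⊔n _ _))
    go (no ne) = ≤-trans (+-mono-≤ (clean-odd-bound i (In y) (λ _ e → e) ne) (*-monoʳ-≤ 3 (proj₂ (In-elim i)))) (m≤n⊔m (q * (q ∸ 1)) _)

  -- Points dominated by many others have only small links; this bounds the in-degree of a point
  -- that still dominates something.
  in-degree-limit : ∀ {z y} → In z y ≡ true → t ≤ (m ∸ κ y) * (m ∸ κ y ∸ 1) + 2 * κ y
  in-degree-limit {y = y} i = ≤-trans (proj₁ (In-elim i)) (in-bound i (In y) (λ _ e → e))

  -- `layer` shares the caps between the two orientations, and `ε` pays the excess of a dominating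
  -- pair, depending only on the in-degree of the dominating point. The bounds `a < 2 + m` and
  -- `b < 2 + m` make both hypotheses decidable by `allUpTo?`.
  module _ (T lo : ℕ) (T₁ : t ∸ 1 ≤ T) (T₂ : 2 * m ≤ T) (T₃ : 8 ≤ T) (lo≤ : ∀ z → S z ≡ true → lo ≤ κ z)
           (layer : ℕ → ℕ → ℕ) (ε : ℕ → ℕ)
           (nonedge : ∀ {a} → a < 2 + m → ∀ {b} → b < 2 + m → lo ≤ a → lo ≤ b → pair-cap m T (a ⊓ b) ≤ layer a b + layer b a)
           (edge : ∀ {a} → a < 2 + m → ∀ {b} → b < 2 + m → lo ≤ a → lo ≤ b → a ≤ m → t ≤ (m ∸ a) * (m ∸ a ∸ 1) + 2 * a →
                   edge-cap m a ≤ layer a b + layer b a + 2 * ε a) where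
    total≤pairs : total ≤ sum-pairs S (λ y z → layer (κ y) (κ z)) + 2 * ∑ (λ z → ∑ (λ y → ⟦ In z y ⟧ * ε (κ y)))
    total≤pairs = ≤-trans total≤W (≤-trans
      (sum-pairs-bound S W B (λ y → n≤0⇒n≡0 (≤-trans (W≤3E y y) (≤-reflexive (cong (3 *_) (E-diag y)))))
        (λ y z e → n≤0⇒n≡0 (≤-trans (W≤3E y z) (≤-reflexive (cong (3 *_) (E-outˡ z e)))))
        (λ y z e → n≤0⇒n≡0 (≤-trans (W≤3E y z) (≤-reflexive (cong (3 *_) (E-outʳ y e)))))
        (λ {y} {z} Sy Sz y≢z → pt Sy Sz y≢z (In z y Bool.≟ true) (In y z Bool.≟ true)))
      (≤-trans (≤-reflexive (trans (sum-pairs-+ S (λ y z → layer (κ y) (κ z)) (λ y z → 2 * (⟦ In z y ⟧ * ε (κ y))))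
          (cong (sum-pairs S (λ y z → layer (κ y) (κ z)) +_) (sum-pairs-* S 2 (λ y z → ⟦ In z y ⟧ * ε (κ y))))))
        (+-monoʳ-≤ (sum-pairs S (λ y z → layer (κ y) (κ z))) (*-monoʳ-≤ 2 (≤-trans (sum-pairs≤ S (λ y z → ⟦ In z y ⟧ * ε (κ y)))
          (≤-reflexive (∑-swap (λ y z → ⟦ In z y ⟧ * ε (κ y)))))))))
      where
      B : Fin n → Fin n → ℕ
      B y z = layer (κ y) (κ z) + 2 * (⟦ In z y ⟧ * ε (κ y))
      κ< : ∀ {z} → S z ≡ true → κ z < 2 + m
      κ< Sz = s≤s (κ≤1+m F t 3≤t m |S| Sz)
      shuffle : ∀ a b c d → a + b + 2 * c ≡ a + 2 * (1 * c) + (b + 2 * (0 * d))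
      shuffle = solve-∀
      pt : ∀ {y z} → S y ≡ true → S z ≡ true → y ≢ z → Dec (In z y ≡ true) → Dec (In y z ≡ true) → W y z + W z y ≤ B y z + B z y
      pt {y} {z} Sy Sz y≢z (yes i) _ = ≤-trans (pair-edge i) (≤-trans
        (edge (κ< Sy) (κ< Sz) (lo≤ y Sy) (lo≤ z Sz) (κ-tail≤m i) (in-degree-limit i))
        (≤-reflexive (trans (shuffle (layer (κ y) (κ z)) (layer (κ z) (κ y)) (ε (κ y)) (ε (κ z)))
          (sym (cong₂ (λ b c → layer (κ y) (κ z) + 2 * (⟦ b ⟧ * ε (κ y)) + (layer (κ z) (κ y) + 2 * (⟦ c ⟧ * ε (κ z)))) i (In-asym i))))))
      pt {y} {z} Sy Sz y≢z (no ni) (yes j) = ≤-trans (≤-reflexive (+-comm (W y z) (W z y))) (≤-trans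
        (pt Sz Sy (λ e → y≢z (sym e)) (yes j) (no ni)) (≤-reflexive (+-comm (B z y) (B y z))))
      pt {y} {z} Sy Sz y≢z (no ni) (no nj) = ≤-trans (pair-nonedge T T₁ T₂ T₃ Sy Sz y≢z (Bool.¬-not nj) (Bool.¬-not ni)) (≤-trans
        (nonedge (κ< Sy) (κ< Sz) (lo≤ y Sy) (lo≤ z Sz)) (+-mono-≤ (m≤m+n (layer (κ y) (κ z)) _) (m≤m+n (layer (κ z) (κ y)) _)))

module InDegrees {n} (F : Family n) (t : ℕ) (3≤t : 3 ≤ t) (m : ℕ) (1≤m : 1 ≤ m) (|S| : size (Family.S F) ≡ 2 + m) where
  open Family F
  open InNeighbours F t 3≤t m |S|
  open Pairs F t 3≤t m 1≤m |S| public

  low high : ℕ → Subsetᵇ n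
  low j z = S z ∧ (κ z <ᵇ j)
  high j = S ∖∖ low j

  c : ℕ → ℕ
  c j = size (low j)

  c-mono : ∀ {i j} → i ≤ j → c i ≤ c j
  c-mono {i} {j} i≤j = size-mono {P = low i} {low j} (λ z e → true-∧ (proj₁ (∧-true e)) (<ᵇ-intro (≤-trans (<ᵇ-elim (proj₂ (∧-true {S z} e))) i≤j)))

  c≤ : ∀ j → c j ≤ 2 + m
  c≤ j = ≤-trans (size-mono {P = low j} {S} (λ z e → proj₁ (∧-true e))) (≤-reflexive |S|)

  high-size : ∀ j → size (high j) ≡ 2 + m ∸ c j
  high-size j = trans (sym (m+n∸n≡m (size (high j)) (c j)))
    (cong (_∸ c j) (trans (size-∖∖ S (low j) (λ u e → proj₁ (∧-true e))) |S|))

  high-true : ∀ {j z} → S z ≡ true → j ≤ κ z → high j z ≡ true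
  high-true {j} {z} Sz le = ∖∖-intro {P = S} {Q = low j} Sz (Bool.¬-not (λ e → <⇒≱ (<ᵇ-elim (proj₂ (∧-true {S z} e))) le))

  meeting : ∀ j → sum-pairs S (λ y z → ⟦ (κ y <ᵇ j) ∨ (κ z <ᵇ j) ⟧) ≤ c j * (2 * (2 + m) ∸ 1 ∸ c j)
  meeting j = ≤-trans (sum-pairs-meeting S (λ z → κ z <ᵇ j)) (≤-reflexive (cong (λ s → c j * (2 * s ∸ 1 ∸ c j)) |S|))

  κ-outside : ∀ {z} → S z ≡ false → κ z ≡ 0
  κ-outside {z} e = ∑-zero (λ y → cong ⟦_⟧ (Bool.¬-not (λ i → true≢false (In-S i) e)))

  -- For fixed `z` the inner sum counts points dominating `z`, of which there are `κ z`, that also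
  -- lie among the `c j` points of in-degree below `j`.
  heads : ∀ j → ∑ (λ z → ∑ (λ y → ⟦ In z y ⟧ * ⟦ κ y <ᵇ j ⟧)) ≤ ∑ (λ z → κ z ⊓ c j)
  heads j = ∑-mono (λ z → ⊓-glb
    (∑-mono (λ y → ≤-trans (*-monoʳ-≤ ⟦ In z y ⟧ (⟦⟧≤1 (κ y <ᵇ j))) (≤-reflexive (*-identityʳ _))))
    (∑-mono (λ y → pt z y)))
    where
    pt : ∀ z y → ⟦ In z y ⟧ * ⟦ κ y <ᵇ j ⟧ ≤ ⟦ low j y ⟧
    pt z y = go (In z y Bool.≟ true)
      where
      go : Dec (In z y ≡ true) → ⟦ In z y ⟧ * ⟦ κ y <ᵇ j ⟧ ≤ ⟦ low j y ⟧
      go (no ni) = ≤-trans (≤-reflexive (cong (λ b → ⟦ b ⟧ * ⟦ κ y <ᵇ j ⟧) (Bool.¬-not ni))) z≤n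
      go (yes i) = ≤-reflexive (trans (cong (λ b → ⟦ b ⟧ * ⟦ κ y <ᵇ j ⟧) i) (trans (*-identityˡ _)
        (sym (cong (λ b → ⟦ b ∧ (κ y <ᵇ j) ⟧) (proj₁ (In⊆ i))))))

-- Totals for seven to ten points by summing over pairs.

-- Half of pair-cap 5 16 (a ⊓ b), as a combination of indicators that can be summed over pairs.
layer₇ : ℕ → ℕ → ℕ
layer₇ a b = 2 * ⟦ (a <ᵇ 1) ∨ (b <ᵇ 1) ⟧ + (4 * ⟦ (a <ᵇ 3) ∨ (b <ᵇ 3) ⟧ + 2 * ⟦ (a <ᵇ 4) ∨ (b <ᵇ 4) ⟧)

nonedge₇ : ∀ {a} → a < 7 → ∀ {b} → b < 7 → 0 ≤ a → 0 ≤ b → pair-cap 5 16 (a ⊓ b) ≤ layer₇ a b + layer₇ b a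
nonedge₇ = toWitness {a? = allUpTo? (λ a → allUpTo? (λ b → 0 ≤? a →-dec (0 ≤? b →-dec pair-cap 5 16 (a ⊓ b) ≤? layer₇ a b + layer₇ b a)) 7) 7} tt

-- The condition with 17 leaves only `a = 0`, where the cap 20 exceeds the layers' 16 by 4.
edge₇ : ∀ {a} → a < 7 → ∀ {b} → b < 7 → 0 ≤ a → 0 ≤ b → a ≤ 5 → 17 ≤ (5 ∸ a) * (5 ∸ a ∸ 1) + 2 * a →
        edge-cap 5 a ≤ layer₇ a b + layer₇ b a + 2 * 2
edge₇ = toWitness {a? = allUpTo? (λ a → allUpTo? (λ b → 0 ≤? a →-dec (0 ≤? b →-dec (a ≤? 5 →-dec (17 ≤? (5 ∸ a) * (5 ∸ a ∸ 1) + 2 * a →-dec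
  edge-cap 5 a ≤? layer₇ a b + layer₇ b a + 2 * 2)))) 7) 7} tt

count₇ : ∀ {c₄} → c₄ < 8 → ∀ {c₃} → c₃ < suc c₄ → ∀ {c₂} → c₂ < suc c₃ → ∀ {c₁} → c₁ < suc c₂ →
  2 * (c₁ * (13 ∸ c₁)) + (4 * (c₃ * (13 ∸ c₃)) + 2 * (c₄ * (13 ∸ c₄)))
  + 2 * ((((7 ∸ c₁) + (7 ∸ c₂)) + ((7 ∸ c₃) + (c₁ ∸ 3) * (7 ∸ c₄))) * 2) ≤ 360
count₇ = toWitness {a? = allUpTo? (λ c₄ → allUpTo? (λ c₃ → allUpTo? (λ c₂ → allUpTo? (λ c₁ →
  2 * (c₁ * (13 ∸ c₁)) + (4 * (c₃ * (13 ∸ c₃)) + 2 * (c₄ * (13 ∸ c₄)))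
  + 2 * ((((7 ∸ c₁) + (7 ∸ c₂)) + ((7 ∸ c₃) + (c₁ ∸ 3) * (7 ∸ c₄))) * 2) ≤? 360) (suc c₂)) (suc c₃)) (suc c₄)) 8} tt

total₇ : ∀ {n} (F : Family n) → size (Family.S F) ≡ 7 → Family.total F ≤ 360
total₇ {n} F |S| = ≤-trans (total≤pairs 16 0 ≤-refl (m≤m+n 10 6) (m≤m+n 8 8) (λ _ _ → z≤n) layer₇ (λ _ → 2) nonedge₇ edge₇)
  (≤-trans (+-mono-≤ layers (*-monoʳ-≤ 2 (≤-trans (≤-reflexive (trans (∑-cong (λ z → ∑-*ʳ 2 (λ y → ⟦ In z y ⟧))) (∑-*ʳ 2 κ))) (*-monoˡ-≤ 2 in-degrees))))
    (count₇ (s≤s (c≤ 4)) (s≤s (c-mono (m≤m+n 3 1))) (s≤s (c-mono (m≤m+n 2 1))) (s≤s (c-mono (m≤m+n 1 1)))))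
  where
  -- The threshold 17 is just above 4(m - 1) = 16, the cap for two nonempty links, and high enough
  -- that only undominated points dominate others.
  3≤17 : 3 ≤ 17
  3≤17 = m≤m+n 3 14
  open Family F
  open InNeighbours F 17 3≤17 5 |S|
  open InDegrees F 17 3≤17 5 (m≤m+n 1 4) |S|
  A : ℕ → Fin n → Fin n → ℕ
  A j y z = ⟦ (κ y <ᵇ j) ∨ (κ z <ᵇ j) ⟧
  layers : sum-pairs S (λ y z → layer₇ (κ y) (κ z)) ≤ 2 * (c 1 * (13 ∸ c 1)) + (4 * (c 3 * (13 ∸ c 3)) + 2 * (c 4 * (13 ∸ c 4)))
  layers = ≤-trans (≤-reflexive (trans (sum-pairs-+ S (λ y z → 2 * A 1 y z) (λ y z → 4 * A 3 y z + 2 * A 4 y z))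
      (cong₂ _+_ (sum-pairs-* S 2 (A 1)) (trans (sum-pairs-+ S (λ y z → 4 * A 3 y z) (λ y z → 2 * A 4 y z))
        (cong₂ _+_ (sum-pairs-* S 4 (A 3)) (sum-pairs-* S 2 (A 4)))))))
    (+-mono-≤ (*-monoʳ-≤ 2 (meeting 1)) (+-mono-≤ (*-monoʳ-≤ 4 (meeting 3)) (*-monoʳ-≤ 2 (meeting 4))))
  tail-zero : ∀ a → 17 ≤ (5 ∸ a) * (5 ∸ a ∸ 1) + 2 * a → a ≤ 5 → a ≡ 0
  tail-zero 0 _ _ = refl
  tail-zero 1 h _ = contradiction (≤ᵇ-intro h) λ ()
  tail-zero 2 h _ = contradiction (≤ᵇ-intro h) λ ()
  tail-zero 3 h _ = contradiction (≤ᵇ-intro h) λ ()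
  tail-zero 4 h _ = contradiction (≤ᵇ-intro h) λ ()
  tail-zero 5 h _ = contradiction (≤ᵇ-intro h) λ ()
  tail-zero (suc (suc (suc (suc (suc (suc _)))))) _ (s≤s (s≤s (s≤s (s≤s (s≤s ())))))
  κ≤c₁ : ∀ z → κ z ≤ c 1
  κ≤c₁ z = size-mono {P = In z} {low 1} (λ y i → true-∧ (proj₁ (In⊆ i)) (<ᵇ-intro (s≤s (≤-reflexive (tail-zero (κ y) (in-degree-limit i) (κ-tail≤m i))))))
  -- The first three units of an in-degree are counted separately. The at most `d ∸ 3` further ones
  -- occur only at points of in-degree at least 4.
  degree-split : ∀ k d h₁ h₂ h₃ h₄ → k ≤ d → (1 ≤ k → h₁ ≡ true) → (2 ≤ k → h₂ ≡ true) → (3 ≤ k → h₃ ≡ true) → (4 ≤ k → h₄ ≡ true) →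
         k ≤ (⟦ h₁ ⟧ + ⟦ h₂ ⟧) + (⟦ h₃ ⟧ + (d ∸ 3) * ⟦ h₄ ⟧)
  degree-split 0 _ _ _ _ _ _ _ _ _ _ = z≤n
  degree-split 1 _ h₁ h₂ h₃ h₄ _ p₁ _ _ _ rewrite p₁ (s≤s z≤n) = s≤s z≤n
  degree-split 2 _ h₁ h₂ h₃ h₄ _ p₁ p₂ _ _ rewrite p₁ (s≤s z≤n) | p₂ (s≤s (s≤s z≤n)) = s≤s (s≤s z≤n)
  degree-split 3 _ h₁ h₂ h₃ h₄ _ p₁ p₂ p₃ _ rewrite p₁ (s≤s z≤n) | p₂ (s≤s (s≤s z≤n)) | p₃ (s≤s (s≤s (s≤s z≤n))) = s≤s (s≤s (s≤s z≤n))
  degree-split (suc (suc (suc (suc k)))) (suc (suc (suc d))) h₁ h₂ h₃ h₄ (s≤s (s≤s (s≤s le))) p₁ p₂ p₃ p₄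
    rewrite p₁ (s≤s z≤n) | p₂ (s≤s (s≤s z≤n)) | p₃ (s≤s (s≤s (s≤s z≤n))) | p₄ (s≤s (s≤s (s≤s (s≤s z≤n)))) | *-identityʳ d = s≤s (s≤s (s≤s le))
  in-degrees : ∑ κ ≤ ((7 ∸ c 1) + (7 ∸ c 2)) + ((7 ∸ c 3) + (c 1 ∸ 3) * (7 ∸ c 4))
  in-degrees = ≤-trans (∑-mono pt) (≤-reflexive (trans (∑-+ (λ z → ⟦ high 1 z ⟧ + ⟦ high 2 z ⟧) (λ z → ⟦ high 3 z ⟧ + (c 1 ∸ 3) * ⟦ high 4 z ⟧))
    (cong₂ _+_ (trans (∑-+ (λ z → ⟦ high 1 z ⟧) (λ z → ⟦ high 2 z ⟧)) (cong₂ _+_ (high-size 1) (high-size 2)))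
      (trans (∑-+ (λ z → ⟦ high 3 z ⟧) (λ z → (c 1 ∸ 3) * ⟦ high 4 z ⟧)) (cong₂ _+_ (high-size 3)
        (trans (∑-*ˡ (c 1 ∸ 3) (λ z → ⟦ high 4 z ⟧)) (cong ((c 1 ∸ 3) *_) (high-size 4))))))))
    where
    pt : ∀ z → κ z ≤ (⟦ high 1 z ⟧ + ⟦ high 2 z ⟧) + (⟦ high 3 z ⟧ + (c 1 ∸ 3) * ⟦ high 4 z ⟧)
    pt z = go (S z Bool.≟ true)
      where
      go : Dec (S z ≡ true) → κ z ≤ (⟦ high 1 z ⟧ + ⟦ high 2 z ⟧) + (⟦ high 3 z ⟧ + (c 1 ∸ 3) * ⟦ high 4 z ⟧)
      go (no ¬Sz) = ≤-trans (≤-reflexive (κ-outside (Bool.¬-not ¬Sz))) z≤n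
      go (yes Sz) = degree-split (κ z) (c 1) (high 1 z) (high 2 z) (high 3 z) (high 4 z) (κ≤c₁ z) (high-true Sz) (high-true Sz) (high-true Sz) (high-true Sz)

-- When every point is dominated, each unordered pair contributes at most 22, and 8·7·11 = 616.
total₈ : ∀ {n} (F : Family n) (|S| : size (Family.S F) ≡ 8) →
         (∀ z → Family.S F z ≡ true → 1 ≤ InNeighbours.κ F 11 (m≤m+n 3 8) 6 |S| z) → Family.total F ≤ 630
total₈ F |S| pos = ≤-trans (total≤pairs 12 1 (m≤m+n 10 2) ≤-refl (m≤m+n 8 4) pos (λ _ _ → 11) (λ _ → 0)
    (toWitness {a? = allUpTo? (λ a → allUpTo? (λ b → 1 ≤? a →-dec (1 ≤? b →-dec pair-cap 6 12 (a ⊓ b) ≤? 22)) 8) 8} tt)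
    (toWitness {a? = allUpTo? (λ a → allUpTo? (λ b → 1 ≤? a →-dec (1 ≤? b →-dec (a ≤? 6 →-dec (11 ≤? (6 ∸ a) * (6 ∸ a ∸ 1) + 2 * a →-dec
      edge-cap 6 a ≤? 22)))) 8) 8} tt))
  (≤-trans (≤-reflexive (cong₂ (λ a b → a + 2 * b) (trans (sum-pairs-const S 11) (cong (λ s → s * (s ∸ 1) * 11) |S|))
    (∑-zero (λ z → trans (∑-*ʳ 0 (λ y → ⟦ In z y ⟧)) (*-zeroʳ (κ z)))))) (m≤m+n 616 14))
  where
  open Family F
  open InNeighbours F 11 (m≤m+n 3 8) 6 |S|
  open Pairs F 11 (m≤m+n 3 8) 6 (m≤m+n 1 5) |S|

-- Each pair contributes at most 20, except that a dominating point of in-degree 1 allows 30. The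
-- exceptions are counted by `heads 2`.
total₉ : ∀ {n} (F : Family n) (|S| : size (Family.S F) ≡ 9) →
         (∀ z → Family.S F z ≡ true → 1 ≤ InNeighbours.κ F 13 (m≤m+n 3 10) 7 |S| z) → Family.total F ≤ 1008
total₉ {n} F |S| pos = ≤-trans (total≤pairs 14 1 (m≤m+n 12 2) ≤-refl (m≤m+n 8 6) pos (λ _ _ → 10) (λ a → 5 * ⟦ a <ᵇ 2 ⟧)
    (toWitness {a? = allUpTo? (λ a → allUpTo? (λ b → 1 ≤? a →-dec (1 ≤? b →-dec pair-cap 7 14 (a ⊓ b) ≤? 20)) 9) 9} tt)
    (toWitness {a? = allUpTo? (λ a → allUpTo? (λ b → 1 ≤? a →-dec (1 ≤? b →-dec (a ≤? 7 →-dec (13 ≤? (7 ∸ a) * (7 ∸ a ∸ 1) + 2 * a →-dec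
      edge-cap 7 a ≤? 20 + 2 * (5 * ⟦ a <ᵇ 2 ⟧))))) 9) 9} tt))
  (≤-trans (+-mono-≤ (≤-reflexive (trans (sum-pairs-const S 10) (cong (λ s → s * (s ∸ 1) * 10) |S|)))
      (*-monoʳ-≤ 2 (≤-trans (≤-reflexive (trans (∑-cong (λ z → trans (∑-cong (λ y → rot ⟦ In z y ⟧ ⟦ κ y <ᵇ 2 ⟧)) (∑-*ˡ 5 (λ y → ⟦ In z y ⟧ * ⟦ κ y <ᵇ 2 ⟧))))
          (∑-*ˡ 5 (λ z → ∑ (λ y → ⟦ In z y ⟧ * ⟦ κ y <ᵇ 2 ⟧))))) (*-monoʳ-≤ 5 (≤-trans (heads 2) spread)))))
    (count (s≤s (c≤ 2))))
  where
  open Family F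
  open InNeighbours F 13 (m≤m+n 3 10) 7 |S|
  open InDegrees F 13 (m≤m+n 3 10) 7 (m≤m+n 1 6) |S|
  rot : ∀ i b → i * (5 * b) ≡ 5 * (i * b)
  rot = solve-∀
  count : ∀ {c} → c < 10 → 720 + 2 * (5 * (c * 1 + (9 ∸ c) * c)) ≤ 1008
  count = toWitness {a? = allUpTo? (λ c → 720 + 2 * (5 * (c * 1 + (9 ∸ c) * c)) ≤? 1008) 10} tt
  -- A point of in-degree below 2 receives at most one exceptional domination, any other at most
  -- `c 2`.
  spread : ∑ (λ z → κ z ⊓ c 2) ≤ c 2 * 1 + (9 ∸ c 2) * c 2
  spread = ≤-trans (∑-mono (λ z → pt z (S z Bool.≟ true) (κ z <ᵇ 2) refl)) (≤-reflexive (trans (∑-+ (λ z → ⟦ low 2 z ⟧ * 1) (λ z → ⟦ high 2 z ⟧ * c 2))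
    (cong₂ _+_ (∑-*ʳ 1 (λ z → ⟦ low 2 z ⟧)) (trans (∑-*ʳ (c 2) (λ z → ⟦ high 2 z ⟧)) (cong (_* c 2) (high-size 2))))))
    where
    pt : ∀ z → Dec (S z ≡ true) → ∀ b → (κ z <ᵇ 2) ≡ b → κ z ⊓ c 2 ≤ ⟦ low 2 z ⟧ * 1 + ⟦ high 2 z ⟧ * c 2
    pt z (no ¬Sz) _ _ = ≤-trans (m⊓n≤m (κ z) (c 2)) (≤-trans (≤-reflexive (κ-outside (Bool.¬-not ¬Sz))) z≤n)
    pt z (yes Sz) true e = ≤-trans (m⊓n≤m (κ z) (c 2)) (≤-trans (≤-pred (<ᵇ-elim e)) (≤-trans
      (≤-reflexive (sym (cong (λ b → ⟦ b ⟧ * 1) (true-∧ Sz e)))) (m≤m+n _ _)))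
    pt z (yes Sz) false e = ≤-trans (m⊓n≤n (κ z) (c 2)) (≤-trans
      (≤-reflexive (sym (trans (cong (λ b → ⟦ b ⟧ * c 2) (high-true {2} Sz (<ᵇ-false e))) (*-identityˡ (c 2))))) (m≤n+m _ _))

-- Half of pair-cap 8 16 (a ⊓ b) for positive a and b.
layer₁₀ : ℕ → ℕ → ℕ
layer₁₀ a b = 2 * ⟦ (a <ᵇ 2) ∨ (b <ᵇ 2) ⟧ + (2 * ⟦ (a <ᵇ 3) ∨ (b <ᵇ 3) ⟧ + (2 * ⟦ (a <ᵇ 4) ∨ (b <ᵇ 4) ⟧
  + (4 * ⟦ (a <ᵇ 6) ∨ (b <ᵇ 6) ⟧ + 2 * ⟦ (a <ᵇ 7) ∨ (b <ᵇ 7) ⟧)))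

-- Half the excess of `edge-cap 8 a` over the layers is 9, 5, 2, 2 for `a` from 1 to 4. It is
-- written with thresholds so that `heads` can sum it.
ε₁₀ : ℕ → ℕ
ε₁₀ a = 4 * ⟦ a <ᵇ 2 ⟧ + (3 * ⟦ a <ᵇ 3 ⟧ + 2 * ⟦ a <ᵇ 5 ⟧)

nonedge₁₀ : ∀ {a} → a < 10 → ∀ {b} → b < 10 → 1 ≤ a → 1 ≤ b → pair-cap 8 16 (a ⊓ b) ≤ layer₁₀ a b + layer₁₀ b a
nonedge₁₀ = toWitness {a? = allUpTo? (λ a → allUpTo? (λ b → 1 ≤? a →-dec (1 ≤? b →-dec pair-cap 8 16 (a ⊓ b) ≤? layer₁₀ a b + layer₁₀ b a)) 10) 10} tt

edge₁₀ : ∀ {a} → a < 10 → ∀ {b} → b < 10 → 1 ≤ a → 1 ≤ b → a ≤ 8 → 17 ≤ (8 ∸ a) * (8 ∸ a ∸ 1) + 2 * a →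
         edge-cap 8 a ≤ layer₁₀ a b + layer₁₀ b a + 2 * ε₁₀ a
edge₁₀ = toWitness {a? = allUpTo? (λ a → allUpTo? (λ b → 1 ≤? a →-dec (1 ≤? b →-dec (a ≤? 8 →-dec (17 ≤? (8 ∸ a) * (8 ∸ a ∸ 1) + 2 * a →-dec
  edge-cap 8 a ≤? layer₁₀ a b + layer₁₀ b a + 2 * ε₁₀ a)))) 10) 10} tt

-- If N i is the number of points of in-degree at least i, the in-degrees truncated at d sum to at most staircase d N.
staircase : ℕ → (ℕ → ℕ) → ℕ
staircase d N = ⟦ 1 ≤ᵇ d ⟧ * N 1 + (⟦ 2 ≤ᵇ d ⟧ * N 2 + (⟦ 3 ≤ᵇ d ⟧ * N 3 + (⟦ 4 ≤ᵇ d ⟧ * N 4 + (⟦ 5 ≤ᵇ d ⟧ * N 5 + (⟦ 6 ≤ᵇ d ⟧ * N 6 + (d ∸ 6) * N 7)))))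

staircase-mono : ∀ d {N N′ : ℕ → ℕ} → (∀ i → N i ≤ N′ i) → staircase d N ≤ staircase d N′
staircase-mono d h = +-mono-≤ (*-monoʳ-≤ ⟦ 1 ≤ᵇ d ⟧ (h 1)) (+-mono-≤ (*-monoʳ-≤ ⟦ 2 ≤ᵇ d ⟧ (h 2)) (+-mono-≤ (*-monoʳ-≤ ⟦ 3 ≤ᵇ d ⟧ (h 3))
  (+-mono-≤ (*-monoʳ-≤ ⟦ 4 ≤ᵇ d ⟧ (h 4)) (+-mono-≤ (*-monoʳ-≤ ⟦ 5 ≤ᵇ d ⟧ (h 5)) (+-mono-≤ (*-monoʳ-≤ ⟦ 6 ≤ᵇ d ⟧ (h 6)) (*-monoʳ-≤ (d ∸ 6) (h 7)))))))

staircase-∑ : ∀ {n} d (N : ℕ → Fin n → ℕ) → ∑ (λ z → staircase d (λ i → N i z)) ≡ staircase d (λ i → ∑ (N i))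
staircase-∑ {n} d N = step (⟦ 1 ≤ᵇ d ⟧) (N 1) (step (⟦ 2 ≤ᵇ d ⟧) (N 2) (step (⟦ 3 ≤ᵇ d ⟧) (N 3) (step (⟦ 4 ≤ᵇ d ⟧) (N 4)
  (step (⟦ 5 ≤ᵇ d ⟧) (N 5) (step (⟦ 6 ≤ᵇ d ⟧) (N 6) (∑-*ˡ (d ∸ 6) (N 7)))))))
  where
  step : ∀ k (A : Fin n → ℕ) {R : Fin n → ℕ} {r} → ∑ R ≡ r → ∑ (λ z → k * A z + R z) ≡ k * ∑ A + r
  step k A {R} e = trans (∑-+ (λ z → k * A z) R) (cong₂ _+_ (∑-*ˡ k A) e)

⊓≤staircase : ∀ {k} → k < 10 → ∀ {d} → d < 11 → k ⊓ d ≤ staircase d (λ i → ⟦ i ≤ᵇ k ⟧)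
⊓≤staircase = toWitness {a? = allUpTo? (λ k → allUpTo? (λ d → k ⊓ d ≤? staircase d (λ i → ⟦ i ≤ᵇ k ⟧)) 11) 10} tt

heights : (c₂ c₃ c₄ c₅ c₆ c₇ : ℕ) → ℕ → ℕ
heights c₂ c₃ c₄ c₅ c₆ c₇ 2 = 10 ∸ c₂
heights c₂ c₃ c₄ c₅ c₆ c₇ 3 = 10 ∸ c₃
heights c₂ c₃ c₄ c₅ c₆ c₇ 4 = 10 ∸ c₄
heights c₂ c₃ c₄ c₅ c₆ c₇ 5 = 10 ∸ c₅
heights c₂ c₃ c₄ c₅ c₆ c₇ 6 = 10 ∸ c₆
heights c₂ c₃ c₄ c₅ c₆ c₇ 7 = 10 ∸ c₇
heights _ _ _ _ _ _ _ = 10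

-- `c₂` to `c₇` stand for the numbers of points of in-degree below 2 to 7. The first line sums the
-- layers, with 19 = 2·10 - 1, and the second sums the excess.
pair-sum : (c₂ c₃ c₄ c₅ c₆ c₇ : ℕ) → ℕ
pair-sum c₂ c₃ c₄ c₅ c₆ c₇ =
  2 * (c₂ * (19 ∸ c₂)) + (2 * (c₃ * (19 ∸ c₃)) + (2 * (c₄ * (19 ∸ c₄)) + (4 * (c₆ * (19 ∸ c₆)) + 2 * (c₇ * (19 ∸ c₇)))))
  + 2 * (4 * H c₂ + (3 * H c₃ + 2 * H c₅))
  where
  H : ℕ → ℕ
  H d = staircase d (heights c₂ c₃ c₄ c₅ c₆ c₇)

-- An exhaustive check over the 8008 nondecreasing sequences of six numbers up to 10.
pair-sum≤ : ∀ {c₇} → c₇ < 11 → ∀ {c₆} → c₆ < suc c₇ → ∀ {c₅} → c₅ < suc c₆ → ∀ {c₄} → c₄ < suc c₅ →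
            ∀ {c₃} → c₃ < suc c₄ → ∀ {c₂} → c₂ < suc c₃ → pair-sum c₂ c₃ c₄ c₅ c₆ c₇ ≤ 1512
pair-sum≤ = toWitness {a? = allUpTo? (λ c₇ → allUpTo? (λ c₆ → allUpTo? (λ c₅ → allUpTo? (λ c₄ → allUpTo? (λ c₃ → allUpTo? (λ c₂ →
  pair-sum c₂ c₃ c₄ c₅ c₆ c₇ ≤? 1512) (suc c₃)) (suc c₄)) (suc c₅)) (suc c₆)) (suc c₇)) 11} tt

-- The threshold is 17 rather than 2m - 1 = 15, so that points of in-degree at least 5 dominate nothing.
total₁₀ : ∀ {n} (F : Family n) (|S| : size (Family.S F) ≡ 10) →
          (∀ z → Family.S F z ≡ true → 1 ≤ InNeighbours.κ F 17 (m≤m+n 3 14) 8 |S| z) → Family.total F ≤ 1512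
total₁₀ {n} F |S| pos = ≤-trans (total≤pairs 16 1 ≤-refl ≤-refl (m≤m+n 8 8) pos layer₁₀ ε₁₀ nonedge₁₀ edge₁₀)
  (≤-trans (+-mono-≤ layers (*-monoʳ-≤ 2 excess))
    (pair-sum≤ (s≤s (c≤ 7)) (s≤s (c-mono (m≤m+n 6 1))) (s≤s (c-mono (m≤m+n 5 1))) (s≤s (c-mono (m≤m+n 4 1))) (s≤s (c-mono (m≤m+n 3 1))) (s≤s (c-mono (m≤m+n 2 1)))))
  where
  open Family F
  open InNeighbours F 17 (m≤m+n 3 14) 8 |S|
  open InDegrees F 17 (m≤m+n 3 14) 8 (m≤m+n 1 7) |S|
  A : ℕ → Fin n → Fin n → ℕ
  A j y z = ⟦ (κ y <ᵇ j) ∨ (κ z <ᵇ j) ⟧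
  layers : sum-pairs S (λ y z → layer₁₀ (κ y) (κ z)) ≤
    2 * (c 2 * (19 ∸ c 2)) + (2 * (c 3 * (19 ∸ c 3)) + (2 * (c 4 * (19 ∸ c 4)) + (4 * (c 6 * (19 ∸ c 6)) + 2 * (c 7 * (19 ∸ c 7)))))
  layers = step 2 2 (step 2 3 (step 2 4 (step 4 6 (≤-trans (≤-reflexive (sum-pairs-* S 2 (A 7))) (*-monoʳ-≤ 2 (meeting 7))))))
    where
    step : ∀ k j {R : Fin n → Fin n → ℕ} {r} → sum-pairs S R ≤ r →
           sum-pairs S (λ y z → k * A j y z + R y z) ≤ k * (c j * (19 ∸ c j)) + r
    step k j {R} le = ≤-trans (≤-reflexive (trans (sum-pairs-+ S (λ y z → k * A j y z) R) (cong (_+ sum-pairs S R) (sum-pairs-* S k (A j)))))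
      (+-mono-≤ (*-monoʳ-≤ k (meeting j)) le)
  N : ℕ → Subsetᵇ n
  N 2 = high 2
  N 3 = high 3
  N 4 = high 4
  N 5 = high 5
  N 6 = high 6
  N 7 = high 7
  N _ = S
  truncated : ∀ j → ∑ (λ z → κ z ⊓ c j) ≤ staircase (c j) (λ i → size (N i))
  truncated j = ≤-trans (∑-mono (λ z → pt z (S z Bool.≟ true))) (≤-reflexive (staircase-∑ (c j) (λ i z → ⟦ N i z ⟧)))
    where
    pt : ∀ z → Dec (S z ≡ true) → κ z ⊓ c j ≤ staircase (c j) (λ i → ⟦ N i z ⟧)
    pt z (no ¬Sz) = ≤-trans (m⊓n≤m (κ z) (c j)) (≤-trans (≤-reflexive (κ-outside (Bool.¬-not ¬Sz))) z≤n)
    pt z (yes Sz) = ≤-trans (⊓≤staircase (s≤s (κ≤1+m F 17 (m≤m+n 3 14) 8 |S| Sz)) (s≤s (c≤ j))) (staircase-mono (c j) N≥)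
      where
      N≥ : ∀ i → ⟦ i ≤ᵇ κ z ⟧ ≤ ⟦ N i z ⟧
      N≥ i = ⟦⟧≤ (λ e → ≤-reflexive (sym (cong ⟦_⟧ (N-true i (≤ᵇ-elim {i} e)))))
        where
        N-true : ∀ i → i ≤ κ z → N i z ≡ true
        N-true 0 _ = Sz
        N-true 1 _ = Sz
        N-true 2 le = high-true Sz le
        N-true 3 le = high-true Sz le
        N-true 4 le = high-true Sz le
        N-true 5 le = high-true Sz le
        N-true 6 le = high-true Sz le
        N-true 7 le = high-true Sz le
        N-true (suc (suc (suc (suc (suc (suc (suc (suc _)))))))) _ = Sz
  N-size : ∀ i → size (N i) ≤ heights (c 2) (c 3) (c 4) (c 5) (c 6) (c 7) i
  N-size 0 = ≤-reflexive |S|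
  N-size 1 = ≤-reflexive |S|
  N-size 2 = ≤-reflexive (high-size 2)
  N-size 3 = ≤-reflexive (high-size 3)
  N-size 4 = ≤-reflexive (high-size 4)
  N-size 5 = ≤-reflexive (high-size 5)
  N-size 6 = ≤-reflexive (high-size 6)
  N-size 7 = ≤-reflexive (high-size 7)
  N-size (suc (suc (suc (suc (suc (suc (suc (suc _)))))))) = ≤-reflexive |S|
  H : ℕ → ℕ
  H d = staircase d (heights (c 2) (c 3) (c 4) (c 5) (c 6) (c 7))
  head : ∀ j → ∑ (λ z → ∑ (λ y → ⟦ In z y ⟧ * ⟦ κ y <ᵇ j ⟧)) ≤ H (c j)
  head j = ≤-trans (heads j) (≤-trans (truncated j) (staircase-mono (c j) N-size))
  excess : ∑ (λ z → ∑ (λ y → ⟦ In z y ⟧ * ε₁₀ (κ y))) ≤ 4 * H (c 2) + (3 * H (c 3) + 2 * H (c 5))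
  excess = ≤-trans (≤-reflexive (trans (∑-cong (λ z → ∑-cong (λ y → distr ⟦ In z y ⟧ ⟦ κ y <ᵇ 2 ⟧ ⟦ κ y <ᵇ 3 ⟧ ⟦ κ y <ᵇ 5 ⟧)))
      (trans (∑₂-+ (λ z y → 4 * D 2 z y) (λ z y → 3 * D 3 z y + 2 * D 5 z y)) (cong₂ _+_ (scale 4 (D 2))
        (trans (∑₂-+ (λ z y → 3 * D 3 z y) (λ z y → 2 * D 5 z y)) (cong₂ _+_ (scale 3 (D 3)) (scale 2 (D 5))))))))
    (+-mono-≤ (*-monoʳ-≤ 4 (head 2)) (+-mono-≤ (*-monoʳ-≤ 3 (head 3)) (*-monoʳ-≤ 2 (head 5))))
    where
    D : ℕ → Fin n → Fin n → ℕ
    D j z y = ⟦ In z y ⟧ * ⟦ κ y <ᵇ j ⟧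
    scale : ∀ k (θ : Fin n → Fin n → ℕ) → ∑ (λ u → ∑ (λ v → k * θ u v)) ≡ k * ∑ (λ u → ∑ (θ u))
    scale k θ = trans (∑-cong (λ u → ∑-*ˡ k (θ u))) (∑-*ˡ k (λ u → ∑ (θ u)))
    distr : ∀ i a b c → i * (4 * a + (3 * b + 2 * c)) ≡ 4 * (i * a) + (3 * (i * b) + 2 * (i * c))
    distr = solve-∀

-- Undominated points among eight to ten points.

module Heavy {n} (F : Family n) (m : ℕ) (4≤m : 4 ≤ m) (|S| : size (Family.S F) ≡ 2 + m) where
  open Family F

  t : ℕ
  t = 2 * m ∸ 1

  3≤t : 3 ≤ t
  3≤t = ≤-trans (m≤m+n 3 4) (∸-monoˡ-≤ 1 (*-monoʳ-≤ 2 4≤m))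

  1≤m : 1 ≤ m
  1≤m = ≤-trans (m≤m+n 1 3) 4≤m

  open InNeighbours F t 3≤t m |S| public
  open Pairs F t 3≤t m 1≤m |S| using (E≤complete; E-both; full-on; full-size)

  -- The only pairs that can exceed the bound 4(m - 1) for two nonempty links: one link is empty and
  -- the other is beyond that bound.
  heavy : Fin n → Fin n → Bool
  heavy y u = (E u y ≡ᵇ 0) ∧ (4 * (m ∸ 1) <ᵇ E y u)

  heavy-elim : ∀ {y u} → heavy y u ≡ true → E u y ≡ 0 × 4 * (m ∸ 1) < E y u
  heavy-elim {y} {u} e = ≡ᵇ-elim {E u y} {0} (proj₁ (∧-true e)) , <ᵇ-elim (proj₂ (∧-true {E u y ≡ᵇ 0} e))

  heavy-head : ∀ {y u} → heavy y u ≡ true → S u ≡ true × y ≢ u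
  heavy-head {y} {u} e = Su , λ { refl → contradiction (≤-trans (s≤s z≤n) (≤-trans (proj₂ (heavy-elim e)) (≤-reflexive (E-diag y)))) λ () }
    where
    Su : S u ≡ true
    Su with S u in eq
    ... | true = refl
    ... | false = contradiction (≤-trans (s≤s z≤n) (≤-trans (proj₂ (heavy-elim e)) (≤-reflexive (E-outʳ y eq)))) λ ()

  -- Two nonempty links together stay within 4(m - 1) by `cross-bound`. A link facing an empty one
  -- stays within it too unless it is heavy, and then it exceeds it by at most m(m - 1) - 4(m - 1).
  heavy-total : total ≤ (2 + m) * (1 + m) * (2 * (m ∸ 1)) + (m * (m ∸ 1) ∸ 4 * (m ∸ 1)) * sum-pairs S (λ y z → ⟦ heavy y z ⟧)
  heavy-total = ≤-trans (sum-pairs-bound S E B E-diag (λ y z → E-outˡ z) (λ y z → E-outʳ y) pt) (≤-reflexive (trans (sum-pairs-+ S (λ _ _ → 2 * (m ∸ 1)) (λ y z → x * ⟦ heavy y z ⟧))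
      (cong₂ _+_ (trans (sum-pairs-const S (2 * (m ∸ 1))) (cong (λ s → s * (s ∸ 1) * (2 * (m ∸ 1))) |S|)) (sum-pairs-* S x (λ y z → ⟦ heavy y z ⟧)))))
    where
    x = m * (m ∸ 1) ∸ 4 * (m ∸ 1)
    B : Fin n → Fin n → ℕ
    B y z = 2 * (m ∸ 1) + x * ⟦ heavy y z ⟧
    twice : ∀ a b c → 4 * a + (b + c) ≡ 2 * a + b + (2 * a + c)
    twice = solve-∀
    one-sided : ∀ {y z} → S y ≡ true → S z ≡ true → y ≢ z → E z y ≡ 0 → E y z + E z y ≤ B y z + B z y
    one-sided {y} {z} Sy Sz y≢z e with 4 * (m ∸ 1) <ᵇ E y z in eq
    ... | false = ≤-trans (≤-reflexive (trans (cong (E y z +_) e) (+-identityʳ _))) (≤-trans (<ᵇ-false eq)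
            (≤-trans (m≤m+n (4 * (m ∸ 1)) (x * ⟦ (E z y ≡ᵇ 0) ∧ false ⟧ + x * ⟦ heavy z y ⟧)) (≤-reflexive (twice (m ∸ 1) _ _))))
    ... | true = ≤-trans (≤-reflexive (trans (cong (E y z +_) e) (+-identityʳ _))) (≤-trans (E≤complete Sy Sz y≢z) (≤-trans (≤-reflexive big)
            (≤-trans (+-monoʳ-≤ (4 * (m ∸ 1)) (≤-trans (≤-reflexive (sym (trans (cong (λ b → x * ⟦ b ∧ true ⟧) (≡ᵇ-intro {E z y} {0} e)) (*-identityʳ x)))) (m≤m+n _ (x * ⟦ heavy z y ⟧))))
              (≤-reflexive (twice (m ∸ 1) _ _)))))
      where
      big : m * (m ∸ 1) ≡ 4 * (m ∸ 1) + x
      big = sym (m+[n∸m]≡n (*-monoˡ-≤ (m ∸ 1) 4≤m))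
    pt : ∀ {y z} → S y ≡ true → S z ≡ true → y ≢ z → E y z + E z y ≤ B y z + B z y
    pt {y} {z} Sy Sz y≢z with E z y Data.Nat.≟ 0 | E y z Data.Nat.≟ 0
    ... | yes e | _ = one-sided Sy Sz y≢z e
    ... | no _ | yes e = ≤-trans (≤-reflexive (+-comm (E y z) (E z y))) (≤-trans (one-sided Sz Sy (λ p → y≢z (sym p)) e) (≤-reflexive (+-comm (B z y) (B y z))))
    ... | no e | no e′ = ≤-trans (E-both 4≤m Sy Sz y≢z e′ e) (≤-trans (m≤m+n (4 * (m ∸ 1)) (x * ⟦ heavy y z ⟧ + x * ⟦ heavy z y ⟧)) (≤-reflexive (twice (m ∸ 1) _ _)))

  heavies≤ : ∀ {y₀ u} → heavy y₀ u ≡ true → (∀ y v → heavy y v ≡ true → v ≡ u) → sum-pairs S (λ y z → ⟦ heavy y z ⟧) ≤ 1 + m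
  heavies≤ {y₀} {u} h₀ only = ≤-trans (∑₂-mono pt) (≤-reflexive (trans (∑₂-* (λ y → ⟦ (S ∖ u) y ⟧) (λ z → ⟦ z == u ⟧))
      (trans (cong (size (S ∖ u) *_) (∑-== u)) (trans (*-identityʳ _) (suc-injective (trans (size-∖ S (proj₁ (heavy-head h₀))) |S|))))))
    where
    pt : ∀ y z → ⟦ S y ⟧ * ⟦ (S ∖ y) z ⟧ * ⟦ heavy y z ⟧ ≤ ⟦ (S ∖ u) y ⟧ * ⟦ z == u ⟧
    pt y z = go (heavy y z Bool.≟ true) (S y Bool.≟ true)
      where
      go : Dec (heavy y z ≡ true) → Dec (S y ≡ true) → ⟦ S y ⟧ * ⟦ (S ∖ y) z ⟧ * ⟦ heavy y z ⟧ ≤ ⟦ (S ∖ u) y ⟧ * ⟦ z == u ⟧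
      go (no nh) _ = ≤-trans (≤-reflexive (trans (cong (λ b → ⟦ S y ⟧ * ⟦ (S ∖ y) z ⟧ * ⟦ b ⟧) (Bool.¬-not nh)) (*-zeroʳ (⟦ S y ⟧ * ⟦ (S ∖ y) z ⟧)))) z≤n
      go _ (no ns) = ≤-trans (≤-reflexive (cong (λ b → ⟦ b ⟧ * ⟦ (S ∖ y) z ⟧ * ⟦ heavy y z ⟧) (Bool.¬-not ns))) z≤n
      go (yes h) (yes Sy) with refl ← only y z h = ≤-trans (*-mono-≤ (*-mono-≤ (⟦⟧≤1 (S y)) (⟦⟧≤1 ((S ∖ y) z))) (⟦⟧≤1 (heavy y z)))
        (≤-reflexive (sym (cong₂ (λ a b → ⟦ a ⟧ * ⟦ b ⟧) (∖-intro {P = S} Sy (proj₂ (heavy-head h))) (==-refl z))))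

  heavies-none : (∀ y v → heavy y v ≡ false) → sum-pairs S (λ y z → ⟦ heavy y z ⟧) ≡ 0
  heavies-none none = ∑-zero (λ y → ∑-zero (λ z → trans (cong (λ b → ⟦ S y ⟧ * ⟦ (S ∖ y) z ⟧ * ⟦ b ⟧) (none y z)) (*-zeroʳ (⟦ S y ⟧ * ⟦ (S ∖ y) z ⟧))))

  module _ {z} (Sz : S z ≡ true) (κz : κ z ≡ 0) where
    undominated : ∀ y → In z y ≡ false
    undominated = size≡0⇒ κz

    rest-intro : ∀ {u} → S u ≡ true → u ≢ z → rest z u ≡ true
    rest-intro Su u≢z = ∖∖-intro {P = S ∖ z} {Q = In z} (∖-intro {P = S} Su u≢z) (undominated _)

    -- The edges of F_u^z avoid the heavy in-neighbour y of u, so they live on one point fewer.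
    heavy-head-charge : ∀ {y u} X → heavy y u ≡ true → m * (m ∸ 1) ≤ X → 2 * (m ∸ 1) + 6 * (m ∸ 2) ≤ X → 2 + 3 * (t ∸ 1) ≤ X →
      6 * (m ∸ 2) + 10 ≤ X → 2 * (m ∸ 1) + 2 * (m ∸ 2) + 6 ≤ X → 2 * (m ∸ 1) + 14 ≤ X → 28 ≤ X →
      u ≢ z × charge z u ≤ X
    heavy-head-charge {y} {u} X h x₁ x₂ x₃ x₄ x₅ x₆ x₇ = u≢z , ≤-trans (≤-reflexive (charge-out {z} {u} (undominated u))) (go (y ≟ z))
      where
      Su = proj₁ (heavy-head h)
      y≢u = proj₂ (heavy-head h)
      Euy : E u y ≡ 0
      Euy = proj₁ (heavy-elim h)
      t≤4 : t ≤ 4 * (m ∸ 1)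
      t≤4 = subst (λ m → 2 * m ∸ 1 ≤ 4 * (m ∸ 1)) (m+[n∸m]≡n 4≤m) (≤-trans (m∸n≤m (2 * (4 + p)) 1) (from-slack (4 + 2 * p) (e p)))
        where
        p = m ∸ 4
        e : ∀ p → 2 * (4 + p) + (4 + 2 * p) ≡ 4 * (3 + p)
        e = solve-∀
      u≢z : u ≢ z
      u≢z refl = true≢false (In-intro (≤-trans t≤4 (<⇒≤ (proj₂ (heavy-elim h)))) (≤-trans (≤-reflexive Euy) z≤n)) (undominated y)
      z≢u : z ≢ u
      z≢u e = u≢z (sym e)
      size-z : size (ground z u (In z)) ≤ m
      size-z = ≤-trans (ground≤ (In z) Sz Su z≢u (In-ground (undominated u))) (m∸n≤m m (κ z))
      go : Dec (y ≡ z) → cnt (clean z u (In z)) + 3 * E u z ≤ X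
      go (yes refl) = ≤-trans (≤-reflexive (trans (cong (λ a → cnt (clean z u (In z)) + 3 * a) Euy) (+-identityʳ _)))
        (≤-trans (complete-bound≤ (ground z u (In z)) (clean-graph z u (In z)) (clean-on z u (In z)) size-z) x₁)
      go (no y≢z) = weighted-cross-bound (ground z u (In z)) (ground z u (λ _ → false)) (ground u z (_== y)) {w = t ∸ 1}
          (clean-graph z u (In z)) (graph z u) (graph u z) (clean-on z u (In z)) (full-on z u) on-y (clean⊆ z u (In z))
          size-z (full-size Sz Su z≢u) size-y (f-cross z u z≢u) (λ le → <⇒≤pred (In-false (undominated u) le)) x₁ x₂ x₃ x₄ x₅ x₆ x₇
        where
        on-y : On (ground u z (_== y)) (f u z)
        on-y {a} {b} e with f-rest e
        ... | Sa , a≢u , a≢z = ∖∖-intro {P = (S ∖ u) ∖ z} {Q = _== y} (∖-intro {P = S ∖ u} (∖-intro {P = S} Sa a≢u) a≢z) (==-false a≢y)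
          where
          a≢y : a ≢ y
          a≢y refl = contradiction (≤-trans (cnt-pos (trans (sym (f-swap₁ u z a b)) e)) (≤-reflexive Euy)) λ ()
        Sy : S y ≡ true
        Sy with S y in eq
        ... | true = refl
        ... | false = contradiction (≤-trans (s≤s z≤n) (≤-trans (proj₂ (heavy-elim h)) (≤-reflexive (E-outˡ u eq)))) λ ()
        size-y : size (ground u z (_== y)) ≤ suc (m ∸ 2)
        size-y = ≤-trans (ground≤ (_== y) Su Sz u≢z (λ a e → subst (λ a → S a ≡ true × a ≢ u × a ≢ z) (sym (==-true {u = a} {y} e)) (Sy , y≢u , y≢z)))
          (≤-trans (≤-reflexive (cong (m ∸_) (∑-== y))) (≤-reflexive (sym (trans (cong suc (sym (∸-+-assoc m 1 1))) (m+[n∸m]≡n (∸-monoˡ-≤ 1 (≤-trans (m≤m+n 2 2) 4≤m)))))))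

-- With an undominated point, `heavy-total` gives 560 + 10h for h heavy pairs. If these all share
-- one head, h is at most 7 and 630 is met exactly. Two heads save 6 each in the degree estimate
-- 7·40 = 280, leaving 268.
step₈ : ∀ {n} (F : Family n) → size (Family.S F) ≡ 8 → Family.total F ≤ 630 ⊎ (∃[ z ] Family.S F z ≡ true × Family.cost F z ≤ 270)
step₈ F |S| with pick (λ z → Family.S F z ∧ (InNeighbours.κ F 11 (m≤m+n 3 8) 6 |S| z ≡ᵇ 0))
... | inj₂ none = inj₁ (total₈ F |S| (λ z Sz → n≢0⇒n>0 (λ e → true≢false (true-∧ Sz (≡ᵇ-intro e)) (none z))))
... | inj₁ (z , e) = go (pick₂ heavy)
  where
  open Family F
  open Heavy F 6 (m≤m+n 4 2) |S|
  Sz : S z ≡ true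
  Sz = proj₁ (∧-true e)
  κz : κ z ≡ 0
  κz = ≡ᵇ-elim {κ z} (proj₂ (∧-true {S z} e))
  rest≡7 : size (rest z) ≡ 7
  rest≡7 = trans (rest≡ F t 3≤t 6 |S| Sz) (cong (7 ∸_) κz)
  charge≤40 : ∀ y → rest z y ≡ true → charge z y ≤ 40
  charge≤40 y r = subst (λ k → charge z y ≤ X 6 k) κz (charge≤X F t 3≤t 6 |S| refl (m≤m+n 4 2) Sz r)
  head-charge : ∀ {y u} → heavy y u ≡ true → u ≢ z × charge z u ≤ 34
  head-charge h = heavy-head-charge Sz κz 34 h (m≤m+n 30 4) ≤-refl (m≤m+n 32 2) ≤-refl (m≤m+n 24 10) (m≤m+n 24 10) (m≤m+n 28 6)
  two-heads : ∀ {y u y′ u′} → heavy y u ≡ true → heavy y′ u′ ≡ true → u′ ≢ u → cost z ≤ 270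
  two-heads {y} {u} {y′} {u′} h h′ u′≢u = ≤-trans (+-cancelʳ-≤ 12 (cost z) 268 (≤-trans
    (≤-trans (≤-reflexive (cong (cost z +_) (sym (trans (∑-+ (at u 6) (at u′ 6)) (cong₂ _+_ (∑-at u 6) (∑-at u′ 6))))))
      (charges≤ 0 40 (λ y → at u 6 y + at u′ 6 y) (λ y i → true≢false i (undominated Sz κz y)) pt (λ y _ nr → cong₂ _+_ (at-0 {y₀ = u} {6} {y} (off h nr)) (at-0 {y₀ = u′} {6} {y} (off h′ nr)))))
    (≤-reflexive (trans (cong (λ a → a * 0 + size (rest z) * 40) κz) (cong (_* 40) rest≡7))))) (m≤m+n 268 2)
    where
    off : ∀ {y v w} → heavy y v ≡ true → rest z w ≡ false → w ≢ v
    off h nr refl = true≢false (rest-intro Sz κz (proj₁ (heavy-head h)) (proj₁ (head-charge h))) nr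
    pt : ∀ y → rest z y ≡ true → charge z y + (at u 6 y + at u′ 6 y) ≤ 40
    pt y r with y ≟ u
    ... | yes refl = ≤-trans (≤-reflexive (cong (λ a → charge z y + (6 + 0 + a)) (at-0 {y₀ = u′} {6} {y} (λ e → u′≢u (sym e))))) (+-monoˡ-≤ 6 (proj₂ (head-charge h)))
    ... | no _ = at-≤ {y₀ = u′} {6} {y} {charge z y} (charge≤40 y r) (λ { refl → +-monoˡ-≤ 6 (proj₂ (head-charge h′)) })
  go : (∃[ y ] ∃[ u ] heavy y u ≡ true) ⊎ (∀ y u → heavy y u ≡ false) → total ≤ 630 ⊎ (∃[ z ] S z ≡ true × cost z ≤ 270)
  go (inj₂ none) = inj₁ (≤-trans heavy-total (≤-trans (+-monoʳ-≤ 560 (*-monoʳ-≤ 10 (≤-reflexive (heavies-none none)))) (m≤m+n 560 70)))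
  go (inj₁ (y , u , h)) with pick₂ (λ y′ u′ → heavy y′ u′ ∧ not (u′ == u))
  ... | inj₁ (y′ , u′ , e′) = inj₂ (z , Sz , two-heads h (proj₁ (∧-true e′)) (λ { refl → true≢false (==-refl u′) (not-true (proj₂ (∧-true {heavy y′ u′} e′))) }))
  ... | inj₂ none = inj₁ (≤-trans heavy-total (+-monoʳ-≤ 560 (*-monoʳ-≤ 10 (heavies≤ h only))))
    where
    only : ∀ y v → heavy y v ≡ true → v ≡ u
    only y v hv with v ≟ u
    ... | yes e = e
    ... | no ne = true≢false (true-∧ hv (cong not (==-false ne))) (none y v)

-- Without heavy pairs the sum over pairs is at most 864. One heavy head saves 6 in the degree
-- estimate 8·48 = 384 and gives exactly 378.
step₉ : ∀ {n} (F : Family n) → size (Family.S F) ≡ 9 → Family.total F ≤ 1008 ⊎ (∃[ z ] Family.S F z ≡ true × Family.cost F z ≤ 378)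
step₉ F |S| with pick (λ z → Family.S F z ∧ (InNeighbours.κ F 13 (m≤m+n 3 10) 7 |S| z ≡ᵇ 0))
... | inj₂ none = inj₁ (total₉ F |S| (λ z Sz → n≢0⇒n>0 (λ e → true≢false (true-∧ Sz (≡ᵇ-intro e)) (none z))))
... | inj₁ (z , e) = go (pick₂ heavy)
  where
  open Family F
  open Heavy F 7 (m≤m+n 4 3) |S|
  Sz : S z ≡ true
  Sz = proj₁ (∧-true e)
  κz : κ z ≡ 0
  κz = ≡ᵇ-elim {κ z} (proj₂ (∧-true {S z} e))
  rest≡8 : size (rest z) ≡ 8
  rest≡8 = trans (rest≡ F t 3≤t 7 |S| Sz) (cong (8 ∸_) κz)
  go : (∃[ y ] ∃[ u ] heavy y u ≡ true) ⊎ (∀ y u → heavy y u ≡ false) → total ≤ 1008 ⊎ (∃[ z ] S z ≡ true × cost z ≤ 378)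
  go (inj₂ none) = inj₁ (≤-trans heavy-total (≤-trans (+-monoʳ-≤ 864 (*-monoʳ-≤ 18 (≤-reflexive (heavies-none none)))) (m≤m+n 864 144)))
  go (inj₁ (y , u , h)) = inj₂ (z , Sz , +-cancelʳ-≤ 6 (cost z) 378 (≤-trans
    (≤-trans (≤-reflexive (cong (cost z +_) (sym (∑-at u 6))))
      (charges≤ 0 48 (at u 6) (λ y i → true≢false i (undominated Sz κz y))
        (λ y r → at-≤ {y₀ = u} {6} {y} (subst (λ k → charge z y ≤ X 7 k) κz (charge≤X F t 3≤t 7 |S| refl (m≤m+n 4 3) Sz r)) (λ { refl → +-monoˡ-≤ 6 (proj₂ hc) }))
        (λ y _ nr → at-0 {y₀ = u} {6} {y} (λ { refl → true≢false (rest-intro Sz κz (proj₁ (heavy-head h)) (proj₁ hc)) nr }))))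
    (≤-reflexive (trans (cong (λ a → a * 0 + size (rest z) * 48) κz) (cong (_* 48) rest≡8)))))
    where
    hc : u ≢ z × charge z u ≤ 42
    hc = heavy-head-charge Sz κz 42 h ≤-refl ≤-refl (m≤m+n 38 4) (m≤m+n 40 2) (m≤m+n 28 14) (m≤m+n 26 16) (m≤m+n 28 14)

step₁₀ : ∀ {n} (F : Family n) → size (Family.S F) ≡ 10 → Family.total F ≤ 1512 ⊎ (∃[ z ] Family.S F z ≡ true × Family.cost F z ≤ 504)
step₁₀ F |S| with pick (λ z → Family.S F z ∧ (InNeighbours.κ F 17 (m≤m+n 3 14) 8 |S| z ≡ᵇ 0))
... | inj₂ none = inj₁ (total₁₀ F |S| (λ z Sz → n≢0⇒n>0 (λ e → true≢false (true-∧ Sz (≡ᵇ-intro e)) (none z))))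
... | inj₁ (z , e) = inj₂ (z , Sz , undominated-cost F 17 (m≤m+n 3 14) 8 |S| 56 Sz κz (λ y r →
    charge-rest≤ 56 Sz r (m≤m+n 1 7) (q≤ (λ q → q * (q ∸ 1)) ≤-refl) (q≤ (λ q → 2 * (q ∸ 1) + 42) ≤-refl)
      (m≤m+n 50 6) (m≤m+n 52 4) (m≤m+n 32 24) (m≤m+n 28 28) (m≤m+n 28 28)))
  where
  open Family F
  open InNeighbours F 17 (m≤m+n 3 14) 8 |S|
  Sz : S z ≡ true
  Sz = proj₁ (∧-true e)
  κz : κ z ≡ 0
  κz = ≡ᵇ-elim {κ z} (proj₂ (∧-true {S z} e))
  q≤ : ∀ (φ : ℕ → ℕ) → φ 8 ≤ 56 → φ (8 ∸ κ z) ≤ 56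
  q≤ φ = subst (λ k → φ (8 ∸ k) ≤ 56) (sym κz)

-- The upper bound by induction on the number of points.

delete-step : ∀ {n} (F : Family n) {s b K} → size (Family.S F) ≡ suc s →
  (∀ (F′ : Family n) → size (Family.S F′) ≡ s → Family.total F′ ≤ b) →
  (∃[ z ] Family.S F z ≡ true × Family.cost F z ≤ K) → Family.total F ≤ b + K
delete-step F |S| ih (z , Sz , le) = ≤-trans (total-delete F z)
  (+-mono-≤ (ih (delete F z) (suc-injective (trans (size-∖ (Family.S F) Sz) |S|))) le)

bound₈ : ∀ {n} (F : Family n) → size (Family.S F) ≡ 8 → Family.total F ≤ 630
bound₈ F |S| with step₈ F |S|
... | inj₁ le = le
... | inj₂ p = delete-step F |S| total₇ p

bound₉ : ∀ {n} (F : Family n) → size (Family.S F) ≡ 9 → Family.total F ≤ 1008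
bound₉ F |S| with step₉ F |S|
... | inj₁ le = le
... | inj₂ p = delete-step F |S| bound₈ p

bound₁₀ : ∀ {n} (F : Family n) → size (Family.S F) ≡ 10 → Family.total F ≤ 1512
bound₁₀ F |S| with step₁₀ F |S|
... | inj₁ le = le
... | inj₂ p = delete-step F |S| bound₉ p

2*choose-2 : ∀ n → 2 * (n C 2) ≡ n * (n ∸ 1)
2*choose-2 zero = refl
2*choose-2 (suc n) = begin
  2 * (suc n C 2) ≡⟨ cong (2 *_) (sym (nCk+nC[k+1]≡[n+1]C[k+1] n 1)) ⟩
  2 * (n C 1 + n C 2) ≡⟨ *-distribˡ-+ 2 (n C 1) (n C 2) ⟩
  2 * (n C 1) + 2 * (n C 2) ≡⟨ cong₂ (λ a b → 2 * a + b) (nC1≡n n) (2*choose-2 n) ⟩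
  2 * n + n * (n ∸ 1) ≡⟨ poly n ⟩
  suc n * n ∎
  where
  open ≡-Reasoning
  eq : ∀ n → 2 * suc n + suc n * n ≡ suc (suc n) * suc n
  eq = solve-∀
  poly : ∀ n → 2 * n + n * (n ∸ 1) ≡ suc n * n
  poly zero = refl
  poly (suc n) = eq n

6*choose-3 : ∀ n → 6 * (n C 3) ≡ n * ((n ∸ 1) * (n ∸ 1 ∸ 1))
6*choose-3 zero = refl
6*choose-3 (suc n) = begin
  6 * (suc n C 3) ≡⟨ cong (6 *_) (sym (nCk+nC[k+1]≡[n+1]C[k+1] n 2)) ⟩
  6 * (n C 2 + n C 3) ≡⟨ split (n C 2) (n C 3) ⟩
  3 * (2 * (n C 2)) + 6 * (n C 3) ≡⟨ cong₂ (λ a b → 3 * a + b) (2*choose-2 n) (6*choose-3 n) ⟩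
  3 * (n * (n ∸ 1)) + n * ((n ∸ 1) * (n ∸ 1 ∸ 1)) ≡⟨ poly n ⟩
  suc n * (n * (n ∸ 1)) ∎
  where
  open ≡-Reasoning
  split : ∀ a b → 6 * (a + b) ≡ 3 * (2 * a) + 6 * b
  split = solve-∀
  eq : ∀ n → 3 * (suc (suc n) * suc n) + suc (suc n) * (suc n * n) ≡ suc (suc (suc n)) * (suc (suc n) * suc n)
  eq = solve-∀
  poly : ∀ n → 3 * (n * (n ∸ 1)) + n * ((n ∸ 1) * (n ∸ 1 ∸ 1)) ≡ suc n * (n * (n ∸ 1))
  poly zero = refl
  poly (suc zero) = refl
  poly (suc (suc n)) = eq n

-- From eleven points on, a deletion costs at most 6·C(n-1,3), which is what Pascal's rule adds to
-- 6·C(n-1,4).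
total-bound : ∀ k {n} (F : Family n) → size (Family.S F) ≡ 9 + k → Family.total F ≤ 6 * ((9 + k) C 4 + 42)
total-bound 0 F |S| = bound₉ F |S|
total-bound 1 F |S| = bound₁₀ F |S|
total-bound (suc (suc k)) F |S| = ≤-trans (delete-step F |S| (total-bound (suc k)) (cheap k |S|)) (≤-reflexive arith)
  where
  cheap : ∀ k → size (Family.S F) ≡ 11 + k → ∃[ z ] Family.S F z ≡ true × Family.cost F z ≤ (10 + k) * ((9 + k) * (8 + k))
  cheap zero |S| = Eleven.cheap-point₁₁ F |S|
  cheap (suc k) |S| = cheap-point F (10 + k) (m≤m+n 10 k) |S|
  open ≡-Reasoning
  split : ∀ a b → 6 * (b + 42) + 6 * a ≡ 6 * ((a + b) + 42)
  split = solve-∀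
  arith : 6 * ((10 + k) C 4 + 42) + (10 + k) * ((9 + k) * (8 + k)) ≡ 6 * ((11 + k) C 4 + 42)
  arith = begin
    6 * ((10 + k) C 4 + 42) + (10 + k) * ((9 + k) * (8 + k)) ≡⟨ cong (6 * ((10 + k) C 4 + 42) +_) (sym (6*choose-3 (10 + k))) ⟩
    6 * ((10 + k) C 4 + 42) + 6 * ((10 + k) C 3) ≡⟨ split ((10 + k) C 3) ((10 + k) C 4) ⟩
    6 * (((10 + k) C 3 + (10 + k) C 4) + 42) ≡⟨ cong (λ a → 6 * (a + 42)) (nCk+nC[k+1]≡[n+1]C[k+1] (10 + k) 3) ⟩
    6 * ((11 + k) C 4 + 42) ∎

-- From independent sets of flags to families

flag : ∀ {n} → Fin n → Fin n → Fin n → Fin n → Flag2 n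
flag x y u v = ⁅ x ⁆ , ∁ (⁅ y ⁆ ∪ (⁅ u ⁆ ∪ ⁅ v ⁆))

flag-swap₁ : ∀ {n} (x y u v : Fin n) → flag x y u v ≡ flag x u y v
flag-swap₁ x y u v = cong (λ B → ⁅ x ⁆ , ∁ B) (trans (sym (∪-assoc ⁅ y ⁆ ⁅ u ⁆ ⁅ v ⁆))
  (trans (cong (_∪ ⁅ v ⁆) (∪-comm ⁅ y ⁆ ⁅ u ⁆)) (∪-assoc ⁅ u ⁆ ⁅ y ⁆ ⁅ v ⁆)))

flag-swap₂ : ∀ {n} (x y u v : Fin n) → flag x y u v ≡ flag x y v u
flag-swap₂ x y u v = cong (λ B → ⁅ x ⁆ , ∁ (⁅ y ⁆ ∪ B)) (∪-comm ⁅ u ⁆ ⁅ v ⁆)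

∈-triple : ∀ {n} {i y u v : Fin n} → i ∈ₛ ⁅ y ⁆ ∪ (⁅ u ⁆ ∪ ⁅ v ⁆) → i ≡ y ⊎ (i ≡ u ⊎ i ≡ v)
∈-triple {i = i} {y} {u} {v} h with x∈p∪q⁻ ⁅ y ⁆ (⁅ u ⁆ ∪ ⁅ v ⁆) h
... | inj₁ p = inj₁ (x∈⁅y⁆⇒x≡y y p)
... | inj₂ q with x∈p∪q⁻ ⁅ u ⁆ ⁅ v ⁆ q
... | inj₁ p = inj₂ (inj₁ (x∈⁅y⁆⇒x≡y u p))
... | inj₂ p = inj₂ (inj₂ (x∈⁅y⁆⇒x≡y v p))

-- The 4-sets `{x,y,a,b}` and `{x,y,u,v}` share only their marks. Each mark lies in the triple
-- removed by the other flag, and the two removed triples are disjoint.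
flags-opposite : ∀ {n} {x y a b u v : Fin n} → x ≢ y →
  y ≢ u → y ≢ v → x ≢ a → x ≢ b → a ≢ u → a ≢ v → b ≢ u → b ≢ v →
  OppositeFlags (flag x y a b) (flag y x u v)
flags-opposite {n} {x} {y} {a} {b} {u} {v} x≢y y≢u y≢v x≢a x≢b a≢u a≢v b≢u b≢v =
    inj₁ (disjoint λ {i} p q → x≢y (trans (sym (x∈⁅y⁆⇒x≡y x p)) (x∈⁅y⁆⇒x≡y y q)))
  , inj₁ (disjoint λ {i} p q → x∈∁p⇒x∉p q (x∈p∪q⁺ (inj₁ p)))
  , inj₁ (disjoint λ {i} p q → x∈∁p⇒x∉p p (x∈p∪q⁺ (inj₁ q)))
  , inj₂ (⊆-antisym (⊆-max _) (λ {i} _ → cover i))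
  where
  disjoint : ∀ {p q : Subset n} → (∀ {i} → i ∈ₛ p → i ∈ₛ q → Data.Empty.⊥) → p ∩ q ≡ ∅
  disjoint {p} {q} h = Empty-unique (λ { (i , e) → h (proj₁ (x∈p∩q⁻ p q e)) (proj₂ (x∈p∩q⁻ p q e)) })
  C₁ C₂ : Subset n
  C₁ = ⁅ y ⁆ ∪ (⁅ a ⁆ ∪ ⁅ b ⁆)
  C₂ = ⁅ x ⁆ ∪ (⁅ u ⁆ ∪ ⁅ v ⁆)
  apart : ∀ {i} → i ≡ y ⊎ (i ≡ a ⊎ i ≡ b) → i ≡ x ⊎ (i ≡ u ⊎ i ≡ v) → Data.Empty.⊥
  apart (inj₁ refl) (inj₁ e) = x≢y (sym e)
  apart (inj₁ refl) (inj₂ (inj₁ e)) = y≢u e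
  apart (inj₁ refl) (inj₂ (inj₂ e)) = y≢v e
  apart (inj₂ (inj₁ refl)) (inj₁ e) = x≢a (sym e)
  apart (inj₂ (inj₁ refl)) (inj₂ (inj₁ e)) = a≢u e
  apart (inj₂ (inj₁ refl)) (inj₂ (inj₂ e)) = a≢v e
  apart (inj₂ (inj₂ refl)) (inj₁ e) = x≢b (sym e)
  apart (inj₂ (inj₂ refl)) (inj₂ (inj₁ e)) = b≢u e
  apart (inj₂ (inj₂ refl)) (inj₂ (inj₂ e)) = b≢v e
  cover : ∀ i → i ∈ₛ ∁ C₁ ∪ ∁ C₂
  cover i with i ∈ₛ? C₁ | i ∈ₛ? C₂
  ... | no ∉C₁ | _ = x∈p∪q⁺ (inj₁ (x∉p⇒x∈∁p ∉C₁))
  ... | yes _ | no ∉C₂ = x∈p∪q⁺ (inj₂ (x∉p⇒x∈∁p ∉C₂))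
  ... | yes ∈C₁ | yes ∈C₂ = contradiction (∈-triple ∈C₂) (apart (∈-triple ∈C₁))

remove-element : ∀ {n k} (p : Subset n) → ∣ p ∣ ≡ suc k → ∃[ y ] ∃[ q ] p ≡ ⁅ y ⁆ ∪ q × y ∉ₛ q × ∣ q ∣ ≡ k
remove-element (inside ∷ p) eq = zero , outside ∷ p , cong (inside ∷_) (sym (∪-identityˡ p)) , (λ ()) , suc-injective eq
remove-element (outside ∷ p) eq with remove-element p eq
... | y , q , refl , y∉q , sz = suc y , outside ∷ q , refl , (λ { (Vec.there y∈q) → y∉q y∈q }) , sz

∣p∣≡0⇒∅ : ∀ {n} (p : Subset n) → ∣ p ∣ ≡ 0 → p ≡ ∅
∣p∣≡0⇒∅ [] _ = refl
∣p∣≡0⇒∅ (outside ∷ p) eq = cong (outside ∷_) (∣p∣≡0⇒∅ p eq)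

∣p∣≡1⇒singleton : ∀ {n} (p : Subset n) → ∣ p ∣ ≡ 1 → ∃[ x ] p ≡ ⁅ x ⁆
∣p∣≡1⇒singleton p eq with remove-element p eq
... | x , q , e , _ , sz = x , trans e (trans (cong (⁅ x ⁆ ∪_) (∣p∣≡0⇒∅ q sz)) (∪-identityʳ ⁅ x ⁆))

∁-involutive : ∀ {n} (p : Subset n) → ∁ (∁ p) ≡ p
∁-involutive p = ⊆-antisym (λ {i} h → x∉∁p⇒x∈p (x∈∁p⇒x∉p h)) (λ {i} h → x∉p⇒x∈∁p (x∈p⇒x∉∁p h))

Distinct : ∀ {n} → Fin n → Fin n → Fin n → Fin n → Set
Distinct x y u v = (x ≢ y × x ≢ u × x ≢ v) × (y ≢ u × y ≢ v) × u ≢ v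

vertex⇒flag : ∀ {n} → 3 ≤ n → (s : Flag2 n) → IsVertex 1 (n ∸ 3) s →
              ∃[ x ] ∃[ y ] ∃[ u ] ∃[ v ] s ≡ flag x y u v × Distinct x y u v
vertex⇒flag {n} 3≤n (A , B) (A⊆B , ∣A∣ , ∣B∣)
  with x , refl ← ∣p∣≡1⇒singleton A ∣A∣
  with y , q₁ , e₁ , y∉ , s₁ ← remove-element (∁ B) (trans (∣∁p∣≡n∸∣p∣ B) (trans (cong (n ∸_) ∣B∣) (m∸[m∸n]≡n 3≤n)))
  with u , q₂ , refl , u∉ , s₂ ← remove-element q₁ s₁
  with v , refl ← ∣p∣≡1⇒singleton q₂ s₂ =
  x , y , u , v , cong (⁅ x ⁆ ,_) (trans (sym (∁-involutive B)) (cong ∁ e₁)) ,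
    (x≢ (x∈p∪q⁺ (inj₁ (x∈⁅x⁆ y))) , x≢ (x∈p∪q⁺ (inj₂ (x∈p∪q⁺ (inj₁ (x∈⁅x⁆ u))))) , x≢ (x∈p∪q⁺ (inj₂ (x∈p∪q⁺ (inj₂ (x∈⁅x⁆ v)))))) ,
    ((λ { refl → y∉ (x∈p∪q⁺ (inj₁ (x∈⁅x⁆ y))) }) , (λ { refl → y∉ (x∈p∪q⁺ (inj₂ (x∈⁅x⁆ y))) })) , (λ { refl → u∉ (x∈⁅x⁆ u) })
  where
  x≢ : ∀ {w} → w ∈ₛ ⁅ y ⁆ ∪ (⁅ u ⁆ ∪ ⁅ v ⁆) → x ≢ w
  x≢ w∈ refl = x∈∁p⇒x∉p (subst (x ∈ₛ_) (sym e₁) w∈) (A⊆B (x∈⁅x⁆ x))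

_≟ᶠ_ : ∀ {n} (s t : Flag2 n) → Dec (s ≡ t)
_≟ᶠ_ = Product.≡-dec (Vec.≡-dec Bool._≟_) (Vec.≡-dec Bool._≟_)

mem : ∀ {n} → List (Flag2 n) → Flag2 n → Bool
mem [] t = false
mem (s ∷ L) t = does (t ≟ᶠ s) ∨ mem L t

mem⇒∈ : ∀ {n} (L : List (Flag2 n)) {t} → mem L t ≡ true → t ∈ L
mem⇒∈ (s ∷ L) {t} e with t ≟ᶠ s
... | yes p = here p
... | no _ = there (mem⇒∈ L e)

distinct : ∀ {n} → Fin n → Fin n → Fin n → Fin n → Bool
distinct x y u v = not (x == y) ∧ (not (x == u) ∧ (not (x == v) ∧ (not (y == u) ∧ (not (y == v) ∧ not (u == v)))))

==-sym : ∀ {n} (u v : Fin n) → u == v ≡ v == u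
==-sym u v with u ≟ v | v ≟ u
... | yes _ | yes _ = refl
... | no _ | no _ = refl
... | yes e | no ne = contradiction (sym e) ne
... | no ne | yes e = contradiction (sym e) ne

∧-left-comm : ∀ a b c → a ∧ (b ∧ c) ≡ b ∧ (a ∧ c)
∧-left-comm a b c = trans (sym (Bool.∧-assoc a b c)) (trans (cong (_∧ c) (Bool.∧-comm a b)) (Bool.∧-assoc b a c))

distinct-swap₁ : ∀ {n} (x y u v : Fin n) → distinct x y u v ≡ distinct x u y v
distinct-swap₁ x y u v rewrite ==-sym u y = trans (∧-left-comm (not (x == y)) (not (x == u)) _)
  (cong (λ b → not (x == u) ∧ (not (x == y) ∧ (not (x == v) ∧ (not (y == u) ∧ b)))) (Bool.∧-comm (not (y == v)) (not (u == v))))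

distinct-swap₂ : ∀ {n} (x y u v : Fin n) → distinct x y u v ≡ distinct x y v u
distinct-swap₂ x y u v rewrite ==-sym v u = cong (not (x == y) ∧_) (trans (∧-left-comm (not (x == u)) (not (x == v)) _)
  (cong (λ b → not (x == v) ∧ (not (x == u) ∧ b)) (∧-left-comm (not (y == u)) (not (y == v)) (not (u == v)))))

not-==-elim : ∀ {n} {u v : Fin n} → not (u == v) ≡ true → u ≢ v
not-==-elim {u = u} e refl = true≢false (==-refl u) (not-true e)

distinct-elim : ∀ {n} {x y u v : Fin n} → distinct x y u v ≡ true → Distinct x y u v
distinct-elim {x = x} {y} {u} {v} e
  with a , e₁ ← ∧-true {not (x == y)} e
  with b , e₂ ← ∧-true {not (x == u)} e₁
  with c , e₃ ← ∧-true {not (x == v)} e₂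
  with d , e₄ ← ∧-true {not (y == u)} e₃
  with f , g ← ∧-true {not (y == v)} e₄ =
  (not-==-elim a , not-==-elim b , not-==-elim c) , (not-==-elim d , not-==-elim f) , not-==-elim g

distinct-intro : ∀ {n} {x y u v : Fin n} → Distinct x y u v → distinct x y u v ≡ true
distinct-intro ((a , b , c) , (d , e) , f) = true-∧ (ne a) (true-∧ (ne b) (true-∧ (ne c) (true-∧ (ne d) (true-∧ (ne e) (ne f)))))
  where
  ne : ∀ {n} {u v : Fin n} → u ≢ v → not (u == v) ≡ true
  ne h = cong not (==-false h)

∑≥2 : ∀ {n} (g : Fin n → ℕ) {a b k} → a ≢ b → k ≤ g a → k ≤ g b → 2 * k ≤ ∑ g
∑≥2 g {a} {b} {k} a≢b ha hb = ≤-trans (≤-reflexive (cong (k +_) (+-identityʳ k))) (≤-trans (+-mono-≤ ha hb)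
  (≤-trans (≤-reflexive (sym (cong₂ _+_ (∑-select a g) (∑-select b g)))) (≤-trans (≤-reflexive (sym (∑-+ (λ u → ⟦ u == a ⟧ * g u) (λ u → ⟦ u == b ⟧ * g u)))) (∑-mono pt))))
  where
  pt : ∀ u → ⟦ u == a ⟧ * g u + ⟦ u == b ⟧ * g u ≤ g u
  pt u with u ≟ a | u ≟ b
  ... | yes refl | yes refl = contradiction refl a≢b
  ... | yes _ | no _ = ≤-reflexive (trans (+-identityʳ _) (+-identityʳ _))
  ... | no _ | yes _ = ≤-reflexive (+-identityʳ _)
  ... | no _ | no _ = z≤n

∑≥3 : ∀ {n} (g : Fin n → ℕ) {a b c k} → a ≢ b → a ≢ c → b ≢ c → k ≤ g a → k ≤ g b → k ≤ g c → 3 * k ≤ ∑ g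
∑≥3 g {a} {b} {c} {k} a≢b a≢c b≢c ha hb hc = ≤-trans (+-mono-≤ hc (∑≥2 g′ a≢b (≤-trans ha (≤-reflexive (sym (g′-at a≢c)))) (≤-trans hb (≤-reflexive (sym (g′-at b≢c))))))
  (≤-trans (≤-reflexive (cong (_+ ∑ g′) (sym (∑-select c g)))) (≤-reflexive (trans (sym (∑-+ (λ u → ⟦ u == c ⟧ * g u) g′)) (∑-cong pt))))
  where
  g′ : Fin _ → ℕ
  g′ u = ⟦ not (u == c) ⟧ * g u
  g′-at : ∀ {u} → u ≢ c → g′ u ≡ g u
  g′-at {u} ne = trans (cong (λ b → ⟦ not b ⟧ * g u) (==-false ne)) (+-identityʳ (g u))
  pt : ∀ u → ⟦ u == c ⟧ * g u + g′ u ≡ g u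
  pt u with u ≟ c
  ... | yes _ = trans (+-identityʳ _) (+-identityʳ _)
  ... | no _ = +-identityʳ _

∑₄ : ∀ {n} → (Fin n → Fin n → Fin n → Fin n → ℕ) → ℕ
∑₄ g = ∑ (λ x → ∑ (λ y → ∑ (λ u → ∑ (g x y u))))

-- A triple of distinct points occurs in all its orders: three choices for the first entry, each
-- with two orders of the rest.
six-orderings : ∀ {n} (h : Fin n → Fin n → Fin n → Fin n → ℕ) →
  (∀ x y u v → h x y u v ≡ h x u y v) → (∀ x y u v → h x y u v ≡ h x y v u) →
  ∀ {x y u v} → y ≢ u → y ≢ v → u ≢ v → 1 ≤ h x y u v → 6 ≤ ∑₄ h
six-orderings h sw₁ sw₂ {x} {y} {u} {v} y≢u y≢v u≢v one = ≤-trans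
  (∑≥3 (λ a → ∑ (λ b → ∑ (h x a b))) y≢u y≢v u≢v
    (two u≢v one (≤-trans one (≤-reflexive (sw₂ x y u v))))
    (two y≢v one₁ (≤-trans one₁ (≤-reflexive (sw₂ x u y v))))
    (two y≢u one₂ (≤-trans one₂ (≤-reflexive (sw₂ x v y u)))))
  (term≤∑ (λ x → ∑ (λ y → ∑ (λ u → ∑ (h x y u)))) x)
  where
  one₁ : 1 ≤ h x u y v
  one₁ = ≤-trans one (≤-reflexive (sw₁ x y u v))
  one₂ : 1 ≤ h x v y u
  one₂ = ≤-trans one (≤-reflexive (trans (sw₂ x y u v) (sw₁ x y v u)))
  two : ∀ {a b c} → b ≢ c → 1 ≤ h x a b c → 1 ≤ h x a c b → 2 ≤ ∑ (λ b → ∑ (h x a b))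
  two {a} {b} {c} b≢c p q = ∑≥2 (λ b → ∑ (h x a b)) b≢c (≤-trans p (term≤∑ (h x a b) c)) (≤-trans q (term≤∑ (h x a c) b))

6*length≤ : ∀ {n} (L : List (Flag2 n)) → 3 ≤ n → All (IsVertex 1 (n ∸ 3)) L → Unique L →
            6 * length L ≤ ∑₄ (λ x y u v → ⟦ mem L (flag x y u v) ∧ distinct x y u v ⟧)
6*length≤ [] _ _ _ = z≤n
6*length≤ {n} (s ∷ L) 3≤n (vs ∷ vL) (s∉ ∷ uL) = begin
  6 * suc (length L) ≡⟨ *-suc 6 (length L) ⟩
  6 + 6 * length L ≤⟨ +-mono-≤ head (6*length≤ L 3≤n vL uL) ⟩
  ∑₄ h + ∑₄ r ≡⟨ sym (∑₄-+ h r) ⟩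
  ∑₄ (λ x y u v → h x y u v + r x y u v) ≤⟨ ∑-mono (λ x → ∑-mono (λ y → ∑₂-mono (pt x y))) ⟩
  ∑₄ (λ x y u v → ⟦ mem (s ∷ L) (flag x y u v) ∧ distinct x y u v ⟧) ∎
  where
  open ≤-Reasoning
  h r : Fin n → Fin n → Fin n → Fin n → ℕ
  h x y u v = ⟦ does (flag x y u v ≟ᶠ s) ∧ distinct x y u v ⟧
  r x y u v = ⟦ mem L (flag x y u v) ∧ distinct x y u v ⟧
  ∑₄-+ : ∀ g g′ → ∑₄ (λ x y u v → g x y u v + g′ x y u v) ≡ ∑₄ g + ∑₄ g′
  ∑₄-+ g g′ = trans (∑-cong (λ x → ∑-cong (λ y → ∑₂-+ (g x y) (g′ x y)))) (∑₂-+ (λ x y → ∑ (λ u → ∑ (g x y u))) (λ x y → ∑ (λ u → ∑ (g′ x y u))))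
  pt : ∀ x y u v → h x y u v + r x y u v ≤ ⟦ mem (s ∷ L) (flag x y u v) ∧ distinct x y u v ⟧
  pt x y u v with flag x y u v ≟ᶠ s | mem L (flag x y u v) in m | distinct x y u v
  -- Uniqueness of the list keeps the head from being counted again in the tail.
  ... | yes refl | true | _ = contradiction refl (All.lookup s∉ (mem⇒∈ L m))
  ... | yes _ | false | true = ≤-refl
  ... | yes _ | false | false = z≤n
  ... | no _ | _ | _ = ≤-refl
  head : 6 ≤ ∑₄ h
  head with vertex⇒flag 3≤n s vs
  ... | x , y , u , v , e , D = six-orderings h
      (λ x y u v → cong₂ (λ t b → ⟦ does (t ≟ᶠ s) ∧ b ⟧) (flag-swap₁ x y u v) (distinct-swap₁ x y u v))
      (λ x y u v → cong₂ (λ t b → ⟦ does (t ≟ᶠ s) ∧ b ⟧) (flag-swap₂ x y u v) (distinct-swap₂ x y u v))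
      {x} (proj₁ (proj₁ (proj₂ D))) (proj₂ (proj₁ (proj₂ D))) (proj₂ (proj₂ D))
      (≤-reflexive (sym (cong ⟦_⟧ (true-∧ (same (sym e)) (distinct-intro D)))))
    where
    same : ∀ {t} → t ≡ s → does (t ≟ᶠ s) ≡ true
    same {t} e with t ≟ᶠ s
    ... | yes _ = refl
    ... | no ne = contradiction e ne

family : ∀ {n a b} (L : List (Flag2 n)) → IsIndependentSet n a b L → Family n
family L (_ , _ , independent) = record
  { S = λ _ → true
  ; f = λ x y u v → mem L (flag x y u v) ∧ distinct x y u v
  ; f-swap₁ = λ x y u v → cong₂ (λ s b → mem L s ∧ b) (flag-swap₁ x y u v) (distinct-swap₁ x y u v)
  ; f-swap₂ = λ x y u v → cong₂ (λ s b → mem L s ∧ b) (flag-swap₂ x y u v) (distinct-swap₂ x y u v)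
  ; f-dom = λ _ → refl , refl
  ; f-irr = λ {x} {y} {u} {v} e → let (xy , _) , (yu , _) , _ = distinct-elim (proj₂ (∧-true {mem L (flag x y u v)} e)) in xy , yu
  ; f-cross = cross
  }
  where
  cross : ∀ x y → x ≢ y → ∀ {a b} → mem L (flag x y a b) ∧ distinct x y a b ≡ true →
          Meets a b (λ u v → mem L (flag y x u v) ∧ distinct y x u v)
  cross x y x≢y {a} {b} e {u} {v} e′ with u ≟ a | v ≟ a | u ≟ b | v ≟ b
  ... | yes p | _ | _ | _ = inj₁ (inj₁ p)
  ... | no _ | yes p | _ | _ = inj₁ (inj₂ p)
  ... | no _ | no _ | yes p | _ = inj₂ (inj₁ p)
  ... | no _ | no _ | no _ | yes p = inj₂ (inj₂ p)
  ... | no ua | no va | no ub | no vb with ∧-true {mem L (flag x y a b)} e | ∧-true {mem L (flag y x u v)} e′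
  ... | m , d | m′ , d′ with distinct-elim {x = x} {y} {a} {b} d | distinct-elim {x = y} {x} {u} {v} d′
  ... | (_ , xa , xb) , _ | (_ , yu , yv) , _ = contradiction
    (flags-opposite x≢y yu yv xa xb (λ p → ua (sym p)) (λ p → va (sym p)) (λ p → ub (sym p)) (λ p → vb (sym p)))
    (independent (mem⇒∈ L m) (mem⇒∈ L m′) (λ p → x≢y (x∈⁅y⁆⇒x≡y y (subst (x ∈ₛ_) (cong proj₁ p) (x∈⁅x⁆ x)))))

independent-bound : ∀ k (L : List (Flag2 (9 + k))) → IsIndependentSet (9 + k) 1 (6 + k) L → length L ≤ (9 + k) C 4 + 42
independent-bound k L I@(vertices , unique , _) = *-cancelˡ-≤ 6 (≤-trans (6*length≤ L (m≤m+n 3 (6 + k)) vertices unique)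
  (total-bound k (family L I) (∑-ones (9 + k))))

-- The extremal example

choose : ∀ (n k : ℕ) → List (Subset n)
choose n zero = ∅ ∷ []
choose zero (suc k) = []
choose (suc n) (suc k) = map (inside ∷_) (choose n k) ++ map (outside ∷_) (choose n (suc k))

length-choose : ∀ n k → length (choose n k) ≡ n C k
length-choose zero zero = refl
length-choose (suc n) zero = refl
length-choose zero (suc k) = refl
length-choose (suc n) (suc k) = trans (length-++ (map (inside ∷_) (choose n k)))
  (trans (cong₂ _+_ (trans (length-map (inside ∷_) (choose n k)) (length-choose n k))
                    (trans (length-map (outside ∷_) (choose n (suc k))) (length-choose n (suc k))))
    (nCk+nC[k+1]≡[n+1]C[k+1] n k))

choose-size : ∀ n k → All (λ p → ∣ p ∣ ≡ k) (choose n k)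
choose-size n zero = ∣⊥∣≡0 n ∷ []
choose-size zero (suc k) = []
choose-size (suc n) (suc k) = All.++⁺ (All.map⁺ (All.map (cong suc) (choose-size n k))) (All.map⁺ (choose-size n (suc k)))

choose-unique : ∀ n k → Unique (choose n k)
choose-unique n zero = [] ∷ []
choose-unique zero (suc k) = []
choose-unique (suc n) (suc k) = Unique.++⁺ (Unique.map⁺ Vec.∷-injectiveʳ (choose-unique n k)) (Unique.map⁺ Vec.∷-injectiveʳ (choose-unique n (suc k))) apart
  where
  apart : ∀ {p} → p ∈ map (inside ∷_) (choose n k) × p ∈ map (outside ∷_) (choose n (suc k)) → Data.Empty.⊥
  apart (i , o) with ∈-map⁻ (inside ∷_) i | ∈-map⁻ (outside ∷_) o
  ... | _ , _ , refl | _ , _ , ()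

-- A new point, placed on top: it represents every 4-set containing it.
extend : ∀ {n} → Flag2 n → Flag2 (suc n)
extend (A , B) = outside ∷ A , inside ∷ B

topFlag : ∀ {n} → Subset n → Flag2 (suc n)
topFlag C = inside ∷ ∅ , inside ∷ ∁ C

add-top : ∀ n → List (Flag2 n) → List (Flag2 (suc n))
add-top n L = map extend L ++ map topFlag (choose n 3)

-- Flags marked by the new point share their mark, so they are not opposite to each other. Nor are
-- they opposite to an extended flag, whose large set contains the new point. Two extended flags are
-- opposite only if the original flags were.
add-top-independent : ∀ {n} L → 3 ≤ n → IsIndependentSet n 1 (n ∸ 3) L → IsIndependentSet (suc n) 1 (suc n ∸ 3) (add-top n L)
add-top-independent {n} L 3≤n (vertices , unique , independent) =
    All.++⁺ (All.map⁺ (All.map extended vertices)) (All.map⁺ (All.map top-vertex (choose-size n 3)))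
  , Unique.++⁺ (Unique.map⁺ (λ { refl → refl }) unique) (Unique.map⁺ (λ e → ∁-injective (Vec.∷-injectiveʳ (cong proj₂ e))) (choose-unique n 3)) apart
  , λ x∈ y∈ x≢y → no-edge (∈-++⁻ (map extend L) x∈) (∈-++⁻ (map extend L) y∈) x≢y
  where
  suc-∸ : suc n ∸ 3 ≡ suc (n ∸ 3)
  suc-∸ = +-∸-assoc 1 3≤n
  extended : ∀ {s} → IsVertex 1 (n ∸ 3) s → IsVertex 1 (suc n ∸ 3) (extend s)
  extended (A⊆B , ∣A∣ , ∣B∣) = (λ { (Vec.there p) → Vec.there (A⊆B p) }) , ∣A∣ , trans (cong suc ∣B∣) (sym suc-∸)
  top-vertex : ∀ {C} → ∣ C ∣ ≡ 3 → IsVertex 1 (suc n ∸ 3) (topFlag C)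
  top-vertex {C} e = (λ { Vec.here → Vec.here ; (Vec.there p) → contradiction p ∉⊥ }) , cong suc (∣⊥∣≡0 n) ,
    trans (cong suc (trans (∣∁p∣≡n∸∣p∣ C) (cong (n ∸_) e))) (sym suc-∸)
  ∁-injective : ∀ {p q : Subset n} → ∁ p ≡ ∁ q → p ≡ q
  ∁-injective {p} {q} e = trans (sym (∁-involutive p)) (trans (cong ∁ e) (∁-involutive q))
  apart : ∀ {s} → s ∈ map extend L × s ∈ map topFlag (choose n 3) → Data.Empty.⊥
  apart (i , o) with ∈-map⁻ extend i | ∈-map⁻ topFlag o
  ... | _ , _ , refl | _ , _ , ()
  not-full : ∀ {B : Subset n} {b} → ∣ B ∣ ≡ n ∸ 3 → b ∷ B ≢ whole
  not-full {B} e p = <⇒≢ (∸-monoʳ-< {n} {3} {0} (s≤s z≤n) 3≤n) (trans (sym e) (trans (cong ∣_∣ (Vec.∷-injectiveʳ p)) (∣⊤∣≡n n)))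
  lower : ∀ {s t} → OppositeFlags (extend s) (extend t) → OppositeFlags s t
  lower (inj₁ p , q , r , inj₂ w) = inj₁ (Vec.∷-injectiveʳ p) , side {outside} {inside} q , side {inside} {outside} r , inj₂ (Vec.∷-injectiveʳ w)
    where
    side : ∀ {a b} {p q : Subset n} → Opposite (a ∷ p) (b ∷ q) → Opposite p q
    side (inj₁ e) = inj₁ (Vec.∷-injectiveʳ e)
    side (inj₂ e) = inj₂ (Vec.∷-injectiveʳ e)
  no-edge : ∀ {s t} → s ∈ map extend L ⊎ s ∈ map topFlag (choose n 3) → t ∈ map extend L ⊎ t ∈ map topFlag (choose n 3) →
            s ≢ t → ¬ OppositeFlags s t
  no-edge (inj₁ i) (inj₁ j) s≢t opp with ∈-map⁻ extend i | ∈-map⁻ extend j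
  ... | s , s∈ , refl | t , t∈ , refl = independent s∈ t∈ (λ e → s≢t (cong extend e)) (lower opp)
  no-edge (inj₁ i) (inj₂ j) _ opp with ∈-map⁻ extend i | ∈-map⁻ topFlag j
  -- The mark meets the large set, so only the alternative that their union is everything remains.
  -- It fails because the large set misses three old points.
  no-edge (inj₁ i) (inj₂ j) _ (_ , _ , inj₂ e , _) | s , s∈ , refl | C , C∈ , refl =
    not-full (proj₂ (proj₂ (All.lookup vertices s∈))) (trans (sym (cong (inside ∷_) (∪-identityʳ _))) e)
  no-edge (inj₂ i) (inj₁ j) _ opp with ∈-map⁻ topFlag i | ∈-map⁻ extend j
  no-edge (inj₂ i) (inj₁ j) _ (_ , inj₂ e , _ , _) | C , C∈ , refl | t , t∈ , refl =
    not-full (proj₂ (proj₂ (All.lookup vertices t∈))) (trans (sym (cong (inside ∷_) (∪-identityˡ _))) e)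
  no-edge (inj₂ i) (inj₂ j) _ opp with ∈-map⁻ topFlag i | ∈-map⁻ topFlag j
  no-edge (inj₂ i) (inj₂ j) _ (inj₂ e , _) | C , _ , refl | D , _ , refl =
    contradiction (trans (sym (∣⊥∣≡0 n)) (trans (cong ∣_∣ (trans (sym (∪-identityʳ ∅)) (Vec.∷-injectiveʳ e))) (∣⊤∣≡n n)))
      (λ n≡0 → contradiction (≤-trans 3≤n (≤-reflexive (sym n≡0))) λ ())

-- On nine points, every 4-set containing the first point is represented by its other three points.
base : List (Flag2 9)
base = concatMap (λ B → map (λ x → outside ∷ ⁅ x ⁆ , outside ∷ B) (filter (λ x → x ∈ₛ? B) (allFin 8))) (choose 8 6)

disjoint⇒small : ∀ {n} (p q : Subset n) → p ∩ q ≡ ∅ → ∣ p ∣ + ∣ q ∣ ≤ n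
disjoint⇒small [] [] _ = z≤n
disjoint⇒small (inside ∷ p) (outside ∷ q) e = s≤s (disjoint⇒small p q (Vec.∷-injectiveʳ e))
disjoint⇒small (outside ∷ p) (inside ∷ q) e = ≤-trans (≤-reflexive (+-suc ∣ p ∣ ∣ q ∣)) (s≤s (disjoint⇒small p q (Vec.∷-injectiveʳ e)))
disjoint⇒small (outside ∷ p) (outside ∷ q) e = m≤n⇒m≤1+n (disjoint⇒small p q (Vec.∷-injectiveʳ e))

-- The large sets alone are never opposite: all of them miss the first point, so no union is
-- everything, and two 6-subsets of nine points intersect.
base-independent : IsIndependentSet 9 1 6 base
base-independent = vertices , toWitness {a? = Unique.unique? _≟ᶠ_ base} tt , no-edge
  where
  vertices : All (IsVertex 1 6) base
  vertices = toWitness {a? = All.all? (λ { (A , B) → A ⊆? B ×-dec (∣ A ∣ Data.Nat.≟ 1 ×-dec ∣ B ∣ Data.Nat.≟ 6) }) base} tt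
  low : All (λ s → Vec.head (proj₂ s) ≡ outside) base
  low = toWitness {a? = All.all? (λ s → Vec.head (proj₂ s) Bool.≟ outside) base} tt
  meet : ∀ (B B′ : Subset 9) → ∣ B ∣ ≡ 6 → ∣ B′ ∣ ≡ 6 → Vec.head B ≡ outside → Vec.head B′ ≡ outside → ¬ Opposite B B′
  meet B B′ e e′ _ _ (inj₁ d) = contradiction (≤-trans (≤-reflexive (sym (cong₂ _+_ e e′))) (disjoint⇒small B B′ d)) (λ le → contradiction (≤ᵇ-intro {12} {9} le) λ ())
  meet (outside ∷ B) (outside ∷ B′) _ _ refl refl (inj₂ ())
  no-edge : ∀ {s t} → s ∈ base → t ∈ base → s ≢ t → ¬ OppositeFlags s t
  no-edge {_ , B} {_ , B′} s∈ t∈ _ (_ , _ , _ , opp) = meet B B′ (proj₂ (proj₂ (All.lookup vertices s∈))) (proj₂ (proj₂ (All.lookup vertices t∈)))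
    (All.lookup low s∈) (All.lookup low t∈) opp

large-independent : ∀ k → Σ (List (Flag2 (9 + k))) λ L → IsIndependentSet (9 + k) 1 (6 + k) L × length L ≡ (9 + k) C 4 + 42
large-independent zero = base , base-independent , refl
large-independent (suc k) with large-independent k
... | L , I , len = add-top (9 + k) L , add-top-independent L (m≤m+n 3 (6 + k)) I , (begin
  length (add-top (9 + k) L) ≡⟨ length-++ (map extend L) ⟩
  length (map extend L) + length (map topFlag (choose (9 + k) 3))
    ≡⟨ cong₂ _+_ (trans (length-map extend L) len) (trans (length-map topFlag (choose (9 + k) 3)) (length-choose (9 + k) 3)) ⟩
  ((9 + k) C 4 + 42) + (9 + k) C 3 ≡⟨ rot ((9 + k) C 4) ((9 + k) C 3) ⟩
  ((9 + k) C 3 + (9 + k) C 4) + 42 ≡⟨ cong (_+ 42) (nCk+nC[k+1]≡[n+1]C[k+1] (9 + k) 3) ⟩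
  (10 + k) C 4 + 42 ∎)
  where
  open ≡-Reasoning
  rot : ∀ a b → (a + 42) + b ≡ (b + a) + 42
  rot = solve-∀

theorem1p3 : ∀ (n : ℕ) → 9 ≤ n → IsIndependenceNumber n 1 (n ∸ 3) (n C 4 + 42)
theorem1p3 n 9≤n = subst (λ n → IsIndependenceNumber n 1 (n ∸ 3) (n C 4 + 42)) (m+[n∸m]≡n 9≤n)
  (large-independent (n ∸ 9) , independent-bound (n ∸ 9))
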